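{- There is an algorithm that, given a (directed or undirected) edge-labeled graph $G$ with $m$ edges, identifies in $O(m)$ time all edges of $G$ that belong to nonrepetitive cycles of $G$.
   Context: Graphs are finite, each edge carries one label, and multiple edges are allowed. Isolated vertices are disregarded. A cycle is a closed path, not required to be simple (it may repeat vertices and edges; in a directed graph it follows edge directions, in an undirected graph edges may be traversed in either direction). A cycle is nonrepetitive if no two cyclically consecutive edges of it (including the last edge followed by the first) share the same label. The edges incident to each vertex of the input are assumed to be given grouped according to their labels. Running times are on a standard random-access machine. -}

module Defs where

open import Data.Bool.Base using (if_then_else_)
open import Data.Fin.Base as Fin using (Fin; toℕ)
open import Data.List.Base
  using (List; []; _∷_; _++_; _∷ʳ_; map; concatMap; length; lookup; head; drop; allFin)
open import Data.List.Membership.Propositional using (_∈_)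
open import Data.List.Relation.Unary.Linked using (Linked)
open import Data.List.Relation.Unary.Unique.Propositional using (Unique)
open import Data.Maybe.Base using (Maybe; just; nothing; fromMaybe)
open import Data.Nat.Base using (ℕ; zero; suc; _+_; _∸_; _*_; _≤_; _≡ᵇ_)
open import Data.Product.Base using (∃-syntax; _×_)
open import Data.Sum.Base using (_⊎_)
open import Data.Unit.Base using (⊤)
open import Function.Bundles using (_⇔_)
open import Relation.Binary.PropositionalEquality.Core using (_≡_; _≢_)
open import Relation.Nullary.Negation.Core using (¬_)

------------------------------------------------------------------------
-- Edge-labeled multigraphs

data Kind : Set where
  directed undirected : Kind

-- Parallel edges and self-loops are allowed.  For an undirected graph the
-- choice of which endpoint is the source carries no meaning.
record Graph : Set where
  field
    kind            : Kind
    #vertices       : ℕ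
    #edges          : ℕ
    source target   : Fin #edges → Fin #vertices
    label           : Fin #edges → ℕ

  Vertex : Set
  Vertex = Fin #vertices

  Edge : Set
  Edge = Fin #edges

  Incident : Edge → Vertex → Set
  Incident e v = source e ≡ v ⊎ target e ≡ v

  field
    no-isolated     : ∀ v → ∃[ e ] Incident e v

module _ (G : Graph) where
  open Graph G

  data Traverses : Edge → Vertex → Vertex → Set where
    forward  : ∀ e → Traverses e (source e) (target e)
    backward : kind ≡ undirected → ∀ e → Traverses e (target e) (source e)

  data Walk : Vertex → Vertex → List Edge → Set where
    []  : ∀ {v} → Walk v v []
    _∷_ : ∀ {u v w e es} → Traverses e u v → Walk v w es → Walk u w (e ∷ es)

  Cycle : List Edge → Set
  Cycle es = ∃[ v ] Walk v v es

  -- The first edge is repeated at the end so that the last edge is also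
  -- compared with the first.  In particular a closed walk consisting of a
  -- single self-loop is repetitive.
  Nonrepetitive : List Edge → Set
  Nonrepetitive []       = ⊤
  Nonrepetitive (e ∷ es) = Linked (λ a b → label a ≢ label b) ((e ∷ es) ∷ʳ e)

  OnNonrepetitiveCycle : Edge → Set
  OnNonrepetitiveCycle e = ∃[ es ] (Cycle es × Nonrepetitive es × e ∈ es)

  -- Edges with equal labels occupy a contiguous block of the list; the
  -- blocks may come in any order.
  Grouped : List Edge → Set
  Grouped es = ∀ i j k → i Fin.≤ j → j Fin.≤ k →
    label (lookup es i) ≡ label (lookup es k) →
    label (lookup es j) ≡ label (lookup es i)

-- One list per vertex; in a directed graph it holds outgoing and incoming
-- edges together, and a self-loop is listed once.
record GroupedIncidence (G : Graph) : Set where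
  open Graph G
  field
    incident : Vertex → List Edge
    complete : ∀ v e → e ∈ incident v ⇔ Incident e v
    unique   : ∀ v → Unique (incident v)
    grouped  : ∀ v → Grouped G (incident v)

------------------------------------------------------------------------
-- Random-access machine with unit-cost instructions, after Cook and
-- Reckhow: copying, addition, (truncated) subtraction, indirect
-- addressing and conditional jumps, but no multiplication.

Reg : Set
Reg = ℕ

data Instr : Set where
  const : (r : Reg) (n : ℕ) → Instr    -- r := n
  add   : (r s t : Reg) → Instr        -- r := s + t
  sub   : (r s t : Reg) → Instr        -- r := s ∸ t
  load  : (r s : Reg) → Instr          -- r := memory[s]
  store : (r s : Reg) → Instr          -- memory[r] := s
  jump  : (l : ℕ) → Instr              -- goto l
  jzero : (r : Reg) (l : ℕ) → Instr    -- if r = 0 then goto l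

Program : Set
Program = List Instr

record State : Set where
  constructor ⟨_,_,_⟩
  field
    pc     : ℕ
    regs   : Reg → ℕ
    memory : ℕ → ℕ
open State public

nth : ∀ {A : Set} → List A → ℕ → Maybe A
nth xs i = head (drop i xs)

_[_↦_] : (ℕ → ℕ) → ℕ → ℕ → (ℕ → ℕ)
(f [ a ↦ x ]) b = if a ≡ᵇ b then x else f b

exec : Instr → State → State
exec (const r n) ⟨ p , R , M ⟩ = ⟨ suc p , R [ r ↦ n ] , M ⟩
exec (add r s t) ⟨ p , R , M ⟩ = ⟨ suc p , R [ r ↦ R s + R t ] , M ⟩
exec (sub r s t) ⟨ p , R , M ⟩ = ⟨ suc p , R [ r ↦ R s ∸ R t ] , M ⟩
exec (load r s)  ⟨ p , R , M ⟩ = ⟨ suc p , R [ r ↦ M (R s) ] , M ⟩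
exec (store r s) ⟨ p , R , M ⟩ = ⟨ suc p , R , M [ R r ↦ R s ] ⟩
exec (jump l)    ⟨ p , R , M ⟩ = ⟨ l , R , M ⟩
exec (jzero r l) ⟨ p , R , M ⟩ = ⟨ (if R r ≡ᵇ 0 then l else suc p) , R , M ⟩

-- The machine halts when the program counter leaves the program.
Halted : Program → State → Set
Halted P s = nth P (pc s) ≡ nothing

step : Program → State → State
step P s with nth P (pc s)
... | just i  = exec i s
... | nothing = s

run : Program → ℕ → State → State
run P zero    s = s
run P (suc t) s = run P t (step P s)

initial : List ℕ → State
initial input = ⟨ 0 , (λ _ → 0) , (λ a → fromMaybe 0 (nth input a)) ⟩

------------------------------------------------------------------------
-- Input and output conventions

kindFlag : Kind → ℕ
kindFlag directed   = 0
kindFlag undirected = 1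

-- Header (kind, #vertices, #edges), then three words per edge, then for
-- each vertex its number of incident edges followed by those edges.
encode : (G : Graph) → GroupedIncidence G → List ℕ
encode G I =
  (kindFlag kind ∷ #vertices ∷ #edges ∷ [])
  ++ concatMap (λ e → toℕ (source e) ∷ toℕ (target e) ∷ label e ∷ [])
       (allFin #edges)
  ++ concatMap (λ v → length (incident v) ∷ map toℕ (incident v))
       (allFin #vertices)
  where
  open Graph G
  open GroupedIncidence I

-- The answer overwrites memory cells 0, …, #edges − 1, one 0/1 flag per edge.
Identifies : (G : Graph) → (Graph.Edge G → Set) → State → Set
Identifies G Q s = ∀ e →
  (Q e × memory s (toℕ e) ≡ 1) ⊎ (¬ Q e × memory s (toℕ e) ≡ 0)

-- The bound is c (m + 1) rather than c m because even the graph without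
-- edges takes a constant number of steps.
IdentifiesInLinearTime : Program → ((G : Graph) → Graph.Edge G → Set) → Set
IdentifiesInLinearTime P Q =
  ∃[ c ] ∀ (G : Graph) (I : GroupedIncidence G) →
    ∃[ t ] (t ≤ c * suc (Graph.#edges G)
      × Halted P (run P t (initial (encode G I)))
      × Identifies G (Q G) (run P t (initial (encode G I))))

-- Concatenating the incidence lists gives at most 2 m positions, each standing
-- for the departure from a vertex along an edge (in a directed graph only the
-- positions at the source are active).  An edge lies on a nonrepetitive cycle
-- iff the position at its source reaches itself in the relation "arrive along
-- the edge, then depart from the position of an edge with another label"; for
-- undirected graphs this uses that a chain of positions can be reversed.  That
-- relation may have quadratically many pairs, but since equal labels are adjacent it
-- is the reachability relation of a digraph with six nodes per position and
-- degrees at most two: from an arrival one walks to the right (or left) through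
-- the positions with the same label, then on through those beyond, each of which
-- has an exit to its departure.  So it remains to compute strongly connected
-- components in linear time.  This is done with Kosaraju's two passes, a depth
-- first search and a backward sweep in the order of decreasing finishing times.
--
-- The algorithm is written in a small language of arrays whose loops have
-- loop-free bodies, so that its running time is the number of iterations up to
-- a constant factor; potential functions bound these numbers.
module Submission where

open import Data.Bool.Base using (Bool; T; _∧_; false; if_then_else_; not; true)
open import Data.Bool.Properties using (T-∧)
open import Data.Fin.Base as Fin using (Fin; join; splitAt; toℕ)
import Data.Fin.Properties as Fin
open import Data.Fin.Properties using (injective⇒≤; splitAt-join; toℕ-injective; toℕ<n)
open import Data.List.Base using (List; []; _++_; _∷_; _∷ʳ_; allFin; concatMap; drop; head; length; lookup; map; tabulate)
open import Data.List.Membership.Propositional using (_∈_; _∉_)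
open import Data.List.Membership.Propositional.Properties using (∈-++⁻; ∈-allFin; ∈-concatMap⁺; ∈-map⁺)
open import Data.List.Properties using (++-assoc; ++-identityʳ; length-++; length-map; length-tabulate; map-++; map-∘)
open import Data.List.Relation.Unary.All as All using (All; []; _∷_)
open import Data.List.Relation.Unary.AllPairs using ([]; _∷_)
import Data.List.Relation.Unary.Any as Any
open import Data.List.Relation.Unary.Any using (here; there)
open import Data.List.Relation.Unary.Linked as Linked using (Linked; [-]; []; _∷_)
open import Data.List.Relation.Unary.Unique.Propositional using (Unique)
open import Data.List.Relation.Unary.Unique.Propositional.Properties using (allFin⁺)
open import Data.Maybe.Base using (fromMaybe; just; nothing)
open import Data.Maybe.Properties using (just-injective)
open import Data.Nat.Base
open import Data.Nat.DivMod using ([m+kn]%n≡m%n; _%_; m<n⇒m%n≡m)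
open import Data.Nat.Properties
open import Data.Nat.Solver using (module +-*-Solver)
open import Data.Product.Base using (_,_; _×_; proj₁; proj₂; Σ; ∃-syntax)
open import Data.Product.Properties using (,-injective)
open import Data.Sum.Base using (_⊎_; inj₁; inj₂)
open import Data.Unit.Base using (tt; ⊤)
open import Defs
open import Function.Base using (_∘_)
open import Function.Bundles using (Equivalence)
open import Relation.Binary.Construct.Closure.ReflexiveTransitive using (Star; _◅_; _◅◅_; ε)
open import Relation.Binary.PropositionalEquality
open import Relation.Nullary.Decidable.Core using (Dec; no; yes)
open import Relation.Nullary.Negation using (contradiction; ¬_)
open +-*-Solver using (solve; _:=_; _:+_; _:*_; con)
open import Data.List.Membership.DecPropositional _≟_ using (_∈?_)

-- Structured register programs

-- Cycles may repeat vertices and edges, and the label condition concerns only consecutive edges.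
-- Once departures along edges are the points, it becomes a condition on single steps, and the step
-- that closes the cycle is like all others. So reachability is all that has to be decided.
-- Departure and arrival of an edge are separate nodes joined by an arc. Hence the edge lies on a
-- closed chain iff these two nodes share a component, and components with a single node need no
-- special treatment. Labels may be arbitrarily large. They are only tested for equality, and only
-- between neighbouring positions of one vertex, which is the information that the gadget requires.
-- The correctness of the component search avoids numeric finishing times and the white-path
-- theorem. Both passes rest on one property of the finishing list, `Good`, preserved because the
-- search stack is a path of the digraph.

Store : Set
Store = (Reg → ℕ) × (ℕ → ℕ)

straight? : Instr → Bool
straight? (jump _)    = false
straight? (jzero _ _) = false
straight? _           = true

data Cmd : Set where
  skip : Cmd
  op   : (i : Instr) {_ : T (straight? i)} → Cmd
  _⨾_  : Cmd → Cmd → Cmd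
  ifz  : Reg → Cmd → Cmd → Cmd

infixr 5 _⨾_

choose : {A : Set} → ℕ → A → A → A
choose zero    a b = a
choose (suc _) a b = b

-- Conditionals are executed symbolically through this eliminator. Its motive speaks only of the
-- resulting value, so the goal need not be abstracted over the tested number.
choose-elim : {A : Set} (P : A → Set) (n : ℕ) {a b : A} →
              (n ≡ 0 → P a) → (n ≢ 0 → P b) → P (choose n a b)
choose-elim P zero    f g = f refl
choose-elim P (suc n) f g = g (λ ())

choose-zero : {A : Set} {n : ℕ} {a b : A} → n ≡ 0 → choose n a b ≡ a
choose-zero refl = refl

choose-nonzero : {A : Set} {n : ℕ} {a b : A} → n ≢ 0 → choose n a b ≡ b
choose-nonzero {n = zero}  n≢0 = contradiction refl n≢0
choose-nonzero {n = suc _} n≢0 = refl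

effect : Instr → Store → Store
effect i (R , M) = let s = exec i ⟨ 0 , R , M ⟩ in regs s , memory s

⟦_⟧₁ : Cmd → Store → Store
⟦ skip ⟧₁      σ = σ
⟦ op i ⟧₁      σ = effect i σ
⟦ c ⨾ d ⟧₁     σ = ⟦ d ⟧₁ (⟦ c ⟧₁ σ)
⟦ ifz r c d ⟧₁ σ = choose (proj₁ σ r) (⟦ c ⟧₁ σ) (⟦ d ⟧₁ σ)

size : Cmd → ℕ
size skip        = 0
size (op _)      = 1
size (c ⨾ d)     = size c + size d
size (ifz _ c d) = suc (size d + suc (size c))

-- Jump targets are absolute, hence the start address `a`. The nonzero branch comes first because
-- `jzero` falls through to it.
flat : Cmd → ℕ → List Instr
flat skip        a = []
flat (op i)      a = i ∷ []
flat (c ⨾ d)     a = flat c a ++ flat d (a + size c)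
flat (ifz r c d) a =
  jzero r (suc a + suc (size d)) ∷
  flat d (suc a) ++ jump (a + size (ifz r c d)) ∷ flat c (suc a + suc (size d))

length-flat : ∀ c a → length (flat c a) ≡ size c
length-flat skip        a = refl
length-flat (op i)      a = refl
length-flat (c ⨾ d)     a = trans (length-++ (flat c a))
  (cong₂ _+_ (length-flat c a) (length-flat d (a + size c)))
length-flat (ifz r c d) a = cong suc (trans (length-++ (flat d (suc a)))
  (cong₂ (λ m n → m + suc n) (length-flat d (suc a))
                             (length-flat c (suc a + suc (size d)))))

CodeAt : Program → ℕ → List Instr → Set
CodeAt P a []       = ⊤
CodeAt P a (i ∷ is) = nth P a ≡ just i × CodeAt P (suc a) is

CodeAt-++ : ∀ P a is {js} → CodeAt P a (is ++ js) →
            CodeAt P a is × CodeAt P (a + length is) js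
CodeAt-++ P a [] {js} code = tt , subst (λ b → CodeAt P b js) (sym (+-identityʳ a)) code
CodeAt-++ P a (i ∷ is) {js} (now , rest) with CodeAt-++ P (suc a) is rest
... | l , r = (now , l) , subst (λ b → CodeAt P b js) (sym (+-suc a (length is))) r

drop-suc : ∀ {A : Set} (xs : List A) a {x ys} → drop a xs ≡ x ∷ ys → drop (suc a) xs ≡ ys
drop-suc (x ∷ xs) zero    refl = refl
drop-suc (x ∷ xs) (suc a) eq   = drop-suc xs a eq

CodeAt-drop : ∀ P a is → drop a P ≡ is → CodeAt P a is
CodeAt-drop P a []       eq = tt
CodeAt-drop P a (i ∷ is) eq = cong head eq , CodeAt-drop P (suc a) is (drop-suc P a eq)

run-+ : ∀ P m n s → run P (m + n) s ≡ run P n (run P m s)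
run-+ P zero    n s = refl
run-+ P (suc m) n s = run-+ P m n (step P s)

place : ℕ → Store → State
place a (R , M) = ⟨ a , R , M ⟩

-- The index is an upper bound on the steps, not their exact number: the two branches of `ifz`
-- differ in length, yet both are charged the size of the whole command.
_⊢_⟶[_]_ : Program → State → ℕ → State → Set
P ⊢ s ⟶[ t ] s' = ∃[ n ] (n ≤ t × run P n s ≡ s')

⟶-trans : ∀ {P s₁ s₂ s₃ t u} → P ⊢ s₁ ⟶[ t ] s₂ → P ⊢ s₂ ⟶[ u ] s₃ → P ⊢ s₁ ⟶[ t + u ] s₃
⟶-trans {P} {s₁} (m , m≤ , p) (n , n≤ , q) =
  m + n , +-mono-≤ m≤ n≤ , trans (run-+ P m n s₁) (trans (cong (run P n) p) q)

⟶-weaken : ∀ {P s s' t u} → t ≤ u → P ⊢ s ⟶[ t ] s' → P ⊢ s ⟶[ u ] s'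
⟶-weaken t≤u (n , n≤ , p) = n , ≤-trans n≤ t≤u , p

⟶-place : ∀ {P s σ t a b} → a ≡ b → P ⊢ s ⟶[ t ] place a σ → P ⊢ s ⟶[ t ] place b σ
⟶-place refl x = x

step-place : ∀ P {i} s → nth P (pc s) ≡ just i → step P s ≡ exec i s
step-place P s eq with nth P (pc s)
step-place P s refl | just _ = refl

⟶-step : ∀ P {i} s → nth P (pc s) ≡ just i → P ⊢ s ⟶[ 1 ] exec i s
⟶-step P s eq = 1 , ≤-refl , step-place P s eq

exec-straight : ∀ i → T (straight? i) → ∀ a σ → exec i (place a σ) ≡ place (suc a) (effect i σ)
exec-straight (const r n) _ a σ = refl
exec-straight (add r s t) _ a σ = refl
exec-straight (sub r s t) _ a σ = refl
exec-straight (load r s)  _ a σ = refl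
exec-straight (store r s) _ a σ = refl

exec-jzero-zero : ∀ r l a σ → proj₁ σ r ≡ 0 → exec (jzero r l) (place a σ) ≡ place l σ
exec-jzero-zero r l a (R , M) eq rewrite eq = refl

exec-jzero-nonzero : ∀ r l a σ → proj₁ σ r ≢ 0 → exec (jzero r l) (place a σ) ≡ place (suc a) σ
exec-jzero-nonzero r l a (R , M) neq with R r
... | zero  = contradiction refl neq
... | suc _ = refl

run-flat : ∀ P c a σ → CodeAt P a (flat c a) →
           P ⊢ place a σ ⟶[ size c ] place (a + size c) (⟦ c ⟧₁ σ)
run-flat P skip a σ cd = 0 , ≤-refl , cong (λ b → place b σ) (sym (+-identityʳ a))
run-flat P (op i {st}) a σ (now , _) =
  subst (P ⊢ place a σ ⟶[ 1 ]_)
        (trans (exec-straight i st a σ) (cong (λ b → place b (effect i σ)) (+-comm 1 a)))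
        (⟶-step P (place a σ) now)
run-flat P (c ⨾ d) a σ cd with CodeAt-++ P a (flat c a) cd
... | cc , dd = ⟶-place (+-assoc a (size c) (size d))
  (⟶-trans (run-flat P c a σ cc)
           (run-flat P d (a + size c) (⟦ c ⟧₁ σ)
             (subst (λ b → CodeAt P (a + b) (flat d (a + size c))) (length-flat c a) dd)))
run-flat P (ifz r c d) a σ (now , rest)
  with CodeAt-++ P (suc a) (flat d (suc a)) rest
... | dd , jmp , cc =
  choose-elim (λ τ → P ⊢ place a σ ⟶[ size (ifz r c d) ] place (a + size (ifz r c d)) τ)
    (proj₁ σ r) zero-branch nonzero-branch
  where
  target-c : suc (suc a + length (flat d (suc a))) ≡ suc a + suc (size d)
  target-c = trans (cong (λ b → suc (suc a + b)) (length-flat d (suc a)))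
                   (sym (+-suc (suc a) (size d)))
  end-c : suc a + suc (size d) + size c ≡ a + size (ifz r c d)
  end-c = trans (cong suc (trans (+-assoc a (suc (size d)) (size c))
            (cong (a +_) (sym (+-suc (size d) (size c)))))) (sym (+-suc a _))
  zero-branch : proj₁ σ r ≡ 0 →
                P ⊢ place a σ ⟶[ size (ifz r c d) ] place (a + size (ifz r c d)) (⟦ c ⟧₁ σ)
  zero-branch eq = ⟶-weaken {t = 1 + size c}
    (s≤s (≤-trans (n≤1+n (size c)) (m≤n+m (suc (size c)) (size d))))
    (⟶-trans (subst (P ⊢ place a σ ⟶[ 1 ]_)
                     (exec-jzero-zero r (suc a + suc (size d)) a σ eq) (⟶-step P (place a σ) now))
       (⟶-place end-c (run-flat P c (suc a + suc (size d)) σ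
         (subst (λ b → CodeAt P b (flat c (suc a + suc (size d)))) target-c cc))))
  nonzero-branch : proj₁ σ r ≢ 0 →
                   P ⊢ place a σ ⟶[ size (ifz r c d) ] place (a + size (ifz r c d)) (⟦ d ⟧₁ σ)
  nonzero-branch neq = ⟶-weaken {t = 1 + (size d + 1)}
    (s≤s (+-monoʳ-≤ (size d) (s≤s z≤n)))
    (⟶-trans (subst (P ⊢ place a σ ⟶[ 1 ]_)
                     (exec-jzero-nonzero r (suc a + suc (size d)) a σ neq) (⟶-step P (place a σ) now))
      (⟶-trans (run-flat P d (suc a) σ dd)
         (⟶-step P (place (suc a + size d) (⟦ d ⟧₁ σ))
           (subst (λ b → nth P (suc a + b) ≡ just (jump (a + size (ifz r c d))))
                  (length-flat d (suc a)) jmp))))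

data Prog : Set where
  once  : Cmd → Prog
  while : Reg → Cmd → Prog
  _⨟_   : Prog → Prog → Prog

infixr 4 _⨟_

data Loop (r : Reg) (c : Cmd) : Store → ℕ → Store → Set where
  stop : ∀ {σ} → proj₁ σ r ≡ 0 → Loop r c σ 0 σ
  next : ∀ {σ n τ} → proj₁ σ r ≢ 0 → Loop r c (⟦ c ⟧₁ σ) n τ → Loop r c σ (suc n) τ

data Runs₁ : Prog → Store → ℕ → Store → Set where
  once  : ∀ {c σ} → Runs₁ (once c) σ (size c) (⟦ c ⟧₁ σ)
  -- Each round pays for the test and the backward jump besides the body; the last unit is the test
  -- that leaves the loop.
  while : ∀ {r c σ n τ} → Loop r c σ n τ → Runs₁ (while r c) σ (n * (size c + 2) + 1) τ
  _⨟_   : ∀ {p q σ τ υ t u} → Runs₁ p σ t τ → Runs₁ q τ u υ → Runs₁ (p ⨟ q) σ (t + u) υ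

psize : Prog → ℕ
psize (once c)      = size c
psize (while r c) = suc (size c + 1)
psize (p ⨟ q)     = psize p + psize q

pflat : Prog → ℕ → Program
pflat (once c)      a = flat c a
pflat (while r c) a = jzero r (a + psize (while r c)) ∷ flat c (suc a) ++ jump a ∷ []
pflat (p ⨟ q)     a = pflat p a ++ pflat q (a + psize p)

length-pflat : ∀ p a → length (pflat p a) ≡ psize p
length-pflat (once c)      a = length-flat c a
length-pflat (while r c) a = cong suc (trans (length-++ (flat c (suc a)))
  (cong (_+ 1) (length-flat c (suc a))))
length-pflat (p ⨟ q)     a = trans (length-++ (pflat p a))
  (cong₂ _+_ (length-pflat p a) (length-pflat q (a + psize p)))

run-loop : ∀ P r c a {σ n τ} → CodeAt P a (pflat (while r c) a) → Loop r c σ n τ →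
           P ⊢ place a σ ⟶[ n * (size c + 2) + 1 ] place (a + psize (while r c)) τ
run-loop P r c a {σ} (now , _) (stop eq) =
  subst (P ⊢ place a σ ⟶[ 1 ]_) (exec-jzero-zero r _ a σ eq) (⟶-step P (place a σ) now)
run-loop P r c a {σ} cd@(now , rest) (next {n = n} neq loop)
  with CodeAt-++ P (suc a) (flat c (suc a)) rest
... | body , jmp , _ = ⟶-weaken (≤-reflexive time)
  (⟶-trans (subst (P ⊢ place a σ ⟶[ 1 ]_) (exec-jzero-nonzero r _ a σ neq) (⟶-step P (place a σ) now))
    (⟶-trans (run-flat P c (suc a) σ body)
      (⟶-trans (⟶-step P (place (suc a + size c) (⟦ c ⟧₁ σ))
                  (subst (λ b → nth P (suc a + b) ≡ just (jump a)) (length-flat c (suc a)) jmp))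
        (run-loop P r c a cd loop))))
  where
  time : 1 + (size c + (1 + (n * (size c + 2) + 1))) ≡ suc n * (size c + 2) + 1
  time = trans (cong suc (sym (+-assoc (size c) 1 (n * (size c + 2) + 1))))
    (trans (cong (_+ (n * (size c + 2) + 1)) (sym (+-suc (size c) 1)))
           (sym (+-assoc (size c + 2) (n * (size c + 2)) 1)))

run-prog : ∀ P p a {σ t τ} → CodeAt P a (pflat p a) → Runs₁ p σ t τ →
           P ⊢ place a σ ⟶[ t ] place (a + psize p) τ
run-prog P (once c)      a cd once       = run-flat P c a _ cd
run-prog P (while r c) a cd (while lp) = run-loop P r c a cd lp
run-prog P (p ⨟ q)     a cd (x ⨟ y) with CodeAt-++ P a (pflat p a) cd
... | pp , qq = ⟶-place (+-assoc a (psize p) (psize q))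
  (⟶-trans (run-prog P p a pp x) (run-prog P q (a + psize p)
    (subst (λ b → CodeAt P (a + b) (pflat q (a + psize p))) (length-pflat p a) qq) y))

nth-length : ∀ {A : Set} (xs : List A) → nth xs (length xs) ≡ nothing
nth-length []       = refl
nth-length (x ∷ xs) = nth-length xs

run-whole : ∀ p {σ t τ} → Runs₁ p σ t τ →
  ∃[ n ] (n ≤ t × Halted (pflat p 0) (run (pflat p 0) n (place 0 σ))
                × memory (run (pflat p 0) n (place 0 σ)) ≡ proj₂ τ)
run-whole p {σ} x with run-prog (pflat p 0) p 0 (CodeAt-drop (pflat p 0) 0 (pflat p 0) refl) x
... | n , n≤ , eq = n , n≤
  , trans (cong (λ s → nth (pflat p 0) (pc s)) eq)
      (trans (cong (nth (pflat p 0)) (sym (length-pflat p 0))) (nth-length (pflat p 0)))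
  , cong memory eq

-- A language of arrays

-- VT holds vertices plus one, 0 marking the end; LINK p relates positions p - 1
-- and p (0: different vertices, 1: same label, 2: different labels).  COL is
-- 0 for an unvisited node, 1 or 2 while its first or second successor is still
-- to be explored, and 3 afterwards; COMP is 0 for an unassigned node and
-- otherwise the root of its component plus one.
data Arr : Set where
  INP OUT PTR VTX REM LEN VT EG SRC TGT MATE ACT LINK NODE KIND POS
    SUCC0 SUCC1 PRED0 PRED1 COL STK TOP ORD FIN ROOT CUR NBR COMP IDX : Arr

num : Arr → ℕ
num INP = 0
num OUT = 1
num PTR = 2
num VTX = 3
num REM = 4
num LEN = 5
num VT = 6
num EG = 7
num SRC = 8
num TGT = 9
num MATE = 10
num ACT = 11
num LINK = 12
num NODE = 13
num KIND = 14
num POS = 15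
num SUCC0 = 16
num SUCC1 = 17
num PRED0 = 18
num PRED1 = 19
num COL = 20
num STK = 21
num TOP = 22
num ORD = 23
num FIN = 24
num ROOT = 25
num CUR = 26
num NBR = 27
num COMP = 28
num IDX = 29

num<32 : ∀ k → num k < 32
num<32 k = <ᵇ⇒< (num k) 32 (ok k)
  where
  ok : ∀ k → T (num k <ᵇ 32)
  ok INP = tt
  ok OUT = tt
  ok PTR = tt
  ok VTX = tt
  ok REM = tt
  ok LEN = tt
  ok VT = tt
  ok EG = tt
  ok SRC = tt
  ok TGT = tt
  ok MATE = tt
  ok ACT = tt
  ok LINK = tt
  ok NODE = tt
  ok KIND = tt
  ok POS = tt
  ok SUCC0 = tt
  ok SUCC1 = tt
  ok PRED0 = tt
  ok PRED1 = tt
  ok COL = tt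
  ok STK = tt
  ok TOP = tt
  ok ORD = tt
  ok FIN = tt
  ok ROOT = tt
  ok CUR = tt
  ok NBR = tt
  ok COMP = tt
  ok IDX = tt

≡ᵇ-refl : ∀ n → (n ≡ᵇ n) ≡ true
≡ᵇ-refl zero    = refl
≡ᵇ-refl (suc n) = ≡ᵇ-refl n

≡ᵇ-≢ : ∀ {m n} → m ≢ n → (m ≡ᵇ n) ≡ false
≡ᵇ-≢ {m} {n} neq with m ≡ᵇ n in eq
... | false = refl
... | true  = contradiction (≡ᵇ⇒≡ m n (subst T (sym eq) tt)) neq

↦-same : ∀ f a {x} → (f [ a ↦ x ]) a ≡ x
↦-same f a rewrite ≡ᵇ-refl a = refl

↦-other : ∀ f {a b x} → a ≢ b → (f [ a ↦ x ]) b ≡ f b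
↦-other f a≢b rewrite ≡ᵇ-≢ a≢b = refl

S : Set
S = Arr → ℕ → ℕ

-- Comparing numbers lets the test evaluate for concrete arrays, so that reading one array after an
-- assignment to another reduces by computation.
upd : S → Arr → ℕ → ℕ → S
upd s k i v k' = if num k ≡ᵇ num k' then (s k') [ i ↦ v ] else s k'

upd-same-array : ∀ s {k k'} i v → num k ≡ num k' → upd s k i v k' ≡ s k' [ i ↦ v ]
upd-same-array s {k} {k'} i v eq rewrite eq | ≡ᵇ-refl (num k') = refl

upd-other-array : ∀ s {k k'} i v → num k ≢ num k' → upd s k i v k' ≡ s k'
upd-other-array s i v neq rewrite ≡ᵇ-≢ neq = refl

infix 9 _at_
infixl 7 _⊕_ _⊖_
infix 6 _⟪_⟫≔_ _≔_
infixr 5 _⨾′_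

data Exp : Set where
  lit     : ℕ → Exp
  _⊕_ _⊖_ : Exp → Exp → Exp
  _at_    : Arr → Exp → Exp
  cond    : Exp → Exp → Exp → Exp

data Com : Set where
  skip   : Com
  _⟪_⟫≔_ : Arr → Exp → Exp → Com
  _⨾′_   : Com → Com → Com
  ifz    : Exp → Com → Com → Com

var : Arr → Exp
var k = k at lit 0

_≔_ : Arr → Exp → Com
k ≔ e = k ⟪ lit 0 ⟫≔ e

⟦_⟧ᵉ : Exp → S → ℕ
⟦ lit n ⟧ᵉ      s = n
⟦ e ⊕ f ⟧ᵉ      s = ⟦ e ⟧ᵉ s + ⟦ f ⟧ᵉ s
⟦ e ⊖ f ⟧ᵉ      s = ⟦ e ⟧ᵉ s ∸ ⟦ f ⟧ᵉ s
⟦ k at e ⟧ᵉ     s = s k (⟦ e ⟧ᵉ s)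
⟦ cond e f g ⟧ᵉ s = choose (⟦ e ⟧ᵉ s) (⟦ f ⟧ᵉ s) (⟦ g ⟧ᵉ s)

⟦_⟧ : Com → S → S
⟦ skip ⟧        s = s
⟦ k ⟪ e ⟫≔ f ⟧  s = upd s k (⟦ e ⟧ᵉ s) (⟦ f ⟧ᵉ s)
⟦ c ⨾′ d ⟧      s = ⟦ d ⟧ (⟦ c ⟧ s)
⟦ ifz e c d ⟧   s = choose (⟦ e ⟧ᵉ s) (⟦ c ⟧ s) (⟦ d ⟧ s)

double : ℕ → ℕ
double n = n + n

-- The memory from cell B on is divided into 32 interleaved arrays.
address : ℕ → Arr → ℕ → ℕ
address B k i = B + (num k + double (double (double (double (double i)))))

-- `num` is below 32, so it is the remainder of the offset modulo 32, and the index is the quotient.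
address-injective : ∀ B {k k' i i'} → address B k i ≡ address B k' i' → num k ≡ num k' × i ≡ i'
address-injective B {k} {k'} {i} {i'} eq = same-array , same-index
  where
  times32 : ∀ n → double (double (double (double (double n)))) ≡ n * 32
  times32 = solve 1 (λ n →
    let d = λ x → x :+ x in d (d (d (d (d n)))) := n :* con 32) refl
    where open +-*-Solver
  eq' : num k + i * 32 ≡ num k' + i' * 32
  eq' = trans (cong (num k +_) (sym (times32 i)))
        (trans (+-cancelˡ-≡ B _ _ eq) (cong (num k' +_) (times32 i')))
  remainder : ∀ k i → (num k + i * 32) % 32 ≡ num k
  remainder k i = trans ([m+kn]%n≡m%n (num k) i 32) (m<n⇒m%n≡m (num<32 k))
  same-array : num k ≡ num k'
  same-array = trans (sym (remainder k i)) (trans (cong (_% 32) eq') (remainder k' i'))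
  same-index : i ≡ i'
  same-index = *-cancelʳ-≡ i i' 32
    (+-cancelˡ-≡ (num k) _ _ (trans eq' (cong (_+ i' * 32) (sym same-array))))

-- Register 0 permanently holds B.  An expression is computed into register d
-- without changing the registers below d.
addr : Arr → Reg → Cmd
addr k d = op (add d d d) ⨾ op (add d d d) ⨾ op (add d d d) ⨾ op (add d d d) ⨾ op (add d d d)
         ⨾ op (const (suc d) (num k)) ⨾ op (add d (suc d) d) ⨾ op (add d 0 d)

trE : Exp → Reg → Cmd
trE (lit n)      d = op (const d n)
trE (e ⊕ f)      d = trE e d ⨾ trE f (suc d) ⨾ op (add d d (suc d))
trE (e ⊖ f)      d = trE e d ⨾ trE f (suc d) ⨾ op (sub d d (suc d))
trE (k at e)     d = trE e d ⨾ addr k d ⨾ op (load d d)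
trE (cond e f g) d = trE e d ⨾ ifz d (trE f d) (trE g d)

tr : Com → Cmd
tr skip         = skip
tr (k ⟪ e ⟫≔ f) = trE f 1 ⨾ trE e 2 ⨾ addr k 2 ⨾ op (store 2 1)
tr (c ⨾′ d)     = tr c ⨾ tr d
tr (ifz e c d)  = trE e 1 ⨾ ifz 1 (tr c) (tr d)

record Rep (B : ℕ) (s : S) (σ : Store) : Set where
  constructor rep
  field
    base  : proj₁ σ 0 ≡ B
    cells : ∀ k i → proj₂ σ (address B k i) ≡ s k i
open Rep

-- `below-kept` makes nesting possible: the first operand stays in `d` while the second is computed
-- from `suc d` upwards, and register 0 keeps the base address.
record Computes (d v : ℕ) (σ τ : Store) : Set where
  constructor computes
  field
    memory-kept : proj₂ τ ≡ proj₂ σ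
    result      : proj₁ τ d ≡ v
    below-kept  : ∀ {r} → r < d → proj₁ τ r ≡ proj₁ σ r
open Computes

op-computes : ∀ d i (st : T (straight? i)) v σ →
  effect i σ ≡ (proj₁ σ [ d ↦ v ] , proj₂ σ) → Computes d v σ (effect i σ)
op-computes d i st v (R , M) eq rewrite eq =
  computes refl (↦-same R d) (λ r<d → ↦-other R (λ d≡r → <⇒≢ r<d (sym d≡r)))

Computes-trans : ∀ {d e v w σ τ υ} → e ≤ d → Computes d v σ τ → Computes e w τ υ →
                 Computes e w σ υ
Computes-trans e≤d p q = computes
  (trans (memory-kept q) (memory-kept p)) (result q)
  (λ r<e → trans (below-kept q r<e) (below-kept p (<-≤-trans r<e e≤d)))

addr-computes : ∀ k d {B i σ} → 0 < d → proj₁ σ 0 ≡ B → proj₁ σ d ≡ i →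
                Computes d (address B k i) σ (⟦ addr k d ⟧₁ σ)
addr-computes k d {B} {i} {R , M} 0<d R0 Rd = computes refl value kept
  where
  twice : (Reg → ℕ) → Reg → ℕ
  twice R = R [ d ↦ R d + R d ]
  twice-d : ∀ R {n} → R d ≡ n → twice R d ≡ double n
  twice-d R eq = trans (↦-same R d) (cong double eq)
  R₅ R₆ R₇ : Reg → ℕ
  R₅ = twice (twice (twice (twice (twice R))))
  R₆ = R₅ [ suc d ↦ num k ]
  R₇ = R₆ [ d ↦ R₆ (suc d) + R₆ d ]
  not-d : ∀ {r} → r < d → d ≢ r
  not-d r<d d≡r = <⇒≢ r<d (sym d≡r)
  kept₁ : ∀ R {r} → r < d → twice R r ≡ R r
  kept₁ R r<d = ↦-other R (not-d r<d)
  kept₅ : ∀ {r} → r < d → R₅ r ≡ R r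
  kept₅ r<d = trans (kept₁ (twice (twice (twice (twice R)))) r<d) (trans (kept₁ (twice (twice (twice R))) r<d)
    (trans (kept₁ (twice (twice R)) r<d) (trans (kept₁ (twice R) r<d) (kept₁ R r<d))))
  kept₇ : ∀ {r} → r < d → R₇ r ≡ R r
  kept₇ r<d = trans (↦-other R₆ (not-d r<d))
      (trans (↦-other R₅ (λ sd≡r → <⇒≢ (m<n⇒m<1+n r<d) (sym sd≡r))) (kept₅ r<d))
  kept : ∀ {r} → r < d → (R₇ [ d ↦ R₇ 0 + R₇ d ]) r ≡ R r
  kept r<d = trans (↦-other R₇ (not-d r<d)) (kept₇ r<d)
  value₅ : R₅ d ≡ double (double (double (double (double i))))
  value₅ = twice-d (twice (twice (twice (twice R)))) (twice-d (twice (twice (twice R)))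
    (twice-d (twice (twice R)) (twice-d (twice R) (twice-d R Rd))))
  value : (R₇ [ d ↦ R₇ 0 + R₇ d ]) d ≡ address B k i
  value = trans (↦-same R₇ d) (cong₂ _+_ (trans (kept₇ 0<d) R0)
    (trans (↦-same R₆ d) (cong₂ _+_ (↦-same R₅ (suc d))
      (trans (↦-other R₅ (λ sd≡d → 1+n≢n sd≡d)) value₅))))

load-computes : ∀ k d {B i s σ} → 0 < d → Rep B s σ → proj₁ σ d ≡ i →
                Computes d (s k i) σ (⟦ addr k d ⨾ op (load d d) ⟧₁ σ)
load-computes k d {B} {i} {s} {σ} 0<d (rep R0 mem) Rd =
  Computes-trans ≤-refl step₁ (op-computes d (load d d) tt (s k i) τ
    (cong (λ v → proj₁ τ [ d ↦ v ] , proj₂ τ)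
    (trans (cong₂ (λ f a → f a) (memory-kept step₁) (result step₁)) (mem k i))))
  where
  τ = ⟦ addr k d ⟧₁ σ
  step₁ = addr-computes k d 0<d R0 Rd

Rep-kept : ∀ {B s d v σ τ} → 0 < d → Computes d v σ τ → Rep B s σ → Rep B s τ
Rep-kept 0<d c (rep R0 mem) = rep (trans (below-kept c 0<d) R0) λ k i → trans
    (cong (λ f → f _) (memory-kept c)) (mem k i)

trE-computes : ∀ e d {B s σ} → 0 < d → Rep B s σ → Computes d (⟦ e ⟧ᵉ s) σ (⟦ trE e d ⟧₁ σ)

binary-computes : ∀ (f : ℕ → ℕ → ℕ) i e₁ e₂ d {B s σ} (st : T (straight? i)) → 0 < d → Rep B s σ →
  (∀ τ → effect i τ ≡ (proj₁ τ [ d ↦ f (proj₁ τ d) (proj₁ τ (suc d)) ] , proj₂ τ)) →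
  Computes d (f (⟦ e₁ ⟧ᵉ s) (⟦ e₂ ⟧ᵉ s)) σ (⟦ trE e₁ d ⨾ trE e₂ (suc d) ⨾ op i {st} ⟧₁ σ)
binary-computes f i e₁ e₂ d {s = s} {σ} st 0<d ρ eff =
  Computes-trans ≤-refl first (Computes-trans (n≤1+n d) second
    (op-computes d i st _ υ (trans (eff υ)
      (cong (λ v → proj₁ υ [ d ↦ v ] , proj₂ υ)
        (cong₂ f (trans (below-kept second ≤-refl) (result first)) (result second))))))
  where
  τ = ⟦ trE e₁ d ⟧₁ σ
  first = trE-computes e₁ d 0<d ρ
  second = trE-computes e₂ (suc d) {s = s} (s≤s z≤n) (Rep-kept 0<d first ρ)
  υ = ⟦ trE e₂ (suc d) ⟧₁ τ

trE-computes (lit n) d {σ = σ} 0<d ρ = op-computes d (const d n) tt n σ refl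
trE-computes (e ⊕ f) d 0<d ρ =
  binary-computes _+_ (add d d (suc d)) e f d tt 0<d ρ (λ _ → refl)
trE-computes (e ⊖ f) d 0<d ρ =
  binary-computes _∸_ (sub d d (suc d)) e f d tt 0<d ρ (λ _ → refl)
trE-computes (k at e) d 0<d ρ = Computes-trans ≤-refl first
  (load-computes k d 0<d (Rep-kept 0<d first ρ) (result first))
  where first = trE-computes e d 0<d ρ
trE-computes (cond e f g) d {s = s} {σ} 0<d ρ = branch (⟦ e ⟧ᵉ s) _ (result first)
  where
  τ = ⟦ trE e d ⟧₁ σ
  first = trE-computes e d 0<d ρ
  branch : ∀ n v → v ≡ n → Computes d (choose n (⟦ f ⟧ᵉ s) (⟦ g ⟧ᵉ s)) σ
                            (choose v (⟦ trE f d ⟧₁ τ) (⟦ trE g d ⟧₁ τ))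
  branch zero    _ refl = Computes-trans ≤-refl first (trE-computes f d 0<d (Rep-kept 0<d first ρ))
  branch (suc _) _ refl = Computes-trans ≤-refl first (trE-computes g d 0<d (Rep-kept 0<d first ρ))

upd-Rep : ∀ {B s R M} k i v → Rep B s (R , M) → Rep B (upd s k i v) (R , M [ address B k i ↦ v ])
upd-Rep {B} {s} {R} {M} k i v (rep R0 mem) = rep R0 go
  where
  go : ∀ k' j → (M [ address B k i ↦ v ]) (address B k' j) ≡ upd s k i v k' j
  go k' j with num k ≟ num k'
  ... | no k≢k' = trans
    (↦-other M {address B k i} {address B k' j}
      (λ eq → k≢k' (proj₁ (address-injective B {k} {k'} {i} {j} eq))))
    (trans (mem k' j) (sym (cong (λ f → f j) (upd-other-array s i v k≢k'))))
  ... | yes k≡k' = trans (same-array (i ≟ j)) (sym (cong (λ f → f j) (upd-same-array s i v k≡k')))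
    where
    same-array : Dec (i ≡ j) → (M [ address B k i ↦ v ]) (address B k' j) ≡ (s k' [ i ↦ v ]) j
    same-array (yes refl) = trans
      (cong (M [ address B k i ↦ v ]) (sym (cong (λ n → B + (n + _)) k≡k')))
      (trans (↦-same M (address B k i)) (sym (↦-same (s k') i)))
    same-array (no i≢j) = trans
      (↦-other M {address B k i} {address B k' j}
        (λ eq → i≢j (proj₂ (address-injective B {k} {k'} {i} {j} eq))))
      (trans (mem k' j) (sym (↦-other (s k') i≢j)))

tr-Rep : ∀ c {B s σ} → Rep B s σ → Rep B (⟦ c ⟧ s) (⟦ tr c ⟧₁ σ)
tr-Rep skip ρ = ρ
tr-Rep (k ⟪ e ⟫≔ f) {B} {s} {σ} ρ =
  rep (base final) λ k' j → trans (cong (λ M → M (address B k' j)) memory-eq) (cells final k' j)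
  where
  first = trE-computes f 1 {s = s} (s≤s z≤n) ρ
  ρ₁ = Rep-kept (s≤s z≤n) first ρ
  second = trE-computes e 2 {s = s} (s≤s z≤n) ρ₁
  ρ₂ = Rep-kept (s≤s z≤n) second ρ₁
  third = addr-computes k 2 (s≤s z≤n) (base ρ₂) (result second)
  ρ₃ = Rep-kept {s = s} (s≤s z≤n) third ρ₂
  υ = ⟦ addr k 2 ⟧₁ (⟦ trE e 2 ⟧₁ (⟦ trE f 1 ⟧₁ σ))
  final = upd-Rep k (⟦ e ⟧ᵉ s) (⟦ f ⟧ᵉ s) ρ₃
  memory-eq : (proj₂ υ [ proj₁ υ 2 ↦ proj₁ υ 1 ]) ≡
              (proj₂ υ [ address B k (⟦ e ⟧ᵉ s) ↦ ⟦ f ⟧ᵉ s ])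
  memory-eq = cong₂ (proj₂ υ [_↦_]) (result third)
    (trans (below-kept third ≤-refl) (trans (below-kept second ≤-refl) (result first)))
tr-Rep (c ⨾′ d) ρ = tr-Rep d (tr-Rep c ρ)
tr-Rep (ifz e c d) {B} {s} {σ} ρ = branch (⟦ e ⟧ᵉ s) _ (result first)
  where
  first = trE-computes e 1 {s = s} (s≤s z≤n) ρ
  ρ₁ = Rep-kept {s = s} (s≤s z≤n) first ρ
  branch : ∀ n v → v ≡ n → Rep B (choose n (⟦ c ⟧ s) (⟦ d ⟧ s))
    (choose v (⟦ tr c ⟧₁ (⟦ trE e 1 ⟧₁ σ)) (⟦ tr d ⟧₁ (⟦ trE e 1 ⟧₁ σ)))
  branch zero    _ refl = tr-Rep c ρ₁
  branch (suc _) _ refl = tr-Rep d ρ₁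

data Algo : Set where
  once  : Com → Algo
  while : Exp → Com → Algo
  _⨟_   : Algo → Algo → Algo

trA : Algo → Prog
trA (once c)    = once (tr c)
-- The machine loop tests a register, so the guard is evaluated into register 1 before the loop and
-- again at the end of every round.
trA (while e c) = once (trE e 1) ⨟ while 1 (tr c ⨾ trE e 1)
trA (p ⨟ q)     = trA p ⨟ trA q

data Iterates (e : Exp) (c : Com) : S → ℕ → S → Set where
  stop : ∀ {s} → ⟦ e ⟧ᵉ s ≡ 0 → Iterates e c s 0 s
  next : ∀ {s n s'} → ⟦ e ⟧ᵉ s ≢ 0 → Iterates e c (⟦ c ⟧ s) n s' → Iterates e c s (suc n) s'

data Runs : Algo → S → ℕ → S → Set where
  once  : ∀ {c s} → Runs (once c) s (size (tr c)) (⟦ c ⟧ s)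
  while : ∀ {e c s n s'} → Iterates e c s n s' →
          Runs (while e c) s (size (trE e 1) + (n * (size (tr c ⨾ trE e 1) + 2) + 1)) s'
  _⨟_   : ∀ {p q s s' s'' t u} → Runs p s t s' → Runs q s' u s'' → Runs (p ⨟ q) s (t + u) s''

Simulates : ℕ → Prog → S → ℕ → S → Set
Simulates B p s t s' = ∀ {σ} → Rep B s σ → ∃[ τ ] (Runs₁ p σ t τ × Rep B s' τ)

Iterates-simulates : ∀ {B e c s n s'} → Iterates e c s n s' →
  ∀ {σ} → Rep B s σ → proj₁ σ 1 ≡ ⟦ e ⟧ᵉ s →
  ∃[ τ ] (Loop 1 (tr c ⨾ trE e 1) σ n τ × Rep B s' τ)
Iterates-simulates (stop eq) {σ} ρ R1 = σ , stop (trans R1 eq) , ρ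
Iterates-simulates {e = e} {c} {s} (next neq it) {σ} ρ R1
  with Iterates-simulates it (Rep-kept {s = ⟦ c ⟧ s} (s≤s z≤n) test (tr-Rep c ρ)) (result test)
  where test = trE-computes e 1 {s = ⟦ c ⟧ s} (s≤s z≤n) (tr-Rep c ρ)
... | τ , lp , ρ' = τ , next (λ eq → neq (trans (sym R1) eq)) lp , ρ'

trA-simulates : ∀ {B p s t s'} → Runs p s t s' → Simulates B (trA p) s t s'
trA-simulates (once {c}) ρ = _ , once , tr-Rep c ρ
trA-simulates (while {e} {s = s} it) ρ with Iterates-simulates it (Rep-kept {s = s} (s≤s z≤n) test ρ) (result test)
  where test = trE-computes e 1 (s≤s z≤n) ρ
... | τ , lp , ρ' = τ , (once ⨟ while lp) , ρ'
trA-simulates (x ⨟ y) ρ with trA-simulates x ρ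
... | τ , x₁ , ρ₁ with trA-simulates y ρ₁
...   | υ , y₁ , ρ₂ = υ , (x₁ ⨟ y₁) , ρ₂

-- Loops, linear bounds, input and output

-- As a Boolean that evaluates on concrete commands, this turns every frame condition into a proof
-- by `tt`.
fresh : Arr → Com → Bool
fresh k skip            = true
fresh k (k' ⟪ _ ⟫≔ _)   = not (num k' ≡ᵇ num k)
fresh k (c ⨾′ d)        = fresh k c ∧ fresh k d
fresh k (ifz _ c d)     = fresh k c ∧ fresh k d

frame : ∀ c k {s} → T (fresh k c) → ⟦ c ⟧ s k ≡ s k
frame skip k f = refl
frame (k' ⟪ e ⟫≔ g) k {s} f with num k' ≡ᵇ num k
... | false = refl
frame (c ⨾′ d) k {s} f with Equivalence.to T-∧ f
... | f₁ , f₂ = trans (frame d k {⟦ c ⟧ s} f₂) (frame c k {s} f₁)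
frame (ifz e c d) k {s} f with Equivalence.to T-∧ f
... | f₁ , f₂ = choose-elim (λ s' → s' k ≡ s k) (⟦ e ⟧ᵉ s) {⟦ c ⟧ s} {⟦ d ⟧ s}
                  (λ _ → frame c k {s} f₁) (λ _ → frame d k {s} f₂)

Frame : Com → S → S → Set
Frame c s₀ s = ∀ k → T (fresh k c) → s k ≡ s₀ k

abstract
  -- The index of `I` is a potential: it strictly decreases and so bounds the number of iterations.
  -- `Frame` is carried along, so that an invariant mentions only the arrays that the body changes.
  while-rule : ∀ {e c} (I : ℕ → S → Set) {n₀ s₀} →
    (∀ {n s} → Frame c s₀ s → I n s → ⟦ e ⟧ᵉ s ≢ 0 → ∃[ n' ] (n' < n × I n' (⟦ c ⟧ s))) →
    I n₀ s₀ →
    ∃[ k ] ∃[ s' ] (k ≤ n₀ × Iterates e c s₀ k s' × (∃[ n' ] I n' s') × ⟦ e ⟧ᵉ s' ≡ 0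
                   × Frame c s₀ s')
  while-rule {e} {c} I {n₀} {s₀} step i₀ = go n₀ ≤-refl (λ _ _ → refl) i₀
    where
    -- The potential may drop by more than one, so the recursion is on a separate upper bound.
    go : ∀ bound {n s} → n ≤ bound → Frame c s₀ s → I n s →
         ∃[ k ] ∃[ s' ] (k ≤ bound × Iterates e c s k s' × (∃[ n' ] I n' s') × ⟦ e ⟧ᵉ s' ≡ 0
                        × Frame c s₀ s')
    go bound {n} {s} n≤ fr i with ⟦ e ⟧ᵉ s ≟ 0
    ... | yes z = 0 , s , z≤n , stop z , (n , i) , z , fr
    ... | no ¬z with step fr i ¬z
    go zero z≤n fr i | no ¬z | n' , () , i'
    go (suc bound) {s = s} n≤ fr i | no ¬z | n' , n'< , i'
      with go bound (≤-pred (≤-trans n'< n≤)) (λ k f → trans (frame c k {s} f) (fr k f)) i'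
    ... | k , s' , k≤ , it , rest = suc k , s' , s≤s k≤ , next ¬z it , rest

-- Wrapping the inequality in a record lets unification read off `c`, `m` and `t`, and keeps the
-- large constants from being unfolded.
record Linear (c m t : ℕ) : Set where
  constructor linear
  field bound : t ≤ c * suc m
open Linear

linear-+ : ∀ {c d m t u} → Linear c m t → Linear d m u → Linear (c + d) m (t + u)
linear-+ {c} {d} {m} (linear p) (linear q) =
  linear (≤-trans (+-mono-≤ p q) (≤-reflexive (sym (*-distribʳ-+ (suc m) c d))))

linear-const : ∀ k m → Linear k m k
linear-const k m = linear (m≤m*n k (suc m))

linear-scale : ∀ {n a m} k → Linear a m n → Linear (k * a) m (n * k)
linear-scale {n} {a} {m} k (linear n≤) = linear (≤-trans (≤-reflexive (*-comm n k))
  (≤-trans (*-monoʳ-≤ k n≤) (≤-reflexive (sym (*-assoc k a (suc m))))))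

while-cost : Exp → Com → ℕ → ℕ
while-cost e c a = size (trE e 1) + ((size (tr c ⨾ trE e 1) + 2) * a + 1)

LinearRun : Algo → ℕ → ℕ → S → S → Set
LinearRun p c m s s' = ∃[ t ] (Runs p s t s' × Linear c m t)

while-linear : ∀ {e c s n s' a m} → Linear a m n → Iterates e c s n s' →
               LinearRun (while e c) (while-cost e c a) m s s'
while-linear {e} {c} {n = n} {m = m} n≤ it = _ , while it ,
  linear-+ (linear-const (size (trE e 1)) m)
    (linear-+ (linear-scale (size (tr c ⨾ trE e 1) + 2) n≤) (linear-const 1 m))

once-linear : ∀ c s m → LinearRun (once c) (size (tr c)) m s (⟦ c ⟧ s)
once-linear c s m = _ , once , linear-const (size (tr c)) m

_then_ : ∀ {p q s s' s'' c d m} → LinearRun p c m s s' → LinearRun q d m s' s'' →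
         LinearRun (p ⨟ q) (c + d) m s s''
(t , x , t≤) then (u , y , u≤) = t + u , (x ⨟ y) , linear-+ t≤ u≤

infixr 4 _then_

-- Transfer of the input and the answer between plain memory and arrays

word : List ℕ → ℕ → ℕ
word w a = fromMaybe 0 (nth w a)

word-beyond : ∀ w {a} → length w ≤ a → word w a ≡ 0
word-beyond []      {zero}  _         = refl
word-beyond []      {suc a} _         = refl
word-beyond (x ∷ w) {suc a} (s≤s ≤a) = word-beyond w ≤a

-- Computes B = 3 + 7 m, which bounds the length of the input because a graph
-- with m edges has at most 2 m vertices and 2 m incidences.
prepare : Cmd
prepare = op (const 1 2) ⨾ op (load 1 1) ⨾ op (const 0 3) ⨾ op (add 0 0 1) ⨾ op (add 0 0 1)
  ⨾ op (add 0 0 1) ⨾ op (add 0 0 1) ⨾ op (add 0 0 1) ⨾ op (add 0 0 1) ⨾ op (add 0 0 1)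
  ⨾ op (const 2 0) ⨾ op (add 2 0 2)

-- The sources lie below `B` and the destinations at or above it, so no unread word is overwritten.
-- Counting down makes the counter itself the loop guard.
copy-in : Cmd
copy-in = (op (const 1 1) ⨾ op (sub 2 2 1) ⨾ op (load 3 2) ⨾ op (const 4 0) ⨾ op (add 4 2 4))
        ⨾ (addr INP 4 ⨾ op (store 4 3))

copy-out : Cmd
copy-out = (op (const 3 1) ⨾ op (sub 2 2 3) ⨾ op (const 3 0) ⨾ op (add 3 2 3))
         ⨾ (addr OUT 3 ⨾ op (load 3 3)) ⨾ op (store 2 3)

whole : Algo → Prog
whole A = once prepare ⨟ while 2 copy-in ⨟ trA A ⨟ once (trE (INP at lit 2) 2) ⨟ while 2 copy-out

address≥ : ∀ B k i → B ≤ address B k i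
address≥ B k i = m≤m+n B _

-- Copying in takes `B` rounds, where `B` is 3 + 7 m and thus at most 10 (m + 1); copying out takes
-- m rounds. This gives the factors 10 and 1. The sizes are parameters, so that the arithmetic never
-- unfolds the compiled code.
overhead-of : (pre in-cost fetch out-cost : ℕ) → ℕ
overhead-of pre in-cost fetch out-cost = pre + ((in-cost * 10 + 1) + (fetch + (out-cost * 1 + 1)))

overhead : ℕ
overhead = overhead-of (size prepare) (size copy-in + 2) (size (trE (INP at lit 2) 2)) (size copy-out + 2)

total-time : ∀ pre in-cost fetch out-cost c m {t B} → B ≡ 3 + m + m + m + m + m + m + m → Linear c m t →
  Linear (overhead-of pre in-cost fetch out-cost + c) m
    (pre + ((B * in-cost + 1) + (t + (fetch + (m * out-cost + 1)))))
total-time pre in-cost fetch out-cost c m {t} {B} B≡ t≤ =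
  subst (λ k → Linear k m (pre + ((B * in-cost + 1) + (t + (fetch + (m * out-cost + 1))))))
    (rearrange pre (in-cost * 10 + 1) c fetch (out-cost * 1 + 1))
    (linear-+ (linear-const pre m)
      (linear-+ (linear-+ (linear-scale in-cost B≤) (linear-const 1 m))
        (linear-+ t≤ (linear-+ (linear-const fetch m)
          (linear-+ (linear-scale out-cost (linear (≤-trans (n≤1+n m) (≤-reflexive (sym (*-identityˡ (suc m)))))))
                    (linear-const 1 m))))))
  where
  rearrange : ∀ a b c d e → a + (b + (c + (d + e))) ≡ (a + (b + (d + e))) + c
  rearrange = solve 5 (λ a b c d e → a :+ (b :+ (c :+ (d :+ e))) := (a :+ (b :+ (d :+ e))) :+ c) refl
  sevenfold : ∀ m → 3 + m + m + m + m + m + m + m ≡ 3 + 7 * m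
  sevenfold = solve 1 (λ m → con 3 :+ m :+ m :+ m :+ m :+ m :+ m :+ m := con 3 :+ con 7 :* m) refl
  B≤ : Linear 10 m B
  B≤ = linear (≤-trans (≤-reflexive (trans B≡ (sevenfold m)))
    (≤-trans (+-mono-≤ (≤ᵇ⇒≤ 3 10 tt) (*-monoˡ-≤ m (≤ᵇ⇒≤ 7 10 tt))) (≤-reflexive (sym (*-suc 10 m)))))

module _ (w : List ℕ) (m B : ℕ) (w2 : word w 2 ≡ m)
         (B≡ : B ≡ 3 + m + m + m + m + m + m + m) (short : length w ≤ B) where

  record Copying (i : ℕ) (σ : Store) : Set where
    field
      s        : S
      holds    : Rep B s σ
      counter  : proj₁ σ 2 ≡ i
      bounded  : i ≤ B
      copied   : ∀ j → i ≤ j → s INP j ≡ word w j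
      clear    : ∀ k → k ≢ INP → ∀ j → s k j ≡ 0
      original : ∀ j → j < i → proj₂ σ j ≡ word w j

  σ₀ : Store
  σ₀ = (λ _ → 0) , word w

  -- All cells from `B` on lie beyond the input and therefore contain 0, so the arrays start out
  -- blank without being initialised.
  prepared : Copying B (⟦ prepare ⟧₁ σ₀)
  prepared = record
    { s = λ _ _ → 0
    ; holds = record { base = base-eq ; cells = λ k i → word-beyond w (≤-trans short (address≥ B k i)) }
    ; counter = trans (+-identityʳ _) base-eq
    ; bounded = ≤-refl
    ; copied = λ j B≤j → sym (word-beyond w (≤-trans short B≤j))
    ; clear = λ _ _ _ → refl
    ; original = λ _ _ → refl }
    where
    base-eq : 3 + word w 2 + word w 2 + word w 2 + word w 2 + word w 2 + word w 2 + word w 2 ≡ B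
    base-eq = trans (cong (λ m → 3 + m + m + m + m + m + m + m) w2) (sym B≡)

  after-addr : ∀ {i σ τ} → Copying (suc i) σ → proj₁ τ 0 ≡ B → proj₂ τ ≡ proj₂ σ →
    proj₁ τ 4 ≡ address B INP i → proj₁ τ 3 ≡ word w i → proj₁ τ 2 ≡ i →
    Copying i (⟦ op (store 4 3) ⟧₁ τ)
  after-addr {i} {σ} {τ} inv base' memory-kept located loaded counter' = record
    { s = upd s INP i (word w i)
    ; holds = rep base' (λ k j → trans (cong (λ M → M (address B k j)) memory-eq) (cells written k j))
    ; counter = counter'
    ; bounded = i≤B
    ; copied = copied'
    ; clear = λ k k≢ j → trans (cong (λ f → f j) (upd-other-array s {INP} {k} i (word w i)
        (λ eq → k≢ (INP-unique k (sym eq))))) (clear k k≢ j)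
    ; original = λ j j<i → trans (cong (λ M → M j) memory-eq)
        (trans (↦-other (proj₂ σ) (λ eq → <⇒≱ (<-≤-trans j<i i≤B)
                                     (≤-trans (address≥ B INP i) (≤-reflexive eq))))
               (original j (m<n⇒m<1+n j<i))) }
    where
    open Copying inv
    written : Rep B (upd s INP i (word w i)) (proj₁ σ , proj₂ σ [ address B INP i ↦ word w i ])
    written = upd-Rep {R = proj₁ σ} {M = proj₂ σ} INP i (word w i) holds
    memory-eq : proj₂ τ [ proj₁ τ 4 ↦ proj₁ τ 3 ] ≡ proj₂ σ [ address B INP i ↦ word w i ]
    memory-eq = trans (cong₂ (proj₂ τ [_↦_]) located loaded)
                      (cong (_[ address B INP i ↦ word w i ]) memory-kept)
    i≤B : i ≤ B
    i≤B = ≤-trans (n≤1+n i) bounded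
    INP-unique : ∀ k → num k ≡ 0 → k ≡ INP
    INP-unique INP _ = refl
    copied' : ∀ j → i ≤ j → (s INP [ i ↦ word w i ]) j ≡ word w j
    copied' j i≤j with i ≟ j
    ... | yes refl = ↦-same (s INP) i
    ... | no i≢j = trans (↦-other (s INP) i≢j) (copied j (≤∧≢⇒< i≤j i≢j))

  copy-in-step : ∀ {i σ} → Copying (suc i) σ → Copying i (⟦ copy-in ⟧₁ σ)
  copy-in-step {i} {σ} inv =
    after-addr inv (trans (below-kept located (s≤s z≤n)) (base holds)) (memory-kept located) (result located)
      (trans (below-kept located ≤-refl) (trans (cong (proj₂ σ) counter') (original i ≤-refl)))
      (trans (below-kept located (s≤s (s≤s (s≤s z≤n)))) counter')
    where
    open Copying inv
    τ = ⟦ op (const 1 1) ⨾ op (sub 2 2 1) ⨾ op (load 3 2) ⨾ op (const 4 0) ⨾ op (add 4 2 4) ⟧₁ σ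
    counter' : proj₁ σ 2 ∸ 1 ≡ i
    counter' = cong (_∸ 1) counter
    located = addr-computes INP 4 {B} {i} {τ} (s≤s z≤n) (base holds) (trans (+-identityʳ _) counter')

  copy-in-loop : ∀ i {σ} → Copying i σ → ∃[ τ ] (Loop 2 copy-in σ i τ × Copying 0 τ)
  copy-in-loop zero    inv = _ , stop (Copying.counter inv) , inv
  copy-in-loop (suc i) inv with copy-in-loop i (copy-in-step inv)
  ... | τ , lp , inv' = τ , next (λ eq → 1+n≢0 (trans (sym (Copying.counter inv)) eq)) lp , inv'

  module _ (s : S) (m≤B : m ≤ B) where

    record Emitting (i : ℕ) (σ : Store) : Set where
      field
        holds   : Rep B s σ
        counter : proj₁ σ 2 ≡ i
        bounded : i ≤ m
        emitted : ∀ j → i ≤ j → j < m → proj₂ σ j ≡ s OUT j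

    -- The answer cells lie below `m` and hence below `B`, so writing them leaves all arrays intact,
    -- including the part of `OUT` still to be read.
    after-read : ∀ {i σ τ} → Emitting (suc i) σ → proj₁ τ 0 ≡ proj₁ σ 0 → proj₂ τ ≡ proj₂ σ →
                 proj₁ τ 3 ≡ s OUT i → proj₁ τ 2 ≡ i →
                 Emitting i (⟦ op (store 2 3) ⟧₁ τ)
    after-read {i} {σ@(R , M)} {τ} inv base-kept memory-kept result counter' = record
      { holds = record
          { base = trans base-kept (base holds)
          ; cells = λ k j → trans (cong (λ N → N (address B k j)) memory-eq)
              (trans (↦-other M (λ eq → <⇒≱ (<-≤-trans bounded m≤B)
                                  (≤-trans (address≥ B k j) (≤-reflexive (sym eq)))))
                     (cells holds k j)) }
      ; counter = counter'
      ; bounded = ≤-trans (n≤1+n i) bounded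
      ; emitted = λ j i≤j j<m → trans (cong (λ N → N j) memory-eq) (emitted' j i≤j j<m (i ≟ j)) }
      where
      open Emitting inv
      memory-eq : proj₂ τ [ proj₁ τ 2 ↦ proj₁ τ 3 ] ≡ M [ i ↦ s OUT i ]
      memory-eq = trans (cong₂ (proj₂ τ [_↦_]) counter' result)
                        (cong (_[ i ↦ s OUT i ]) memory-kept)
      emitted' : ∀ j → i ≤ j → j < m → Dec (i ≡ j) → (M [ i ↦ s OUT i ]) j ≡ s OUT j
      emitted' j i≤j j<m (yes refl) = ↦-same M i
      emitted' j i≤j j<m (no i≢j) = trans (↦-other M i≢j) (emitted j (≤∧≢⇒< i≤j i≢j) j<m)

    copy-out-step : ∀ {i σ} → Emitting (suc i) σ → Emitting i (⟦ copy-out ⟧₁ σ)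
    copy-out-step {i} {σ} inv =
      after-read inv (below-kept loaded (s≤s z≤n)) (memory-kept loaded) (result loaded)
        (trans (below-kept loaded ≤-refl) counter')
      where
      open Emitting inv
      τ = ⟦ op (const 3 1) ⨾ op (sub 2 2 3) ⨾ op (const 3 0) ⨾ op (add 3 2 3) ⟧₁ σ
      counter' : proj₁ σ 2 ∸ 1 ≡ i
      counter' = cong (_∸ 1) counter
      loaded = load-computes OUT 3 {B} {i} {s} {τ} (s≤s z≤n)
        (record { base = base holds ; cells = cells holds }) (trans (+-identityʳ _) counter')

    copy-out-loop : ∀ i {σ} → Emitting i σ → ∃[ τ ] (Loop 2 copy-out σ i τ × Emitting 0 τ)
    copy-out-loop zero    inv = _ , stop (Emitting.counter inv) , inv
    copy-out-loop (suc i) inv with copy-out-loop i (copy-out-step inv)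
    ... | τ , lp , inv' = τ , next (λ eq → 1+n≢0 (trans (sym (Emitting.counter inv)) eq)) lp , inv'


  Solved : Algo → ℕ → ((ℕ → ℕ) → Set) → Set
  Solved A c P = ∀ s₀ → (∀ j → s₀ INP j ≡ word w j) → (∀ k → k ≢ INP → ∀ j → s₀ k j ≡ 0) →
      ∃[ s ] (LinearRun A c m s₀ s × s INP 2 ≡ m × P (s OUT))

  m≤B : m ≤ B
  m≤B = ≤-trans (m≤n+m m _) (≤-reflexive (sym B≡))

  finish : ∀ {s σ} → Rep B s σ → s INP 2 ≡ m →
    let τ = ⟦ trE (INP at lit 2) 2 ⟧₁ σ in
    ∃[ υ ] (Loop 2 copy-out τ m υ × ∀ j → j < m → proj₂ υ j ≡ s OUT j)
  finish {s} {σ} ρ m-eq =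
    let (υ , loop , inv) = copy-out-loop s m≤B m start in
    υ , loop , λ j → Emitting.emitted inv j z≤n
    where
    fetched = trE-computes (INP at lit 2) 2 {s = s} {σ} (s≤s z≤n) ρ
    start : Emitting s m≤B m (⟦ trE (INP at lit 2) 2 ⟧₁ σ)
    start = record { holds = Rep-kept {s = s} (s≤s z≤n) fetched ρ ; counter = trans (result fetched) m-eq
                   ; bounded = ≤-refl ; emitted = λ j m≤j j<m → contradiction j<m (≤⇒≯ m≤j) }

  runs-whole : ∀ A c P → Solved A c P →
    ∃[ t ] ∃[ τ ] (Runs₁ (whole A) σ₀ t τ × Linear (overhead + c) m t
      × ∃[ f ] (P f × ∀ j → j < m → proj₂ τ j ≡ f j))
  runs-whole A c P correct =
    let (σ₁ , loop₁ , inv₁) = copy-in-loop B prepared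
        (s , (t , runs , t≤) , m-eq , post) =
          correct (Copying.s inv₁) (λ j → Copying.copied inv₁ j z≤n) (Copying.clear inv₁)
        (σ₂ , runs₂ , ρ₂) = trA-simulates runs (Copying.holds inv₁)
        (σ₃ , loop₃ , out) = finish ρ₂ m-eq
    in _ , σ₃ , (once ⨟ (while loop₁ ⨟ (runs₂ ⨟ (once ⨟ while loop₃)))) , 
         total-time (size prepare) (size copy-in + 2) (size (trE (INP at lit 2) 2)) (size copy-out + 2) c m B≡ t≤
       , s OUT , post , out

  run-algo : ∀ A c P → Solved A c P →
    ∃[ n ] (n ≤ (overhead + c) * suc m
      × Halted (pflat (whole A) 0) (run (pflat (whole A) 0) n (initial w))
      × ∃[ f ] (P f × ∀ j → j < m → memory (run (pflat (whole A) 0) n (initial w)) j ≡ f j))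
  run-algo A c P correct =
    let (t , τ , runs , t≤ , f , post , out) = runs-whole A c P correct
        (n , n≤ , halted , mem) = run-whole (whole A) runs
    in n , ≤-trans n≤ (bound t≤) , halted , f , post , λ j j<m → trans (cong (λ M → M j) mem) (out j j<m)

-- Strongly connected components

module Digraph (T : ℕ) (σ0 σ1 : ℕ → ℕ) where

  -- Every node has exactly two entries; a missing successor will be represented by the node itself,
  -- which does not affect reachability.
  E : ℕ → ℕ → Set
  E x y = x < T × (y ≡ σ0 x ⊎ y ≡ σ1 x)

  infix 4 _⟶*_ _~_

  _⟶*_ : ℕ → ℕ → Set
  _⟶*_ = Star E

  _~_ : ℕ → ℕ → Set
  x ~ y = x ⟶* y × y ⟶* x

  ~-refl : ∀ {x} → x ~ x
  ~-refl = ε , ε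

  ~-sym : ∀ {x y} → x ~ y → y ~ x
  ~-sym (p , q) = q , p

  ~-trans : ∀ {x y z} → x ~ y → y ~ z → x ~ z
  ~-trans (p , q) (p' , q') = p ◅◅ p' , q' ◅◅ q

  source< : ∀ {x y} → x ⟶* y → y < T → x < T
  source< ε             y<T = y<T
  source< ((x<T , _) ◅ _) _ = x<T

  -- No strongly connected component reaching r was completely finished
  -- before r; the list has the latest finished node first.
  Good : List ℕ → Set
  Good []         = ⊤
  Good (r ∷ post) = Good post × (∀ y → y ⟶* r → ∃[ z ] (z ~ y × z ∉ post))

  -- `escaping` is the inductive core: a finished node that still reaches an unfinished one has an
  -- unfinished node in its own component. Applied at the moment when a node is finished, it yields
  -- `Good` for the extended list.
  record Dfs (col : ℕ → ℕ) (st bl : List ℕ) : Set where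
    field
      covered     : ∀ {x} → col x ≢ 0 → x ∈ st ⊎ x ∈ bl
      first-done  : ∀ {x} → 2 ≤ col x → col (σ0 x) ≢ 0
      second-done : ∀ {x} → 3 ≤ col x → col (σ1 x) ≢ 0
      grey        : ∀ {x} → x ∈ st → x < T × col x ≢ 0
      black       : ∀ {x} → x ∈ bl → x < T × 3 ≤ col x
      path        : Linked (λ a b → E b a) st
      unique      : Unique st
      disjoint    : ∀ {x} → x ∈ st → x ∉ bl
      good        : Good bl
      escaping    : ∀ {y w} → y ∈ bl → y ⟶* w → w ∉ bl → ∃[ z ] (z ~ y × z ∉ bl)

  dfs-start : ∀ {col} → (∀ x → col x ≡ 0) → Dfs col [] []
  dfs-start white = record
    { covered = λ {x} c → contradiction (white x) c
    ; first-done = λ {x} 2≤ → contradiction (≤-trans 2≤ (≤-reflexive (white x))) λ ()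
    ; second-done = λ {x} 3≤ → contradiction (≤-trans 3≤ (≤-reflexive (white x))) λ ()
    ; grey = λ () ; black = λ () ; path = [] ; unique = [] ; disjoint = λ ()
    ; good = tt ; escaping = λ () }

  recolour-≥ : ∀ (col : ℕ → ℕ) {x c} → col x ≤ c → ∀ y → col y ≤ (col [ x ↦ c ]) y
  recolour-≥ col {x} ≤c y with x ≟ y
  ... | yes refl = ≤-trans ≤c (≤-reflexive (sym (↦-same col x)))
  ... | no x≢y = ≤-reflexive (sym (↦-other col x≢y))

  ≢0-mono : ∀ {a b} → a ≤ b → a ≢ 0 → b ≢ 0
  ≢0-mono a≤b a≢0 refl = a≢0 (n≤0⇒n≡0 a≤b)

  recoloured : ∀ (col : ℕ → ℕ) x c y (P : ℕ → Set) → P ((col [ x ↦ c ]) y) →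
               (x ≡ y × P c) ⊎ (x ≢ y × P (col y))
  recoloured col x c y P p with x ≟ y
  ... | yes refl = inj₁ (refl , subst P (↦-same col x) p)
  ... | no x≢y = inj₂ (x≢y , subst P (↦-other col x≢y) p)

  push : ∀ {col st bl y} → Dfs col st bl → col y ≡ 0 → y < T →
         Linked (λ a b → E b a) (y ∷ st) → Dfs (col [ y ↦ 1 ]) (y ∷ st) bl
  push {col} {st} {bl} {y} d white y<T linked = record
    { covered = covered'
    ; first-done = λ {x} 2≤ → first-done' x (recoloured col y 1 x (2 ≤_) 2≤)
    ; second-done = λ {x} 3≤ → second-done' x (recoloured col y 1 x (3 ≤_) 3≤)
    ; grey = grey'
    ; black = λ {x} x∈ → let (x<T , 3≤) = black x∈ in x<T , ≤-trans 3≤ (mono x)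
    ; path = linked
    ; unique = All.tabulate (λ {x} x∈ y≡x → proj₂ (grey x∈) (trans (cong col (sym y≡x)) white)) ∷ unique
    ; disjoint = λ { (here refl) y∈ → contradiction (≤-trans (proj₂ (black y∈)) (≤-reflexive white)) λ ()
                   ; (there x∈) → disjoint x∈ }
    ; good = good ; escaping = escaping }
    where
    open Dfs d
    mono : ∀ x → col x ≤ (col [ y ↦ 1 ]) x
    mono = recolour-≥ col (≤-trans (≤-reflexive white) z≤n)
    covered' : ∀ {x} → (col [ y ↦ 1 ]) x ≢ 0 → x ∈ y ∷ st ⊎ x ∈ bl
    covered' {x} c with recoloured col y 1 x (_≢ 0) c
    ... | inj₁ (refl , _) = inj₁ (here refl)
    ... | inj₂ (_ , c') with covered c'
    ...   | inj₁ x∈ = inj₁ (there x∈)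
    ...   | inj₂ x∈ = inj₂ x∈
    first-done' : ∀ x → (y ≡ x × 2 ≤ 1) ⊎ (y ≢ x × 2 ≤ col x) → (col [ y ↦ 1 ]) (σ0 x) ≢ 0
    first-done' x (inj₁ (_ , s≤s ()))
    first-done' x (inj₂ (_ , 2≤)) = ≢0-mono (mono (σ0 x)) (first-done 2≤)
    second-done' : ∀ x → (y ≡ x × 3 ≤ 1) ⊎ (y ≢ x × 3 ≤ col x) → (col [ y ↦ 1 ]) (σ1 x) ≢ 0
    second-done' x (inj₁ (_ , s≤s ()))
    second-done' x (inj₂ (_ , 3≤)) = ≢0-mono (mono (σ1 x)) (second-done 3≤)
    grey' : ∀ {x} → x ∈ y ∷ st → x < T × (col [ y ↦ 1 ]) x ≢ 0
    grey' (here refl) = y<T , λ eq → contradiction (trans (sym (↦-same col y)) eq) λ ()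
    grey' (there x∈) = proj₁ (grey x∈) , ≢0-mono (mono _) (proj₂ (grey x∈))

  advance : ∀ {col st bl x} → Dfs col st bl → x ∈ st →
            (2 ≤ suc (col x) → col (σ0 x) ≢ 0) → (3 ≤ suc (col x) → col (σ1 x) ≢ 0) →
            Dfs (col [ x ↦ suc (col x) ]) st bl
  advance {col} {st} {bl} {x} d x∈st visited0 visited1 = record
    { covered = λ {y} c → covered (nonzero y (recoloured col x (suc (col x)) y (_≢ 0) c))
    ; first-done = λ {y} 2≤ → ≢0-mono (mono (σ0 y)) (first-done' y (recoloured col x (suc (col x)) y (2 ≤_) 2≤))
    ; second-done = λ {y} 3≤ → ≢0-mono (mono (σ1 y)) (second-done' y (recoloured col x (suc (col x)) y (3 ≤_) 3≤))
    ; grey = λ {y} y∈ → proj₁ (grey y∈) , ≢0-mono (mono y) (proj₂ (grey y∈))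
    ; black = λ {y} y∈ → proj₁ (black y∈) , ≤-trans (proj₂ (black y∈)) (mono y)
    ; path = path ; unique = unique ; disjoint = disjoint ; good = good ; escaping = escaping }
    where
    open Dfs d
    mono : ∀ y → col y ≤ (col [ x ↦ suc (col x) ]) y
    mono = recolour-≥ col (n≤1+n _)
    nonzero : ∀ y → (x ≡ y × suc (col x) ≢ 0) ⊎ (x ≢ y × col y ≢ 0) → col y ≢ 0
    nonzero y (inj₁ (refl , _)) = proj₂ (grey x∈st)
    nonzero y (inj₂ (_ , c)) = c
    first-done' : ∀ y → (x ≡ y × 2 ≤ suc (col x)) ⊎ (x ≢ y × 2 ≤ col y) → col (σ0 y) ≢ 0
    first-done' y (inj₁ (refl , 2≤)) = visited0 2≤
    first-done' y (inj₂ (_ , 2≤)) = first-done 2≤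
    second-done' : ∀ y → (x ≡ y × 3 ≤ suc (col x)) ⊎ (x ≢ y × 3 ≤ col y) → col (σ1 y) ≢ 0
    second-done' y (inj₁ (refl , 3≤)) = visited1 3≤
    second-done' y (inj₂ (_ , 3≤)) = second-done 3≤

  stack-reaches-top : ∀ {r st g} → Linked (λ a b → E b a) (r ∷ st) → g ∈ r ∷ st → g ⟶* r
  stack-reaches-top linked        (here refl) = ε
  stack-reaches-top (e ∷ linked)  (there g∈)  = stack-reaches-top linked g∈ ◅◅ (e ◅ ε)
  stack-reaches-top [-]           (there ())

  -- `g` is the end of the first arc by which the path leaves `bl`.
  exit : ∀ {bl y w} (Q : ℕ → Set) → (∀ {x z} → x ∈ bl → E x z → z ∈ bl ⊎ Q z) →
         y ∈ bl → y ⟶* w → w ∉ bl → ∃[ g ] (Q g × y ⟶* g × g ⟶* w)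
  exit Q leave y∈ ε w∉ = contradiction y∈ w∉
  exit Q leave y∈ (e ◅ es) w∉ with leave y∈ e
  ... | inj₂ q = _ , q , e ◅ ε , es
  ... | inj₁ z∈ with exit Q leave z∈ es w∉
  ...   | g , q , p , p' = g , q , e ◅ p , p'

  -- The stack is a path, so every grey node reaches `r`. All successors of finished nodes are
  -- coloured, so a path from `r` that leaves the finished nodes does so at a grey node. That node
  -- is in the component of `r`, which is therefore not completely finished.
  pop : ∀ {col r st bl} → Dfs col (r ∷ st) bl → 3 ≤ col r → Dfs col st (r ∷ bl)
  pop {col} {r} {st} {bl} d 3≤ = record
    { covered = covered'
    ; first-done = first-done ; second-done = second-done
    ; grey = λ x∈ → grey (there x∈)
    ; black = λ { (here refl) → proj₁ (grey (here refl)) , 3≤ ; (there x∈) → black x∈ }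
    ; path = Linked.tail path
    ; unique = tail-unique unique
    ; disjoint = λ { x∈ (here refl) → All.lookup (head-fresh unique) x∈ refl
                   ; x∈ (there x∈bl) → disjoint (there x∈) x∈bl }
    ; good = good , good-r
    ; escaping = escaping' }
    where
    open Dfs d
    tail-unique : Unique (r ∷ st) → Unique st
    tail-unique (_ ∷ u) = u
    head-fresh : Unique (r ∷ st) → All (r ≢_) st
    head-fresh (a ∷ _) = a
    covered' : ∀ {x} → col x ≢ 0 → x ∈ st ⊎ x ∈ r ∷ bl
    covered' c with covered c
    ... | inj₁ (here refl) = inj₂ (here refl)
    ... | inj₁ (there x∈) = inj₁ x∈
    ... | inj₂ x∈ = inj₂ (there x∈)
    r∉bl : r ∉ bl
    r∉bl = disjoint (here refl)
    good-r : ∀ y → y ⟶* r → ∃[ z ] (z ~ y × z ∉ bl)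
    -- A finished `y` still reaches the unfinished `r`, so the old invariant supplies the witness;
    -- an unfinished `y` is its own witness.
    good-r y p with y ∈? bl
    ... | yes y∈ = escaping y∈ p r∉bl
    ... | no y∉ = y , ~-refl , y∉
    finished : ∀ {x} → x ∈ r ∷ bl → 3 ≤ col x
    finished (here refl) = 3≤
    finished (there x∈) = proj₂ (black x∈)
    target≢0 : ∀ {x z} → x ∈ r ∷ bl → E x z → col z ≢ 0
    target≢0 x∈ (_ , inj₁ refl) = first-done (≤-trans (n≤1+n 2) (finished x∈))
    target≢0 x∈ (_ , inj₂ refl) = second-done (finished x∈)
    leave : ∀ {x z} → x ∈ r ∷ bl → E x z → z ∈ r ∷ bl ⊎ (z ∈ st)
    leave x∈ e with covered' (target≢0 x∈ e)
    ... | inj₁ z∈ = inj₂ z∈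
    ... | inj₂ z∈ = inj₁ z∈
    r-escapes : ∀ {w} → r ⟶* w → w ∉ r ∷ bl → ∃[ z ] (z ~ r × z ∉ r ∷ bl)
    r-escapes p w∉ with exit (_∈ st) leave (here refl) p w∉
    ... | g , g∈ , r⟶g , _ = g , (stack-reaches-top path (there g∈) , r⟶g) ,
      λ { (here refl) → All.lookup (head-fresh unique) g∈ refl ; (there g∈bl) → disjoint (there g∈) g∈bl }
    escaping' : ∀ {y w} → y ∈ r ∷ bl → y ⟶* w → w ∉ r ∷ bl → ∃[ z ] (z ~ y × z ∉ r ∷ bl)
    escaping' (here refl) p w∉ = r-escapes p w∉
    escaping' {y} {w} (there y∈) p w∉ with escaping y∈ p (λ w∈ → w∉ (there w∈))
    ... | z , z~y , z∉ with z ≟ r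
    ...   | no z≢r = z , z~y , λ { (here z≡r) → z≢r z≡r ; (there z∈) → z∉ z∈ }
    -- The witness for `y` was `r`, which has just been finished; the grey node found for `r`
    -- replaces it.
    ...   | yes refl with r-escapes (proj₁ z~y ◅◅ p) w∉
    ...     | g , g~r , g∉ = g , ~-trans g~r z~y , g∉

  -- `pending` holds the assigned nodes whose predecessors are still to be examined; only they may
  -- violate the closure in `closed`. `info` preserves what `Good` said about the current root after
  -- that root has left `rest`, and is void between two roots. `named` ensures that a fresh root
  -- brings a fresh number.
  record Sweep (comp : ℕ → ℕ) (rest pending : List ℕ) : Set where
    field
      covered : ∀ {x} → x < T → x ∈ rest ⊎ comp x ≢ 0
      good    : Good rest
      sound   : ∀ {x y} → comp x ≢ 0 → comp x ≡ comp y → x ~ y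
      closed  : ∀ {x y} → comp x ≢ 0 → E y x → y ~ x → comp y ≡ comp x ⊎ x ∈ pending
      root    : ℕ
      current : ∀ {x} → x ∈ pending → comp x ≡ suc root
      info    : ∀ {x} → x ∈ pending → ∀ y → y ⟶* root → ∃[ z ] (z ~ y × z ∉ rest)
      named   : ∀ {x r} → comp x ≡ suc r → comp r ≡ suc r

  -- All nodes on the path from `y` to `x` belong to their common component. Without pending nodes
  -- in the class, `closed` carries the number backwards along the path.
  back-closed : ∀ {comp rest pending c x y} → Sweep comp rest pending → c ≢ 0 →
                (∀ {z} → z ∈ pending → comp z ≢ c) → comp x ≡ c → y ~ x → comp y ≡ c
  back-closed {comp} {c = c} {x} sw c≢0 other x≡c (p , q) = go p q
    where
    go : ∀ {y} → y ⟶* x → x ⟶* y → comp y ≡ c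
    go ε q = x≡c
    go (_◅_ {j = y₁} e p) q with go p (q ◅◅ (e ◅ ε))
    ... | y₁≡c with Sweep.closed sw (λ eq → c≢0 (trans (sym y₁≡c) eq)) e (e ◅ ε , p ◅◅ q)
    ...   | inj₁ eq = trans eq y₁≡c
    ...   | inj₂ y₁∈ = contradiction y₁≡c (other y₁∈)

  assign-kept : ∀ (comp : ℕ → ℕ) {y c} x → comp y ≡ 0 → comp x ≢ 0 → (comp [ y ↦ c ]) x ≡ comp x
  assign-kept comp {y} {c} x y≡0 x≢0 = ↦-other comp {y} {x} (λ { refl → x≢0 y≡0 })

  assign-≢0 : ∀ (comp : ℕ → ℕ) {y c} x → c ≢ 0 → comp x ≢ 0 → (comp [ y ↦ c ]) x ≢ 0
  assign-≢0 comp {y} {c} x c≢0 x≢0 with y ≟ x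
  ... | yes refl = λ eq → c≢0 (trans (sym (↦-same comp y)) eq)
  ... | no y≢x = λ eq → x≢0 (trans (sym (↦-other comp y≢x)) eq)

  assign-covered : ∀ {rest} comp y {c} → c ≢ 0 → ∀ {x} → x ∈ y ∷ rest ⊎ comp x ≢ 0 →
                   x ∈ rest ⊎ (comp [ y ↦ c ]) x ≢ 0
  assign-covered comp y c≢0 (inj₁ (here refl)) = inj₂ λ eq → c≢0 (trans (sym (↦-same comp y)) eq)
  assign-covered comp y c≢0 (inj₁ (there x∈)) = inj₁ x∈
  assign-covered comp y c≢0 {x} (inj₂ x≢0) = inj₂ (assign-≢0 comp {y} x c≢0 x≢0)

  assign-sound : ∀ {comp : ℕ → ℕ} {y c} → (∀ {a b} → comp a ≢ 0 → comp a ≡ comp b → a ~ b) →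
    comp y ≡ 0 → (∀ {b} → comp b ≡ c → b ~ y) →
    ∀ {a b} → (comp [ y ↦ c ]) a ≢ 0 → (comp [ y ↦ c ]) a ≡ (comp [ y ↦ c ]) b → a ~ b
  assign-sound {comp} {y} {c} sound y≡0 class {a} {b} a≢0 a≡b with y ≟ a | y ≟ b
  ... | yes refl | yes refl = ~-refl
  ... | yes refl | no y≢b = ~-sym (class (trans (sym (trans a≡b (↦-other comp y≢b))) (↦-same comp y)))
  ... | no y≢a | yes refl = class (trans (sym (↦-other comp y≢a)) (trans a≡b (↦-same comp y)))
  ... | no y≢a | no y≢b = sound (λ eq → a≢0 (trans (↦-other comp y≢a) eq))
          (trans (sym (↦-other comp y≢a)) (trans a≡b (↦-other comp y≢b)))

  assign-closed : ∀ {comp : ℕ → ℕ} {pending y c} →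
    (∀ {a b} → comp a ≢ 0 → E b a → b ~ a → comp b ≡ comp a ⊎ a ∈ pending) → comp y ≡ 0 →
    ∀ {a b} → (comp [ y ↦ c ]) a ≢ 0 → E b a → b ~ a →
    (comp [ y ↦ c ]) b ≡ (comp [ y ↦ c ]) a ⊎ a ∈ y ∷ pending
  assign-closed {comp} {y = y} closed y≡0 {a} {b} a≢0 e b~a with y ≟ a
  ... | yes refl = inj₂ (here refl)
  ... | no y≢a with closed a≢0' e b~a
    where
    a≢0' : comp a ≢ 0
    a≢0' eq = a≢0 (trans (↦-other comp y≢a) eq)
  ...   | inj₂ a∈ = inj₂ (there a∈)
  ...   | inj₁ eq = inj₁ (trans (assign-kept comp b y≡0 (λ b≡0 → a≢0 (trans (↦-other comp y≢a) (trans (sym eq) b≡0))))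
                          (trans eq (sym (↦-other comp y≢a))))

  assign-named : ∀ {comp : ℕ → ℕ} {y c} → (∀ {x r} → comp x ≡ suc r → comp r ≡ suc r) → comp y ≡ 0 →
    (∀ {r} → c ≡ suc r → (comp [ y ↦ c ]) r ≡ suc r) →
    ∀ {x r} → (comp [ y ↦ c ]) x ≡ suc r → (comp [ y ↦ c ]) r ≡ suc r
  assign-named {comp} {y} named y≡0 c-named {x} {r} eq with y ≟ x
  ... | yes refl = c-named (trans (sym (↦-same comp y)) eq)
  ... | no y≢x = trans (assign-kept comp r y≡0 (λ r≡0 → 0≢1+n (trans (sym r≡0) r≡))) r≡
    where
    r≡ : comp r ≡ suc r
    r≡ = named (trans (sym (↦-other comp y≢x)) eq)

  -- The crucial claim is `y ~ x`. Since `y` reaches the root, its component has a node `z` outside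
  -- `rest`, hence an assigned one. If `z` has the current number, the claim follows by `sound`.
  -- Otherwise the class of `z` has no pending node, so it is closed and would already contain `y`,
  -- which is unassigned.
  visit : ∀ {comp rest pending x y} → Sweep comp rest pending → x ∈ pending → E y x → comp y ≡ 0 →
          Sweep (comp [ y ↦ comp x ]) rest (y ∷ pending)
  visit {comp} {rest} {pending} {x} {y} sw x∈ e y≡0 = record
    { covered = λ z<T → covered' (covered z<T)
    ; good = good
    ; sound = assign-sound sound y≡0 (λ b≡ → ~-trans (sound (λ b≡0 → x≢0 (trans (sym b≡) b≡0)) b≡) (~-sym y~x))
    ; closed = assign-closed closed y≡0
    ; root = root
    ; current = λ { (here refl) → trans (↦-same comp y) (current x∈)
                  ; {z} (there z∈) → trans (assign-kept comp z y≡0 (pending≢0 z∈)) (current z∈) }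
    ; info = λ _ → info x∈
    ; named = assign-named named y≡0 λ {r} eq →
        trans (assign-kept comp r y≡0 (λ r≡0 → 0≢1+n (trans (sym r≡0) (named eq)))) (named eq) }
    where
    open Sweep sw
    pending≢0 : ∀ {z} → z ∈ pending → comp z ≢ 0
    pending≢0 z∈ eq = 0≢1+n (trans (sym eq) (current z∈))
    x≢0 : comp x ≢ 0
    x≢0 = pending≢0 x∈
    covered' : ∀ {z} → z ∈ rest ⊎ comp z ≢ 0 → z ∈ rest ⊎ (comp [ y ↦ comp x ]) z ≢ 0
    covered' (inj₁ z∈) = inj₁ z∈
    covered' {z} (inj₂ z≢0) = inj₂ (assign-≢0 comp {y} z x≢0 z≢0)
    y~x : y ~ x
    y~x with info x∈ y (e ◅ proj₁ (sound x≢0 (trans (current x∈) (sym (named (current x∈))))))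
    ... | z , z~y , z∉ with covered (source< (proj₁ z~y) (proj₁ e))
    ...   | inj₁ z∈ = contradiction z∈ z∉
    ...   | inj₂ z≢0 with comp z ≟ comp x
    ...     | yes z≡x = ~-trans (~-sym z~y) (sound z≢0 z≡x)
    ...     | no z≢x = contradiction
                (trans (sym (back-closed sw z≢0 (λ w∈ eq → z≢x
                    (trans (sym eq) (trans (current w∈) (sym (current x∈)))))
                               refl (~-sym z~y))) y≡0) z≢0

  new-root : ∀ {comp r rest} → Sweep comp (r ∷ rest) [] → comp r ≡ 0 →
             Sweep (comp [ r ↦ suc r ]) rest (r ∷ [])
  new-root {comp} {r} {rest} sw r≡0 = record
    { covered = λ z<T → assign-covered comp r (λ ()) (covered z<T)
    ; good = proj₁ good
    -- A node already numbered `suc r` would by `named` make `comp r` nonzero.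
    ; sound = assign-sound sound r≡0 (λ b≡ → contradiction (trans (sym r≡0) (named b≡)) 0≢1+n)
    ; closed = assign-closed closed r≡0
    ; root = r
    ; current = λ { (here refl) → ↦-same comp r }
    ; info = λ _ → proj₂ good
    ; named = assign-named named r≡0 (λ { refl → ↦-same comp r }) }
    where open Sweep sw

  skip-root : ∀ {comp r rest} → Sweep comp (r ∷ rest) [] → comp r ≢ 0 → Sweep comp rest []
  skip-root {comp} {r} {rest} sw r≢0 = record
    { covered = λ z<T → covered' (covered z<T)
    ; good = proj₁ good ; sound = sound ; closed = closed ; root = root
    ; current = λ () ; info = λ () ; named = named }
    where
    open Sweep sw
    covered' : ∀ {z} → z ∈ r ∷ rest ⊎ comp z ≢ 0 → z ∈ rest ⊎ comp z ≢ 0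
    covered' (inj₁ (here refl)) = inj₂ r≢0
    covered' (inj₁ (there z∈)) = inj₁ z∈
    covered' (inj₂ z≢0) = inj₂ z≢0

  -- A predecessor of `x` in its component cannot have a different number: that class would have no
  -- pending node, hence be closed, and would have claimed `x` as well.
  settle : ∀ {comp rest pending pending' x} → Sweep comp rest pending → x ∈ pending →
           (∀ {y} → E y x → comp y ≢ 0) →
           (∀ {z} → z ∈ pending → z ≡ x ⊎ z ∈ pending') → (∀ {z} → z ∈ pending' → z ∈ pending) →
           Sweep comp rest pending'
  settle {comp} {rest} {pending} {pending'} {x} sw x∈ visited shrink grow = record
    { covered = covered ; good = good ; sound = sound ; closed = closed'
    ; root = root ; current = λ z∈ → current (grow z∈) ; info = λ z∈ → info (grow z∈) ; named = named }
    where
    open Sweep sw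
    closed' : ∀ {a b} → comp a ≢ 0 → E b a → b ~ a → comp b ≡ comp a ⊎ a ∈ pending'
    closed' {a} {b} a≢0 e b~a with closed a≢0 e b~a
    ... | inj₁ eq = inj₁ eq
    ... | inj₂ a∈ with shrink a∈
    ...   | inj₂ a∈' = inj₂ a∈'
    ...   | inj₁ refl with comp b ≟ comp x
    ...     | yes eq = inj₁ eq
    ...     | no b≢x = contradiction
                (sym (back-closed sw (visited e) (λ w∈ eq → b≢x
                    (trans (sym eq) (trans (current w∈) (sym (current x∈)))))
                  refl (~-sym b~a))) b≢x

  sweep-start : ∀ {comp bl} → (∀ x → comp x ≡ 0) → Good bl → (∀ {x} → x < T → x ∈ bl) → Sweep comp bl []
  sweep-start blank g all = record
    { covered = λ z<T → inj₁ (all z<T) ; good = g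
    ; sound = λ {x} x≢0 → contradiction (blank x) x≢0
    ; closed = λ {x} x≢0 → contradiction (blank x) x≢0
    ; root = 0 ; current = λ () ; info = λ ()
    ; named = λ {x} eq → contradiction (trans (sym (blank x)) eq) 0≢1+n }

  sweep-end : ∀ {comp} → Sweep comp [] [] → ∀ {x y} → x < T →
              (comp x ≡ comp y → x ~ y) × (x ~ y → comp x ≡ comp y)
  sweep-end {comp} sw {x} {y} x<T = Sweep.sound sw x≢0 , λ x~y →
    sym (back-closed sw x≢0 (λ ()) refl (~-sym x~y))
    where
    x≢0 : comp x ≢ 0
    x≢0 with Sweep.covered sw x<T
    ... | inj₁ ()
    ... | inj₂ x≢0 = x≢0

  reorder : ∀ {comp rest pending pending'} → Sweep comp rest pending →
            (∀ {z} → z ∈ pending → z ∈ pending') → (∀ {z} → z ∈ pending' → z ∈ pending) →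
            Sweep comp rest pending'
  reorder {comp} {pending = pending} {pending'} sw grow shrink = record
    { covered = covered ; good = good ; sound = sound ; closed = closed'
    ; root = root ; current = λ z∈ → current (shrink z∈) ; info = λ z∈ → info (shrink z∈) ; named = named }
    where
    open Sweep sw
    closed' : ∀ {a b} → comp a ≢ 0 → E b a → b ~ a → comp b ≡ comp a ⊎ a ∈ pending'
    closed' a≢0 e b~a with closed a≢0 e b~a
    ... | inj₁ eq = inj₁ eq
    ... | inj₂ a∈ = inj₂ (grow a∈)

-- The two passes of the component search

-- The list reads the cells downwards, so that appending to the array is a cons.
data Holds (f : ℕ → ℕ) : ℕ → List ℕ → Set where
  []   : Holds f 0 []
  snoc : ∀ {n x xs} → f n ≡ x → Holds f n xs → Holds f (suc n) (x ∷ xs)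

Holds-write : ∀ {f n xs i v} → n ≤ i → Holds f n xs → Holds (f [ i ↦ v ]) n xs
Holds-write n≤i [] = []
Holds-write {f} n≤i (snoc eq h) =
  snoc (trans (↦-other f (λ i≡n → <⇒≱ n≤i (≤-reflexive i≡n))) eq) (Holds-write (≤-trans (n≤1+n _) n≤i) h)

Holds-push : ∀ {f n xs v} → Holds f n xs → Holds (f [ n ↦ v ]) (suc n) (v ∷ xs)
Holds-push {f} {n} h = snoc (↦-same f n) (Holds-write ≤-refl h)

Σ< : ℕ → (ℕ → ℕ) → ℕ
Σ< zero    f = 0
Σ< (suc n) f = f n + Σ< n f

Σ<-cong : ∀ n {f g : ℕ → ℕ} → (∀ x → x < n → f x ≡ g x) → Σ< n f ≡ Σ< n g
Σ<-cong zero    eq = refl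
Σ<-cong (suc n) eq = cong₂ _+_ (eq n ≤-refl) (Σ<-cong n (λ x x<n → eq x (m<n⇒m<1+n x<n)))

Σ<-≤ : ∀ n {f : ℕ → ℕ} c → (∀ x → f x ≤ c) → Σ< n f ≤ n * c
Σ<-≤ zero    c f≤ = z≤n
Σ<-≤ (suc n) c f≤ = +-mono-≤ (f≤ n) (Σ<-≤ n c f≤)

Σ<-drop : ∀ n k {f g : ℕ → ℕ} x → x < n → (∀ y → x ≢ y → g y ≡ f y) → k + g x ≤ f x →
          k + Σ< n g ≤ Σ< n f
Σ<-drop (suc n) k {f} {g} x x<n same drop with x ≟ n
... | yes refl = ≤-trans (≤-reflexive (sym (+-assoc k (g x) (Σ< n g))))
  (+-mono-≤ drop (≤-reflexive (Σ<-cong n (λ y y<n → same y (λ x≡y → <⇒≢ y<n (sym x≡y))))))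
... | no x≢n = ≤-trans (≤-reflexive swap)
  (+-mono-≤ (≤-reflexive (same n x≢n)) (Σ<-drop n k x (≤∧≢⇒< (≤-pred x<n) x≢n) same drop))
  where
  swap : k + (g n + Σ< n g) ≡ g n + (k + Σ< n g)
  swap = trans (sym (+-assoc k (g n) _)) (trans (cong (_+ Σ< n g) (+-comm k (g n))) (+-assoc (g n) k _))

Σ<-write : ∀ n k (w : ℕ → ℕ) (f : ℕ → ℕ) {x c} → x < n → k + w c ≤ w (f x) →
           k + Σ< n (λ y → w ((f [ x ↦ c ]) y)) ≤ Σ< n (λ y → w (f y))
Σ<-write n k w f {x} {c} x<n drop = Σ<-drop n k x x<n (λ y x≢y → cong w (↦-other f x≢y))
  (≤-trans (≤-reflexive (cong (λ v → k + w v) (↦-same f x))) drop)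

-- Nested to the right and ending in `lit 0`, its value is definitionally `6 * n`.
mul6 : Exp → Exp
mul6 e = e ⊕ (e ⊕ (e ⊕ (e ⊕ (e ⊕ (e ⊕ lit 0)))))

push-nbr : Com
push-nbr = COL ⟪ var NBR ⟫≔ lit 1 ⨾′ STK ⟪ var TOP ⟫≔ var NBR ⨾′ TOP ≔ lit 1 ⊕ var TOP

dfs-cond : Exp
dfs-cond = (mul6 (var LEN) ⊖ var ROOT) ⊕ var TOP

-- An iteration scans one root, finishes one node or examines one successor. The explicit stack thus
-- flattens the recursive search into one loop with a loop-free body.
dfs-body : Com
dfs-body =
  ifz (var TOP)
    (NBR ≔ var ROOT ⨾′ ROOT ≔ lit 1 ⊕ var ROOT ⨾′ ifz (COL at var NBR) push-nbr skip)
    (CUR ≔ STK at (var TOP ⊖ lit 1) ⨾′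
     ifz (lit 3 ⊖ COL at var CUR)
       (ORD ⟪ var FIN ⟫≔ var CUR ⨾′ FIN ≔ lit 1 ⊕ var FIN ⨾′ TOP ≔ var TOP ⊖ lit 1)
       (NBR ≔ cond (COL at var CUR ⊖ lit 1) (SUCC0 at var CUR) (SUCC1 at var CUR) ⨾′
        ifz (COL at var NBR) push-nbr skip ⨾′
        COL ⟪ var CUR ⟫≔ lit 1 ⊕ COL at var CUR))

module DfsPass (T : ℕ) (σ0 σ1 : ℕ → ℕ)
               (σ0< : ∀ {x} → x < T → σ0 x < T) (σ1< : ∀ {x} → x < T → σ1 x < T) where
  open Digraph T σ0 σ1

  record DfsState (col stk ord : ℕ → ℕ) (top fin root : ℕ) : Set where
    field
      {st bl} : List ℕ
      dfs     : Dfs col st bl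
      stack   : Holds stk top st
      order   : Holds ord fin bl
      scanned : ∀ x → x < root → col x ≢ 0

  open DfsState

  -- A push raises `top` by one, and the pushed node's loss of whiteness pays for it. The advance of
  -- `root`, or of the colour of the current node, then makes the total decrease.
  measure : (ℕ → ℕ) → ℕ → ℕ → ℕ
  measure col top root = (T ∸ root) + (top + Σ< T (λ x → 3 ∸ col x))

  extend-scanned : ∀ {col : ℕ → ℕ} {root} → (∀ x → x < root → col x ≢ 0) → col root ≢ 0 →
                   ∀ x → x < suc root → col x ≢ 0
  extend-scanned {root = root} old new x x< with x ≟ root
  ... | yes refl = new
  ... | no x≢ = old x (≤∧≢⇒< (≤-pred x<) x≢)

  push-root : ∀ {col stk ord top fin root} → top ≡ 0 → root < T → col root ≡ 0 →
    DfsState col stk ord top fin root →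
    DfsState (col [ root ↦ 1 ]) (stk [ top ↦ root ]) ord (suc top) fin (suc root)
    × measure (col [ root ↦ 1 ]) (suc top) (suc root) < measure col top root
  push-root {col} {root = root} refl root<T white record { dfs = d ; stack = [] ; order = o ; scanned = sc } =
    record { dfs = push d white root<T [-] ; stack = Holds-push [] ; order = o
           ; scanned = extend-scanned (λ x x< → ≢0-mono (recolour-≥ col (≤-trans (≤-reflexive white) z≤n) x)
               (sc x x<))
                         (λ eq → 0≢1+n (trans (sym eq) (↦-same col root))) }
    , +-mono-<-≤ (∸-monoʳ-< (n<1+n root) root<T)
        (Σ<-write T 1 (3 ∸_) col root<T (≤-reflexive (sym (cong (3 ∸_) white))))

  skip-scanned : ∀ {col stk ord top fin root} → root < T → col root ≢ 0 →
    DfsState col stk ord top fin root →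
    DfsState col stk ord top fin (suc root) × measure col top (suc root) < measure col top root
  skip-scanned root<T seen s = record { dfs = dfs s ; stack = stack s ; order = order s
      ; scanned = extend-scanned (scanned s) seen }
    , +-monoˡ-< _ (∸-monoʳ-< (n<1+n _) root<T)

  pop-top : ∀ {col stk ord top fin root} → top ≢ 0 → 3 ∸ col (stk (top ∸ 1)) ≡ 0 →
    DfsState col stk ord top fin root →
    DfsState col stk (ord [ fin ↦ stk (top ∸ 1) ]) (top ∸ 1) (suc fin) root
    × measure col (top ∸ 1) root < measure col top root
  pop-top {root = root} top≢0 done record { stack = [] } = contradiction refl top≢0
  pop-top {root = root} top≢0 done record { dfs = d ; stack = snoc refl h ; order = o ; scanned = sc } =
    record { dfs = pop d (m∸n≡0⇒m≤n done) ; stack = h ; order = Holds-push o ; scanned = sc }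
    , +-monoʳ-< (T ∸ root) ≤-refl

  next-succ : (ℕ → ℕ) → ℕ → ℕ
  next-succ col x = choose (col x ∸ 1) (σ0 x) (σ1 x)

  dfs-advance : ∀ {col st bl x} → Dfs col st bl → x ∈ st → col (next-succ col x) ≢ 0 →
                Dfs (col [ x ↦ suc (col x) ]) st bl
  dfs-advance {col} {x = x} d x∈ seen = advance d x∈ (visited0 (col x) refl) (visited1 (col x) refl)
    where
    visited0 : ∀ c → col x ≡ c → 2 ≤ suc c → col (σ0 x) ≢ 0
    visited0 zero          eq (s≤s ())
    visited0 (suc zero)    eq _ = subst (λ c → col (choose (c ∸ 1) (σ0 x) (σ1 x)) ≢ 0) eq seen
    visited0 (suc (suc c)) eq _ = Dfs.first-done d (≤-trans (s≤s (s≤s z≤n)) (≤-reflexive (sym eq)))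
    visited1 : ∀ c → col x ≡ c → 3 ≤ suc c → col (σ1 x) ≢ 0
    visited1 zero          eq (s≤s ())
    visited1 (suc zero)    eq (s≤s (s≤s ()))
    visited1 (suc (suc c)) eq _ = subst (λ c → col (choose (c ∸ 1) (σ0 x) (σ1 x)) ≢ 0) eq seen

  weight-advance : ∀ (col : ℕ → ℕ) {x} → x < T → 3 ∸ col x ≢ 0 →
    Σ< T (λ y → 3 ∸ (col [ x ↦ suc (col x) ]) y) < Σ< T (λ y → 3 ∸ col y)
  weight-advance col {x} x<T more = Σ<-write T 1 (3 ∸_) col x<T (≤-reflexive (drops (col x) more))
    where
    drops : ∀ c → 3 ∸ c ≢ 0 → suc (3 ∸ suc c) ≡ 3 ∸ c
    drops 0 _ = refl
    drops 1 _ = refl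
    drops 2 _ = refl
    drops (suc (suc (suc c))) more = contradiction (0∸n≡0 c) more

  stay-top : ∀ {col stk ord top fin root} → top ≢ 0 → let x = stk (top ∸ 1) in
    3 ∸ col x ≢ 0 → col (next-succ col x) ≢ 0 → DfsState col stk ord top fin root →
    DfsState (col [ x ↦ suc (col x) ]) stk ord top fin root
    × measure (col [ x ↦ suc (col x) ]) top root < measure col top root
  stay-top top≢0 more seen record { stack = [] } = contradiction refl top≢0
  stay-top {col} {top = top} {root = root} top≢0 more seen record { dfs = d ; stack = h@(snoc refl _)
      ; order = o ; scanned = sc } =
    record { dfs = dfs-advance d (here refl) seen ; stack = h ; order = o
           ; scanned = λ x x< → ≢0-mono (recolour-≥ col (n≤1+n _) x) (sc x x<) }
    , +-monoʳ-< (T ∸ root) (+-monoʳ-< top (weight-advance col (proj₁ (Dfs.grey d (here refl))) more))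

  choose-< : ∀ n {a b} → a < T → b < T → choose n a b < T
  choose-< zero    a< b< = a<
  choose-< (suc n) a< b< = b<

  next-edge : ∀ {x} n → x < T → E x (choose n (σ0 x) (σ1 x))
  next-edge zero    x<T = x<T , inj₁ refl
  next-edge (suc n) x<T = x<T , inj₂ refl

  push-top : ∀ {col stk ord top fin root y} → top ≢ 0 → let x = stk (top ∸ 1) ; col' = col [ y ↦ 1 ] in
    3 ∸ col x ≢ 0 → y ≡ next-succ col x → col y ≡ 0 → DfsState col stk ord top fin root →
    DfsState (col' [ x ↦ suc (col' x) ]) (stk [ top ↦ y ]) ord (suc top) fin root
    × measure (col' [ x ↦ suc (col' x) ]) (suc top) root < measure col top root
  push-top top≢0 more y≡ white record { stack = [] } = contradiction refl top≢0
  push-top {col} {stk} {top = suc top} {root = root} {y = y} top≢0 more y≡ white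
           record { dfs = d ; stack = h@(snoc {xs = st} refl _) ; order = o ; scanned = sc } =
    record { dfs = dfs-advance pushed (there (here refl)) seen
           ; stack = Holds-push h ; order = o
           ; scanned = λ z z< → ≢0-mono (recolour-≥ col' {x} (n≤1+n _) z)
               (≢0-mono (recolour-≥ col (≤-trans (≤-reflexive white) z≤n) z) (sc z z<)) }
    , +-monoʳ-< (T ∸ root) (≤-trans (≤-reflexive shift) (+-monoʳ-≤ (suc top) heavier))
    where
    x = stk top
    col' = col [ y ↦ 1 ]
    x<T = proj₁ (Dfs.grey d (here refl))
    y<T : y < T
    y<T = subst (_< T) (sym y≡) (choose-< (col x ∸ 1) (σ0< x<T) (σ1< x<T))
    y≢x : y ≢ x
    y≢x refl = proj₂ (Dfs.grey d (here refl)) white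
    pushed : Dfs col' (y ∷ x ∷ st) (bl record { dfs = d ; stack = h ; order = o ; scanned = sc })
    pushed = push d white y<T (subst (E x) (sym y≡) (next-edge (col x ∸ 1) x<T) ∷ Dfs.path d)
    col'x : col' x ≡ col x
    col'x = ↦-other col y≢x
    seen : col' (next-succ col' x) ≢ 0
    seen eq = 0≢1+n (trans (sym eq) (trans (cong (λ c → col' (choose (c ∸ 1) (σ0 x) (σ1 x))) col'x)
                (trans (cong col' (sym y≡)) (↦-same col y))))
    -- One unit is gained by colouring `y` and one by advancing `x`; the first pays for the longer
    -- stack.
    weight' = Σ< T (λ z → 3 ∸ (col' [ x ↦ suc (col' x) ]) z)
    heavier : suc (suc weight') ≤ Σ< T (λ z → 3 ∸ col z)
    heavier = ≤-trans (s≤s (weight-advance col' x<T (λ eq → more (trans (cong (3 ∸_) (sym col'x)) eq))))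
                      (Σ<-write T 1 (3 ∸_) col y<T (≤-reflexive (sym (cong (3 ∸_) white))))
    shift : suc (suc (suc top) + weight') ≡ suc top + suc (suc weight')
    shift = sym (trans (+-suc (suc top) (suc weight')) (cong suc (+-suc (suc top) weight')))

  Searching : S → Set
  Searching s = DfsState (s COL) (s STK) (s ORD) (s TOP 0) (s FIN 0) (s ROOT 0)

  energy : S → ℕ
  energy s = measure (s COL) (s TOP 0) (s ROOT 0)

  Progress : S → S → Set
  Progress s s' = Searching s' × energy s' < energy s

  dfs-step : ∀ s → 6 * s LEN 0 ≡ T → s SUCC0 ≡ σ0 → s SUCC1 ≡ σ1 →
             Searching s → ⟦ dfs-cond ⟧ᵉ s ≢ 0 → Progress s (⟦ dfs-body ⟧ s)
  dfs-step s refl refl refl inv go = choose-elim (Progress s) (s TOP 0)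
    (λ empty →
      let root<T : s ROOT 0 < T
          root<T = m∸n≢0⇒n<m (λ eq → go (cong₂ _+_ eq empty))
      in choose-elim (Progress s) (s COL (s ROOT 0))
        (λ white → push-root empty root<T white inv)
        (λ seen → skip-scanned root<T seen inv))
    (λ top≢0 → choose-elim (Progress s) (3 ∸ s COL (s STK (s TOP 0 ∸ 1)))
      (λ done → pop-top top≢0 done inv)
      -- Both branches are followed by the same recolouring of the current node, so the motive
      -- composes `Progress` with that assignment.
      (λ more → choose-elim (λ s' → Progress s (⟦ COL ⟪ var CUR ⟫≔ lit 1 ⊕ COL at var CUR ⟧ s'))
          (s COL (next-succ (s COL) (s STK (s TOP 0 ∸ 1))))
        (λ white → push-top top≢0 more refl white inv)
        (λ seen → stay-top top≢0 more seen inv)))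

  record Finished (s : S) : Set where
    constructor finished
    field
      {bl}  : List ℕ
      good  : Good bl
      order : Holds (s ORD) (s FIN 0) bl
      all   : ∀ {x} → x < T → x ∈ bl
      only  : ∀ {x} → x ∈ bl → x < T

  -- Together with the falling potential this bounds `FIN` by the initial potential. That is enough
  -- for the time of the sweep and avoids counting the entries of the finishing list.
  fin-step : ∀ s → ⟦ dfs-body ⟧ s FIN 0 ≤ suc (s FIN 0)
  fin-step s = choose-elim P (s TOP 0)
    (λ _ → choose-elim P (s COL (s ROOT 0)) (λ _ → n≤1+n _) (λ _ → n≤1+n _))
    (λ _ → choose-elim P (3 ∸ s COL x) (λ _ → ≤-refl)
      (λ _ → choose-elim (λ s' → P (⟦ COL ⟪ var CUR ⟫≔ lit 1 ⊕ COL at var CUR ⟧ s'))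
        (s COL (choose (s COL x ∸ 1) (s SUCC0 x) (s SUCC1 x))) (λ _ → n≤1+n _) (λ _ → n≤1+n _)))
    where
    x = s STK (s TOP 0 ∸ 1)
    P : S → Set
    P s' = s' FIN 0 ≤ suc (s FIN 0)

  dfs-final : ∀ s → 6 * s LEN 0 ≡ T → Searching s → ⟦ dfs-cond ⟧ᵉ s ≡ 0 →
    s TOP 0 ≡ 0 × Finished s
  dfs-final s refl inv halt = top≡0 , finished (Dfs.good (dfs inv)) (order inv) all
      (λ x∈ → proj₁ (Dfs.black (dfs inv) x∈))
    where
    top≡0 : s TOP 0 ≡ 0
    top≡0 = m+n≡0⇒n≡0 (T ∸ s ROOT 0) halt
    empty-stack : ∀ {f n xs} → n ≡ 0 → Holds f n xs → xs ≡ []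
    empty-stack refl [] = refl
    all : ∀ {x} → x < T → x ∈ bl inv
    all {x} x<T with Dfs.covered (dfs inv) (scanned inv x (<-≤-trans x<T (m∸n≡0⇒m≤n (m+n≡0⇒m≡0 _ halt))))
    ... | inj₂ x∈ = x∈
    ... | inj₁ x∈ with empty-stack top≡0 (stack inv)
    ...   | eq = contradiction (subst (x ∈_) eq x∈) λ ()

  dfs-energy : ∀ s → s TOP 0 ≡ 0 → energy s ≤ T + T * 3
  dfs-energy s top≡0 = +-mono-≤ (m∸n≤m T (s ROOT 0))
    (≤-trans (≤-reflexive (cong (_+ Σ< T (λ x → 3 ∸ s COL x)) top≡0)) (Σ<-≤ T 3 (λ x → m∸n≤m 3 (s COL x))))

  dfs-run : ∀ s₀ → 6 * s₀ LEN 0 ≡ T → s₀ SUCC0 ≡ σ0 → s₀ SUCC1 ≡ σ1 →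
    (∀ x → s₀ COL x ≡ 0) → s₀ TOP 0 ≡ 0 → s₀ FIN 0 ≡ 0 → s₀ ROOT 0 ≡ 0 →
    ∃[ k ] ∃[ s ] (k ≤ T + T * 3 × Iterates dfs-cond dfs-body s₀ k s × Frame dfs-body s₀ s
      × s FIN 0 ≤ T + T * 3 × s TOP 0 ≡ 0 × Finished s)
  dfs-run s₀ len e0 e1 white top fin root =
    let (k , s , k≤ , it , (n , inv , _ , fin≤) , halt , fr) =
          while-rule {dfs-cond} {dfs-body}
            (λ n s → Searching s × energy s ≡ n × s FIN 0 + energy s ≤ T + T * 3) {s₀ = s₀}
            (λ { {n} {s} fr (inv , refl , fin≤) go →
                 let (inv' , drop) = dfs-step s (trans (cong (λ f → 6 * f 0) (fr LEN tt)) len)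
                                       (trans (fr SUCC0 tt) e0) (trans (fr SUCC1 tt) e1) inv go
                 in energy (⟦ dfs-body ⟧ s) , drop , inv' , refl ,
                    ≤-trans (+-monoˡ-≤ (energy (⟦ dfs-body ⟧ s)) (fin-step s))
                      (≤-trans (≤-reflexive (sym (+-suc (s FIN 0) (energy (⟦ dfs-body ⟧ s)))))
                        (≤-trans (+-monoʳ-≤ (s FIN 0) drop) fin≤)) })
            (start , refl , ≤-trans (≤-reflexive (cong (_+ energy s₀) fin)) (dfs-energy s₀ top))
        (top≡0 , done) = dfs-final s (trans (cong (λ f → 6 * f 0) (fr LEN tt)) len) inv halt
    in k , s , ≤-trans k≤ (dfs-energy s₀ top) , it , fr , ≤-trans (m≤m+n _ _) fin≤ , top≡0 , done
    where
    start : Searching s₀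
    start = record { dfs = dfs-start white
                   ; stack = subst (λ n → Holds (s₀ STK) n []) (sym top) []
                   ; order = subst (λ n → Holds (s₀ ORD) n []) (sym fin) []
                   ; scanned = λ x x< → contradiction (<-≤-trans x< (≤-reflexive root)) n≮0 }

-- The backward sweep along predecessors

sweep-cond : Exp
sweep-cond = var FIN ⊕ var TOP

probe : Arr → Com
probe k = NBR ≔ k at var CUR ⨾′
          ifz (COMP at var NBR)
            (COMP ⟪ var NBR ⟫≔ COMP at var CUR ⨾′ STK ⟪ var TOP ⟫≔ var NBR ⨾′ TOP ≔ lit 1 ⊕ var TOP)
            skip

sweep-body : Com
sweep-body =
  ifz (var TOP)
    (FIN ≔ var FIN ⊖ lit 1 ⨾′ CUR ≔ ORD at var FIN ⨾′
     ifz (COMP at var CUR)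
       (COMP ⟪ var CUR ⟫≔ lit 1 ⊕ var CUR ⨾′ STK ⟪ var TOP ⟫≔ var CUR ⨾′ TOP ≔ lit 1 ⊕ var TOP)
       skip)
    (TOP ≔ var TOP ⊖ lit 1 ⨾′ CUR ≔ STK at var TOP ⨾′ probe PRED0 ⨾′ probe PRED1)

module SweepPass (T : ℕ) (σ0 σ1 π0 π1 : ℕ → ℕ) where
  open Digraph T σ0 σ1

  module _ (π0-sound : ∀ {x} → x < T → π0 x ≡ x ⊎ E (π0 x) x)
           (π1-sound : ∀ {x} → x < T → π1 x ≡ x ⊎ E (π1 x) x)
           (π-complete : ∀ {x y} → E y x → y ≡ x ⊎ (y ≡ π0 x ⊎ y ≡ π1 x)) where

    -- Assigning a node also puts it on the stack; the weight 2 of an unassigned node covers this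
    -- increase of `top`.
    weight : ℕ → ℕ
    weight zero    = 2
    weight (suc _) = 0

    burden : (ℕ → ℕ) → ℕ
    burden comp = Σ< T (λ x → weight (comp x))

    -- A node in busy has left the stack, but its predecessors are still to be visited.
    record SweepState (busy : List ℕ) (comp stk ord : ℕ → ℕ) (top fin : ℕ) : Set where
      field
        {rest pending} : List ℕ
        sweep          : Sweep comp rest (busy ++ pending)
        stack          : Holds stk top pending
        order          : Holds ord fin rest
        bounded        : ∀ {x} → x ∈ rest → x < T
        assigned<      : ∀ {x} → comp x ≢ 0 → x < T

    measure : (ℕ → ℕ) → ℕ → ℕ → ℕ
    measure comp top fin = fin + (top + burden comp)

    assign-< : ∀ (comp : ℕ → ℕ) {y c} → (∀ {x} → comp x ≢ 0 → x < T) → y < T →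
               ∀ {x} → (comp [ y ↦ c ]) x ≢ 0 → x < T
    assign-< comp {y} old y<T {x} x≢0 with y ≟ x
    ... | yes refl = y<T
    ... | no y≢x = old (λ eq → x≢0 (trans (↦-other comp y≢x) eq))

    burden-drop : ∀ (comp : ℕ → ℕ) {y c} → y < T → comp y ≡ 0 → c ≢ 0 → 2 + burden (comp [ y ↦ c ]) ≤ burden comp
    burden-drop comp {y} {c} y<T y≡0 c≢0 = Σ<-write T 2 weight comp y<T
      (≤-reflexive (trans (cong (2 +_) (zero-weight c c≢0)) (sym (cong weight y≡0))))
      where
      zero-weight : ∀ c → c ≢ 0 → weight c ≡ 0
      zero-weight zero    c≢0 = contradiction refl c≢0
      zero-weight (suc c) _   = refl

    take-root : ∀ {comp stk ord top fin} → top ≡ 0 → fin ≢ 0 → let r = ord (fin ∸ 1) in comp r ≡ 0 →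
      SweepState [] comp stk ord top fin →
      SweepState [] (comp [ r ↦ suc r ]) (stk [ top ↦ r ]) ord (suc top) (fin ∸ 1)
      × measure (comp [ r ↦ suc r ]) (suc top) (fin ∸ 1) < measure comp top fin
    take-root refl fin≢0 r≡0 record { order = [] } = contradiction refl fin≢0
    take-root {comp} refl fin≢0 r≡0 record { sweep = sw ; stack = [] ; order = snoc {n = fin} {x = r} refl o
        ; bounded = b ; assigned< = a } =
      record { sweep = new-root sw r≡0 ; stack = Holds-push [] ; order = o
             ; bounded = λ x∈ → b (there x∈) ; assigned< = assign-< comp a (b (here refl)) }
      , s≤s (+-monoʳ-≤ fin (≤-trans (n≤1+n _) (burden-drop comp (b (here refl)) r≡0 λ ())))

    pass-root : ∀ {comp stk ord top fin} → top ≡ 0 → fin ≢ 0 → comp (ord (fin ∸ 1)) ≢ 0 →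
      SweepState [] comp stk ord top fin →
      SweepState [] comp stk ord top (fin ∸ 1) × measure comp top (fin ∸ 1) < measure comp top fin
    pass-root refl fin≢0 r≢0 record { order = [] } = contradiction refl fin≢0
    pass-root refl fin≢0 r≢0 record { sweep = sw ; stack = [] ; order = snoc refl o ; bounded = b ; assigned< = a } =
      record { sweep = skip-root sw r≢0 ; stack = [] ; order = o ; bounded = λ x∈ → b (there x∈) ; assigned< = a }
      , ≤-refl

    expand : ∀ {comp stk ord top fin} → top ≢ 0 → SweepState [] comp stk ord top fin →
      SweepState (stk (top ∸ 1) ∷ []) comp stk ord (top ∸ 1) fin
      × measure comp (top ∸ 1) fin < measure comp top fin
    expand top≢0 record { stack = [] } = contradiction refl top≢0
    expand {fin = fin} top≢0 record { sweep = sw ; stack = snoc refl h ; order = o ; bounded = b ; assigned< = a } =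
      record { sweep = sw ; stack = h ; order = o ; bounded = b ; assigned< = a } , +-monoʳ-< fin ≤-refl

    current≢0 : ∀ {x comp stk ord top fin} → SweepState (x ∷ []) comp stk ord top fin → comp x ≢ 0
    current≢0 ex eq = 0≢1+n (trans (sym eq) (Sweep.current (SweepState.sweep ex) (here refl)))

    assign-pred : ∀ {x y comp stk ord top fin} → SweepState (x ∷ []) comp stk ord top fin →
      y ≡ x ⊎ E y x → comp y ≡ 0 →
      SweepState (x ∷ []) (comp [ y ↦ comp x ]) (stk [ top ↦ y ]) ord (suc top) fin
      × measure (comp [ y ↦ comp x ]) (suc top) fin ≤ measure comp top fin
    -- The predecessor table may list the node itself, but that node is already assigned.
    assign-pred ex (inj₁ refl) y≡0 = contradiction y≡0 (current≢0 ex)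
    assign-pred {x} {y} {comp} {top = top} {fin} ex (inj₂ e) y≡0 =
      record { sweep = reorder (visit sweep (here refl) e y≡0)
                 (λ { (here refl) → there (here refl) ; (there (here refl)) → here refl ; (there (there z∈)) →
                     there (there z∈) })
                 (λ { (here refl) → there (here refl) ; (there (here refl)) → here refl ; (there (there z∈)) →
                     there (there z∈) })
             ; stack = Holds-push stack ; order = order ; bounded = bounded
             ; assigned< = assign-< comp assigned< (proj₁ e) }
      , +-monoʳ-≤ fin (≤-trans (≤-reflexive (sym (+-suc top _)))
          (+-monoʳ-≤ top (≤-trans (n≤1+n _) (burden-drop comp (proj₁ e) y≡0 (current≢0 ex)))))
      where open SweepState ex

    expanded : ∀ {x comp stk ord top fin} → SweepState (x ∷ []) comp stk ord top fin →
      comp (π0 x) ≢ 0 → comp (π1 x) ≢ 0 → SweepState [] comp stk ord top fin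
    expanded {x} {comp} ex seen0 seen1 = record
      { sweep = settle sweep (here refl) seen (λ { (here refl) → inj₁ refl ; (there z∈) → inj₂ z∈ }) there
      ; stack = stack ; order = order ; bounded = bounded ; assigned< = assigned< }
      where
      open SweepState ex
      seen : ∀ {y} → E y x → comp y ≢ 0
      seen e with π-complete e
      ... | inj₁ refl = current≢0 ex
      ... | inj₂ (inj₁ refl) = seen0
      ... | inj₂ (inj₂ refl) = seen1

    Sweeping : S → Set
    Sweeping s = SweepState [] (s COMP) (s STK) (s ORD) (s TOP 0) (s FIN 0)

    energy : S → ℕ
    energy s = measure (s COMP) (s TOP 0) (s FIN 0)

    Progress : S → S → Set
    Progress s s' = Sweeping s' × energy s' < energy s

    Probing : ℕ → S → Set
    Probing x s = SweepState (x ∷ []) (s COMP) (s STK) (s ORD) (s TOP 0) (s FIN 0)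

    -- Besides the probed predecessor, all nodes assigned earlier remain assigned. Hence what the
    -- first probe achieved still holds after the second, and `x` can be settled.
    probe-step : ∀ k x s → k ≡ PRED0 ⊎ k ≡ PRED1 → s CUR 0 ≡ x → s k x ≡ x ⊎ E (s k x) x → Probing x s →
      Probing x (⟦ probe k ⟧ s) × energy (⟦ probe k ⟧ s) ≤ energy s
      × ⟦ probe k ⟧ s COMP (s k x) ≢ 0 × (∀ z → s COMP z ≢ 0 → ⟦ probe k ⟧ s COMP z ≢ 0)
    probe-step k x s which refl sound ex = choose-elim P (s COMP (s k (s CUR 0)))
      (λ y≡0 → let (ex' , drop) = assign-pred ex sound y≡0 in ex' , drop
             , (λ eq → current≢0 ex (trans (sym (↦-same (s COMP) (s k (s CUR 0)))) eq))
             , λ z z≢0 → assign-≢0 (s COMP) {s k (s CUR 0)} z (current≢0 ex) z≢0)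
      (λ y≢0 → ex , ≤-refl , y≢0 , λ z z≢0 → z≢0)
      where
      P : S → Set
      P s' = Probing x s' × energy s' ≤ energy s × s' COMP (s k x) ≢ 0 × (∀ z → s COMP z ≢ 0 → s' COMP z ≢ 0)

    sweep-step : ∀ s → s PRED0 ≡ π0 → s PRED1 ≡ π1 →
                 Sweeping s → ⟦ sweep-cond ⟧ᵉ s ≢ 0 → Progress s (⟦ sweep-body ⟧ s)
    sweep-step s refl refl inv go = choose-elim (Progress s) (s TOP 0)
      (λ empty →
        let fin≢0 : s FIN 0 ≢ 0
            fin≢0 = λ eq → go (cong₂ _+_ eq empty)
        in choose-elim (Progress s) (s COMP (s ORD (s FIN 0 ∸ 1)))
          (λ r≡0 → take-root empty fin≢0 r≡0 inv)
          (λ r≢0 → pass-root empty fin≢0 r≢0 inv))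
      (λ top≢0 →
        let x = s STK (s TOP 0 ∸ 1)
            s₁ = ⟦ TOP ≔ var TOP ⊖ lit 1 ⨾′ CUR ≔ STK at var TOP ⟧ s
            (ex , drop) = expand top≢0 inv
            x<T = SweepState.assigned< ex (current≢0 ex)
            (ex₁ , ≤₁ , seen0 , mono₁) = probe-step PRED0 x s₁ (inj₁ refl) refl (π0-sound x<T) ex
            s₂ = ⟦ probe PRED0 ⟧ s₁
            pred1 : s₂ PRED1 ≡ π1
            pred1 = frame (probe PRED0) PRED1 {s₁} tt
            cur : s₂ CUR 0 ≡ x
            cur = cong (λ f → f 0) (frame (probe PRED0) CUR {s₁} tt)
            (ex₂ , ≤₂ , seen1 , mono₂) = probe-step PRED1 x s₂ (inj₂ refl) cur
              (subst (λ f → f x ≡ x ⊎ E (f x) x) (sym pred1) (π1-sound x<T)) ex₁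
        in expanded ex₂ (mono₂ _ seen0) (subst (λ f → ⟦ probe PRED1 ⟧ s₂ COMP (f x) ≢ 0) pred1 seen1)
           , <-≤-trans (s≤s (≤-trans ≤₂ ≤₁)) drop)

    sweep-run : ∀ s₀ {bl bound} → s₀ PRED0 ≡ π0 → s₀ PRED1 ≡ π1 → (∀ x → s₀ COMP x ≡ 0) →
      s₀ TOP 0 ≡ 0 → s₀ FIN 0 ≤ bound →
      Good bl → Holds (s₀ ORD) (s₀ FIN 0) bl → (∀ {x} → x < T → x ∈ bl) → (∀ {x} → x ∈ bl → x < T) →
      ∃[ k ] ∃[ s ] (k ≤ bound + T * 2 × Iterates sweep-cond sweep-body s₀ k s × Frame sweep-body s₀ s
        × (∀ {x y} → x < T → (s COMP x ≡ s COMP y → x ~ y) × (x ~ y → s COMP x ≡ s COMP y)))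
    sweep-run s₀ {bl} {bound} e0 e1 blank top fin≤ good order all only =
      let (k , s , k≤ , it , (n , inv , _) , halt , fr) =
            while-rule {sweep-cond} {sweep-body} (λ n s → Sweeping s × energy s ≡ n) {s₀ = s₀}
              (λ { {n} {s} fr (inv , refl) go →
                   let (inv' , drop) = sweep-step s (trans (fr PRED0 tt) e0) (trans (fr PRED1 tt) e1) inv go
                   in energy (⟦ sweep-body ⟧ s) , drop , inv' , refl })
              (start , refl)
      in k , s , ≤-trans k≤ energy≤ , it , fr , sweep-end (swept s inv halt)
      where
      start : Sweeping s₀
      start = record { sweep = sweep-start blank good all
                     ; stack = subst (λ n → Holds (s₀ STK) n []) (sym top) []
                     ; order = order ; bounded = only
                     ; assigned< = λ {x} x≢0 → contradiction (blank x) x≢0 }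
      weight≤2 : ∀ c → weight c ≤ 2
      weight≤2 zero    = ≤-refl
      weight≤2 (suc c) = z≤n
      energy≤ : energy s₀ ≤ bound + T * 2
      energy≤ = +-mono-≤ fin≤ (≤-trans (≤-reflexive (cong (_+ burden (s₀ COMP)) top))
                                       (Σ<-≤ T 2 (λ x → weight≤2 (s₀ COMP x))))
      none : ∀ {f n xs} → n ≡ 0 → Holds f n xs → xs ≡ []
      none refl [] = refl
      swept : ∀ s → Sweeping s → ⟦ sweep-cond ⟧ᵉ s ≡ 0 → Sweep (s COMP) [] []
      swept s record { sweep = sw ; stack = st ; order = o } halt
        with none (m+n≡0⇒m≡0 (s FIN 0) halt) o | none (m+n≡0⇒n≡0 (s FIN 0) halt) st
      ... | refl | refl = sw

-- The compact digraph

-- Around position p: O is the departure along p, I the arrival along p, and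
-- X/F (rightwards) and Y/B (leftwards) lead from an arrival to the departures
-- of the same vertex with another label: X and Y run through the positions
-- with the label of the arrival, F and B through those beyond it.
data Role : Set where
  O I X F Y B : Role

rank : Role → ℕ
rank O = 0
rank I = 1
rank X = 2
rank F = 3
rank Y = 4
rank B = 5

Node : Set
Node = Role × ℕ

code : Node → ℕ
code (k , p) = rank k + 6 * p

data Place : Set where
  here after before mate : Place

data Test : Set where
  active linked changes : Place → Test

-- The tables are syntax with two readings: `pick` on nodes and `pickE` as an expression for the
-- machine. `self` stands for a missing arc.
data Pick : Set where
  self : Pick
  node : Role → Place → Pick
  test : Test → Pick → Pick → Pick

succ0 succ1 pred0 pred1 : Role → Pick
succ0 O = test (active here) self (node I mate)
succ0 I = node X here
succ0 X = test (linked after) self (test (changes after) (node X after) (node F after))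
succ0 F = node O here
succ0 Y = test (linked here) self (test (changes here) (node Y before) (node B before))
succ0 B = node O here
succ1 O = self
succ1 I = node Y here
succ1 X = self
succ1 F = test (linked after) self (node F after)
succ1 Y = self
succ1 B = test (linked here) self (node B before)
pred0 O = node F here
pred0 I = test (active mate) self (node O mate)
pred0 X = node I here
pred0 F = test (linked here) self (node F before)
pred0 Y = node I here
pred0 B = test (linked after) self (node B after)
pred1 O = node B here
pred1 I = self
pred1 X = test (linked here) self (test (changes here) (node X before) self)
pred1 F = test (linked here) self (test (changes here) self (node X before))
pred1 Y = test (linked after) self (test (changes after) (node Y after) self)
pred1 B = test (linked after) self (test (changes after) self (node Y after))

module Picks (lk mt ac : ℕ → ℕ) where

  spot : Place → ℕ → ℕ
  spot here   p = p
  spot after  p = suc p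
  -- The tables use `before` only when position `p` is linked to the one before it. Since `lk 0` is
  -- 0, truncation at position 0 never matters.
  spot before p = p ∸ 1
  spot mate   p = mt p

  value : Test → ℕ → ℕ
  value (active l)  p = ac (spot l p)
  value (linked l)  p = lk (spot l p)
  value (changes l) p = lk (spot l p) ∸ 1

  pick : Pick → Node → Node
  pick self         n       = n
  pick (node k l)   (_ , p) = k , spot l p
  pick (test t e f) n       = choose (value t (proj₂ n)) (pick e n) (pick f n)

  along : (Role → Pick) → Node → Node
  along table n = pick (table (proj₁ n)) n

-- The premise of `apart` is conditional so that it also covers the last position.
data Link (N : ℕ) (vt lb : ℕ → ℕ) (p : ℕ) : ℕ → Set where
  apart : (suc p < N → vt p ≢ vt (suc p)) → Link N vt lb p 0
  same  : suc p < N → vt p ≡ vt (suc p) → lb p ≡ lb (suc p) → Link N vt lb p 1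
  other : suc p < N → vt p ≡ vt (suc p) → lb p ≢ lb (suc p) → Link N vt lb p 2

-- Positions are numbered so that the positions of a vertex, and among these
-- the positions with the same label, are consecutive.
record Layout : Set where
  field
    N           : ℕ
    vt lb       : ℕ → ℕ
    lk mt ac    : ℕ → ℕ
    mt<         : ∀ {p} → p < N → mt p < N
    mt-inv      : ∀ {p} → p < N → mt (mt p) ≡ p
    block       : ∀ {p q r} → p ≤ q → q ≤ r → r < N → vt p ≡ vt r →
                  vt q ≡ vt p × (lb p ≡ lb r → lb q ≡ lb p)
    lk-first    : lk 0 ≡ 0
    link        : ∀ p → p < N → Link N vt lb p (lk (suc p))

module Gadget (L : Layout) where
  open Layout L
  open Picks lk mt ac public

  data Arc : Node → Node → Set where
    out : ∀ {p} → p < N → ac p ≢ 0 → Arc (O , p) (I , mt p)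
    inX : ∀ {p} → p < N → Arc (I , p) (X , p)
    inY : ∀ {p} → p < N → Arc (I , p) (Y , p)
    XX  : ∀ {p} → suc p < N → vt p ≡ vt (suc p) → lb p ≡ lb (suc p) → Arc (X , p) (X , suc p)
    XF  : ∀ {p} → suc p < N → vt p ≡ vt (suc p) → lb p ≢ lb (suc p) → Arc (X , p) (F , suc p)
    FF  : ∀ {p} → suc p < N → vt p ≡ vt (suc p) → Arc (F , p) (F , suc p)
    FO  : ∀ {p} → p < N → Arc (F , p) (O , p)
    YY  : ∀ {p} → suc p < N → vt p ≡ vt (suc p) → lb p ≡ lb (suc p) → Arc (Y , suc p) (Y , p)
    YB  : ∀ {p} → suc p < N → vt p ≡ vt (suc p) → lb p ≢ lb (suc p) → Arc (Y , suc p) (B , p)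
    BB  : ∀ {p} → suc p < N → vt p ≡ vt (suc p) → Arc (B , suc p) (B , p)
    BO  : ∀ {p} → p < N → Arc (B , p) (O , p)

  Step : ℕ → ℕ → Set
  Step p p' = p < N × ac p ≢ 0 × p' < N × vt (mt p) ≡ vt p' × lb (mt p) ≢ lb p'

  Meets : (ℕ → ℕ → Set) → ℕ → ℕ → Set
  Meets _⋈_ r q = ∃[ p ] (p < N × q ⋈ p × vt q ≡ vt p × Star Step p r)

  -- What a node must satisfy in order to reach `(O, r)`; the property is transported backwards
  -- along arcs. At `X` and `Y` the departure sought must have another label, while `F` and `B` no
  -- longer mention labels because the block of the arrival's label has been left.
  Meaning : ℕ → Node → Set
  Meaning r (O , p) = Star Step p r
  Meaning r (I , q) = Meets (λ q p → lb q ≢ lb p) r q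
  Meaning r (X , q) = Meets (λ q p → q < p × lb q ≢ lb p) r q
  Meaning r (F , q) = Meets _≤_ r q
  Meaning r (Y , q) = Meets (λ q p → p < q × lb q ≢ lb p) r q
  Meaning r (B , q) = Meets (λ q p → p ≤ q) r q

  arc-meaning : ∀ {r a b} → Arc a b → Meaning r b → Meaning r a
  arc-meaning (out p<N ac≢0) (p' , p'< , lb≢ , vt≡ , ch) = (p<N , ac≢0 , p'< , vt≡ , lb≢) ◅ ch
  arc-meaning (inX p<N) (p' , p'< , (_ , lb≢) , vt≡ , ch) = p' , p'< , lb≢ , vt≡ , ch
  arc-meaning (inY p<N) (p' , p'< , (_ , lb≢) , vt≡ , ch) = p' , p'< , lb≢ , vt≡ , ch
  arc-meaning (XX sp<N v l) (p' , p'< , (q<p' , lb≢) , vt≡ , ch) =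
    p' , p'< , (≤-trans (n≤1+n _) q<p' , λ eq → lb≢ (trans (sym l) eq)) , trans v vt≡ , ch
  -- Equal labels form one block: if the later position `p'` had the label of `p`, then so would
  -- `suc p`, contrary to `l`.
  arc-meaning {r} (XF {p} sp<N v l) (p' , p'< , q≤p' , vt≡ , ch) =
    p' , p'< , (q≤p' , λ eq → l (sym (proj₂ (block (n≤1+n p) q≤p' p'< (trans v vt≡)) eq))) , trans v vt≡ , ch
  arc-meaning (FF sp<N v) (p' , p'< , q≤p' , vt≡ , ch) = p' , p'< , ≤-trans (n≤1+n _) q≤p' , trans v vt≡ , ch
  arc-meaning (FO {p} p<N) ch = p , p<N , ≤-refl , refl , ch
  arc-meaning (YY sp<N v l) (p' , p'< , (p'<q , lb≢) , vt≡ , ch) =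
    p' , p'< , (≤-trans p'<q (n≤1+n _) , λ eq → lb≢ (trans l eq)) , trans (sym v) vt≡ , ch
  arc-meaning {r} (YB {p} sp<N v l) (p' , p'< , p'≤q , vt≡ , ch) =
    p' , p'< , (s≤s p'≤q , λ eq → l (trans (proj₂ (block p'≤q (n≤1+n p) sp<N (trans (sym vt≡) v)) (sym eq)) (sym eq)))
    , trans (sym v) vt≡ , ch
  arc-meaning (BB sp<N v) (p' , p'< , p'≤q , vt≡ , ch) = p' , p'< , ≤-trans p'≤q (n≤1+n _) , trans (sym v) vt≡ , ch
  arc-meaning (BO {p} p<N) ch = p , p<N , ≤-refl , refl , ch

  path-meaning : ∀ {r n} → Star Arc n (O , r) → Meaning r n
  path-meaning ε        = ε
  path-meaning (a ◅ as) = arc-meaning a (path-meaning as)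

  F-walk : ∀ d {q} → d + q < N → vt q ≡ vt (d + q) → Star Arc (F , q) (F , d + q)
  F-walk zero    d< v = ε
  F-walk (suc d) {q} d< v = F-walk d (≤-trans (n≤1+n _) d<) v' ◅◅ (FF d< (trans (sym v') v) ◅ ε)
    where
    v' : vt q ≡ vt (d + q)
    v' = sym (proj₁ (block (m≤n+m q d) (n≤1+n _) d< v))

  B-walk : ∀ d {q} → d + q < N → vt q ≡ vt (d + q) → Star Arc (B , d + q) (B , q)
  B-walk zero    d< v = ε
  B-walk (suc d) {q} d< v = BB d< (trans (sym v') v) ◅ B-walk d (≤-trans (n≤1+n _) d<) v'
    where
    v' : vt q ≡ vt (d + q)
    v' = sym (proj₁ (block (m≤n+m q d) (n≤1+n _) d< v))

  -- Follow the `X` nodes up to the first change of label, which occurs because the final label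
  -- differs; there switch to `F`, which passes every remaining position.
  X-walk : ∀ d {q} → suc d + q < N → vt q ≡ vt (suc d + q) → lb q ≢ lb (suc d + q) →
           Star Arc (X , q) (F , suc d + q)
  X-walk d {q} d< v l = go (lb q ≟ lb (suc q)) d d< v l
    where
    inside : ∀ d → suc d + q < N → vt q ≡ vt (suc d + q) → vt q ≡ vt (suc q)
    inside d d< v = sym (proj₁ (block (n≤1+n q) (s≤s (m≤n+m q d)) d< v))
    next< : ∀ d → suc d + q < N → suc q < N
    next< d d< = ≤-trans (s≤s (s≤s (m≤n+m q d))) d<
    go : Dec (lb q ≡ lb (suc q)) → ∀ d → suc d + q < N → vt q ≡ vt (suc d + q) → lb q ≢ lb (suc d + q) →
         Star Arc (X , q) (F , suc d + q)
    go (no l') d d< v l = XF (next< d d<) (inside d d< v) l' ◅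
      subst (λ r → Star Arc (F , suc q) (F , r)) (+-suc d q)
        (F-walk d (subst (_< N) (sym (+-suc d q)) d<)
          (trans (sym (inside d d< v)) (trans v (cong vt (sym (+-suc d q))))))
    go (yes l') zero    d< v l = contradiction l' l
    go (yes l') (suc d) d< v l = XX (next< (suc d) d<) (inside (suc d) d< v) l' ◅
      subst (λ r → Star Arc (X , suc q) (F , r)) (cong suc (+-suc d q))
        (X-walk d (subst (_< N) (sym (cong suc (+-suc d q))) d<)
          (trans (sym (inside (suc d) d< v)) (trans v (cong vt (sym (cong suc (+-suc d q))))))
          (λ eq → l (trans l' (trans eq (cong lb (cong suc (+-suc d q)))))))

  Y-walk : ∀ d {q} → suc d + q < N → vt q ≡ vt (suc d + q) → lb q ≢ lb (suc d + q) →
           Star Arc (Y , suc d + q) (B , q)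
  Y-walk d {q} d< v l with lb (d + q) ≟ lb (suc d + q)
  ... | no l' = YB d< (trans (sym inside) v) l' ◅ B-walk d (≤-trans (n≤1+n _) d<) inside
    where
    inside : vt q ≡ vt (d + q)
    inside = sym (proj₁ (block (m≤n+m q d) (n≤1+n _) d< v))
  Y-walk zero    d< v l | yes l' = contradiction l' l
  Y-walk (suc d) {q} d< v l | yes l' = YY d< (trans (sym inside) v) l' ◅
    Y-walk d (≤-trans (n≤1+n _) d<) inside (λ eq → l (trans eq l'))
    where
    inside : vt q ≡ vt (suc d + q)
    inside = sym (proj₁ (block (m≤n+m q (suc d)) (n≤1+n _) d< v))

  -- A departure to the right is reached through `X` and `F`, one to the left through `Y` and `B`;
  -- the labels exclude `q` itself.
  enter : ∀ {q p} → q < N → p < N → vt q ≡ vt p → lb q ≢ lb p → Star Arc (I , q) (O , p)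
  enter {q} {p} q< p< v l with ≤-total q p
  ... | inj₁ q≤p with m≤n⇒∃[o]m+o≡n q≤p
  ...   | zero , refl = contradiction (cong lb (sym (+-identityʳ q))) l
  ...   | suc d , refl = inX q< ◅ subst (λ r → Star Arc (X , q) (F , r)) (+-comm (suc d) q)
            (X-walk d (subst (_< N) (+-comm q (suc d)) p<) (trans v (cong vt (+-comm q (suc d))))
              (λ eq → l (trans eq (cong lb (+-comm (suc d) q))))) ◅◅ (FO p< ◅ ε)
  enter {q} {p} q< p< v l | inj₂ p≤q with m≤n⇒∃[o]m+o≡n p≤q
  ...   | zero , refl = contradiction (cong lb (+-identityʳ p)) l
  ...   | suc d , refl = inY q< ◅ subst (λ r → Star Arc (Y , r) (B , p)) (+-comm (suc d) p)
            (Y-walk d (subst (_< N) (+-comm p (suc d)) q<) (trans (sym v) (cong vt (+-comm p (suc d))))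
              (λ eq → l (trans (cong lb (+-comm p (suc d))) (sym eq)))) ◅◅ (BO p< ◅ ε)

  link-same : ∀ {p} → suc p < N → vt p ≡ vt (suc p) → lb p ≡ lb (suc p) → lk (suc p) ≡ 1
  link-same {p} sp< v l with lk (suc p) | link p (<⇒≤ sp<)
  ... | _ | apart ne     = contradiction v (ne sp<)
  ... | _ | same _ _ _   = refl
  ... | _ | other _ _ l' = contradiction l l'

  link-other : ∀ {p} → suc p < N → vt p ≡ vt (suc p) → lb p ≢ lb (suc p) → lk (suc p) ≡ 2
  link-other {p} sp< v l with lk (suc p) | link p (<⇒≤ sp<)
  ... | _ | apart ne    = contradiction v (ne sp<)
  ... | _ | same _ _ l' = contradiction l' l
  ... | _ | other _ _ _ = refl

  link-linked : ∀ {p} → suc p < N → vt p ≡ vt (suc p) → lk (suc p) ≢ 0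
  link-linked {p} sp< v with lk (suc p) | link p (<⇒≤ sp<)
  ... | _ | apart ne    = contradiction v (ne sp<)
  ... | _ | same _ _ _  = λ ()
  ... | _ | other _ _ _ = λ ()

  -- The first alternative is the entry `self` for a missing arc; such loops of the tabulated
  -- digraph are not arcs of the gadget.
  Forth Back : (Role → Pick) → Set
  Forth table = ∀ k p → p < N → along table (k , p) ≡ (k , p) ⊎ Arc (k , p) (along table (k , p))
  Back table = ∀ k p → p < N → along table (k , p) ≡ (k , p) ⊎ Arc (along table (k , p)) (k , p)

  succ0-sound : Forth succ0
  succ0-sound O p p< = choose-elim (λ n → n ≡ (O , p) ⊎ Arc (O , p) n) (ac p)
    (λ _ → inj₁ refl) (λ ac≢0 → inj₂ (out p< ac≢0))
  succ0-sound I p p< = inj₂ (inX p<)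
  succ0-sound X p p< with lk (suc p) | link p p<
  ... | _ | apart _      = inj₁ refl
  ... | _ | same s v l   = inj₂ (XX s v l)
  ... | _ | other s v l  = inj₂ (XF s v l)
  succ0-sound F p p< = inj₂ (FO p<)
  succ0-sound Y zero p< rewrite lk-first = inj₁ refl
  succ0-sound Y (suc p) p< with lk (suc p) | link p (<⇒≤ p<)
  ... | _ | apart _      = inj₁ refl
  ... | _ | same s v l   = inj₂ (YY s v l)
  ... | _ | other s v l  = inj₂ (YB s v l)
  succ0-sound B p p< = inj₂ (BO p<)

  succ1-sound : Forth succ1
  succ1-sound O p p< = inj₁ refl
  succ1-sound I p p< = inj₂ (inY p<)
  succ1-sound X p p< = inj₁ refl
  succ1-sound F p p< with lk (suc p) | link p p<
  ... | _ | apart _      = inj₁ refl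
  ... | _ | same s v l   = inj₂ (FF s v)
  ... | _ | other s v l  = inj₂ (FF s v)
  succ1-sound Y p p< = inj₁ refl
  succ1-sound B zero p< rewrite lk-first = inj₁ refl
  succ1-sound B (suc p) p< with lk (suc p) | link p (<⇒≤ p<)
  ... | _ | apart _      = inj₁ refl
  ... | _ | same s v l   = inj₂ (BB s v)
  ... | _ | other s v l  = inj₂ (BB s v)

  pred0-sound : Back pred0
  pred0-sound O p p< = inj₂ (FO p<)
  pred0-sound I p p< = choose-elim (λ n → n ≡ (I , p) ⊎ Arc n (I , p)) (ac (mt p)) (λ _ → inj₁ refl)
    (λ ac≢0 → inj₂ (subst (λ q → Arc (O , mt p) (I , q)) (mt-inv p<) (out (mt< p<) ac≢0)))
  pred0-sound X p p< = inj₂ (inX p<)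
  pred0-sound F zero p< rewrite lk-first = inj₁ refl
  pred0-sound F (suc p) p< with lk (suc p) | link p (<⇒≤ p<)
  ... | _ | apart _      = inj₁ refl
  ... | _ | same s v l   = inj₂ (FF s v)
  ... | _ | other s v l  = inj₂ (FF s v)
  pred0-sound Y p p< = inj₂ (inY p<)
  pred0-sound B p p< with lk (suc p) | link p p<
  ... | _ | apart _      = inj₁ refl
  ... | _ | same s v l   = inj₂ (BB s v)
  ... | _ | other s v l  = inj₂ (BB s v)

  pred1-sound : Back pred1
  pred1-sound O p p< = inj₂ (BO p<)
  pred1-sound I p p< = inj₁ refl
  pred1-sound X zero p< rewrite lk-first = inj₁ refl
  pred1-sound X (suc p) p< with lk (suc p) | link p (<⇒≤ p<)
  ... | _ | apart _      = inj₁ refl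
  ... | _ | same s v l   = inj₂ (XX s v l)
  ... | _ | other s v l  = inj₁ refl
  pred1-sound F zero p< rewrite lk-first = inj₁ refl
  pred1-sound F (suc p) p< with lk (suc p) | link p (<⇒≤ p<)
  ... | _ | apart _      = inj₁ refl
  ... | _ | same s v l   = inj₁ refl
  ... | _ | other s v l  = inj₂ (XF s v l)
  pred1-sound Y p p< with lk (suc p) | link p p<
  ... | _ | apart _      = inj₁ refl
  ... | _ | same s v l   = inj₂ (YY s v l)
  ... | _ | other s v l  = inj₁ refl
  pred1-sound B p p< with lk (suc p) | link p p<
  ... | _ | apart _      = inj₁ refl
  ... | _ | same s v l   = inj₁ refl
  ... | _ | other s v l  = inj₂ (YB s v l)

  succ-complete : ∀ {n n'} → Arc n n' → n' ≡ along succ0 n ⊎ n' ≡ along succ1 n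
  succ-complete (out p< ac≢0) = inj₁ (sym (choose-nonzero ac≢0))
  succ-complete (inX p<) = inj₁ refl
  succ-complete (inY p<) = inj₂ refl
  succ-complete (XX s v l) rewrite link-same s v l = inj₁ refl
  succ-complete (XF s v l) rewrite link-other s v l = inj₁ refl
  succ-complete (FF s v) = inj₂ (sym (choose-nonzero (link-linked s v)))
  succ-complete (FO p<) = inj₁ refl
  succ-complete (YY s v l) rewrite link-same s v l = inj₁ refl
  succ-complete (YB s v l) rewrite link-other s v l = inj₁ refl
  succ-complete (BB s v) = inj₂ (sym (choose-nonzero (link-linked s v)))
  succ-complete (BO p<) = inj₁ refl

  pred-complete : ∀ {n n'} → Arc n n' → n ≡ along pred0 n' ⊎ n ≡ along pred1 n'
  pred-complete (out {p} p< ac≢0) = inj₁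
      (sym (trans (choose-nonzero (λ eq → ac≢0 (trans (sym (cong ac (mt-inv p<))) eq)))
                                                 (cong (O ,_) (mt-inv p<))))
  pred-complete (inX p<) = inj₁ refl
  pred-complete (inY p<) = inj₁ refl
  pred-complete (XX s v l) rewrite link-same s v l = inj₂ refl
  pred-complete (XF s v l) rewrite link-other s v l = inj₂ refl
  pred-complete (FF s v) = inj₁ (sym (choose-nonzero (link-linked s v)))
  pred-complete (FO p<) = inj₁ refl
  pred-complete (YY s v l) rewrite link-same s v l = inj₂ refl
  pred-complete (YB s v l) rewrite link-other s v l = inj₂ refl
  pred-complete (BB s v) = inj₁ (sym (choose-nonzero (link-linked s v)))
  pred-complete (BO p<) = inj₂ refl

  arc-source : ∀ {n n'} → Arc n n' → proj₂ n < N
  arc-source (out p< _)  = p<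
  arc-source (inX p<)    = p<
  arc-source (inY p<)    = p<
  arc-source (XX s _ _)  = <⇒≤ s
  arc-source (XF s _ _)  = <⇒≤ s
  arc-source (FF s _)    = <⇒≤ s
  arc-source (FO p<)     = p<
  arc-source (YY s _ _)  = s
  arc-source (YB s _ _)  = s
  arc-source (BB s _)    = s
  arc-source (BO p<)     = p<

  arc-target : ∀ {n n'} → Arc n n' → proj₂ n' < N
  arc-target (out p< _)  = mt< p<
  arc-target (inX p<)    = p<
  arc-target (inY p<)    = p<
  arc-target (XX s _ _)  = s
  arc-target (XF s _ _)  = s
  arc-target (FF s _)    = s
  arc-target (FO p<)     = p<
  arc-target (YY s _ _)  = <⇒≤ s
  arc-target (YB s _ _)  = <⇒≤ s
  arc-target (BB s _)    = <⇒≤ s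
  arc-target (BO p<)     = p<

  steps-path : ∀ {p q} → Star Step p q → Star Arc (O , p) (O , q)
  steps-path ε = ε
  steps-path ((p< , ac≢0 , p'< , v , l) ◅ ss) = out p< ac≢0 ◅ (enter (mt< p<) p'< v l ◅◅ steps-path ss)

-- Numbering the nodes of the compact digraph

rank<6 : ∀ k → rank k < 6
rank<6 O = s≤s z≤n
rank<6 I = s≤s (s≤s z≤n)
rank<6 X = s≤s (s≤s (s≤s z≤n))
rank<6 F = s≤s (s≤s (s≤s (s≤s z≤n)))
rank<6 Y = s≤s (s≤s (s≤s (s≤s (s≤s z≤n))))
rank<6 B = ≤-refl

advance-node : Node → Node
advance-node (O , p) = I , p
advance-node (I , p) = X , p
advance-node (X , p) = F , p
advance-node (F , p) = Y , p
advance-node (Y , p) = B , p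
advance-node (B , p) = O , suc p

code-advance : ∀ n → code (advance-node n) ≡ suc (code n)
code-advance (O , p) = refl
code-advance (I , p) = refl
code-advance (X , p) = refl
code-advance (F , p) = refl
code-advance (Y , p) = refl
code-advance (B , p) = *-suc 6 p

-- Counting through the nodes replaces division by six. The table-building loop moves its cursor in
-- the same order, so it needs no division either.
decode : ℕ → Node
decode zero    = O , 0
decode (suc x) = advance-node (decode x)

code-decode : ∀ x → code (decode x) ≡ x
code-decode zero    = refl
code-decode (suc x) = trans (code-advance (decode x)) (cong suc (code-decode x))

code< : ∀ k {p N} → p < N → code (k , p) < 6 * N
code< k {p} {N} p<N = ≤-trans (+-monoˡ-< (6 * p) (rank<6 k))
  (≤-trans (≤-reflexive (sym (*-suc 6 p))) (*-monoʳ-≤ 6 p<N))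

code<⁻¹ : ∀ n {N} → code n < 6 * N → proj₂ n < N
code<⁻¹ (k , p) {N} c< = *-cancelˡ-< 6 p N (≤-<-trans (m≤n+m (6 * p) (rank k)) c<)

decode-first : ∀ p → decode (6 * p) ≡ (O , p)
decode-first zero    = refl
decode-first (suc p) = trans (cong decode (*-suc 6 p))
  (cong (λ n → advance-node (advance-node (advance-node (advance-node (advance-node (advance-node n))))))
      (decode-first p))

decode-code : ∀ n → decode (code n) ≡ n
decode-code (O , p) = decode-first p
decode-code (I , p) = cong (λ n → advance-node n) (decode-first p)
decode-code (X , p) = cong (λ n → advance-node (advance-node n)) (decode-first p)
decode-code (F , p) = cong (λ n → advance-node (advance-node (advance-node n))) (decode-first p)
decode-code (Y , p) = cong (λ n → advance-node (advance-node (advance-node (advance-node n)))) (decode-first p)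
decode-code (B , p) = cong (λ n → advance-node (advance-node (advance-node (advance-node (advance-node n)))))
    (decode-first p)

code-injective : ∀ n n' → code n ≡ code n' → n ≡ n'
code-injective n n' eq = trans (sym (decode-code n)) (trans (cong decode eq) (decode-code n'))

module Coded (L : Layout) (σ0 σ1 π0 π1 : ℕ → ℕ) where
  open Layout L
  open Gadget L
  M : ℕ
  M = 6 * N
  open Digraph M σ0 σ1

  Tabulates : (ℕ → ℕ) → (Role → Pick) → Set
  Tabulates f table = ∀ n → proj₂ n < N → f (code n) ≡ code (along table n)

  module _ (h0 : Tabulates σ0 succ0) (h1 : Tabulates σ1 succ1)
           (g0 : Tabulates π0 pred0) (g1 : Tabulates π1 pred1) where

    decode< : ∀ {x} → x < M → proj₂ (decode x) < N
    decode< {x} x<M = code<⁻¹ (decode x) (subst (_< M) (sym (code-decode x)) x<M)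

    tabulated : ∀ {f table x} → Tabulates f table → x < M → f x ≡ code (along table (decode x))
    tabulated {f} {x = x} h x<M = trans (cong f (sym (code-decode x))) (h (decode x) (decode< x<M))

    forth< : ∀ {f table} → Tabulates f table → Forth table → ∀ {x} → x < M → f x < M
    forth< {f} {table} h sound {x} x<M = subst (_< M) (sym (tabulated {f} {table} h x<M))
      (code< (proj₁ (along table (decode x))) (target (sound (proj₁ (decode x)) (proj₂ (decode x)) (decode< x<M))))
      where
      target : along table (decode x) ≡ decode x ⊎ Arc (decode x) (along table (decode x)) →
               proj₂ (along table (decode x)) < N
      target (inj₁ eq) = subst (λ n → proj₂ n < N) (sym eq) (decode< x<M)
      target (inj₂ a)  = arc-target a

    σ0< : ∀ {x} → x < M → σ0 x < M
    σ0< = forth< {σ0} {succ0} h0 succ0-sound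

    σ1< : ∀ {x} → x < M → σ1 x < M
    σ1< = forth< {σ1} {succ1} h1 succ1-sound

    arc-E : ∀ {n n'} → Arc n n' → E (code n) (code n')
    arc-E {n} a with succ-complete a
    ... | inj₁ eq = code< (proj₁ n) (arc-source a) , inj₁ (trans (cong code eq) (sym (h0 n (arc-source a))))
    ... | inj₂ eq = code< (proj₁ n) (arc-source a) , inj₂ (trans (cong code eq) (sym (h1 n (arc-source a))))

    E-arc : ∀ n {y} → E (code n) y → ∃[ n' ] (y ≡ code n' × (n' ≡ n ⊎ Arc n n'))
    E-arc n@(k , p) (c< , inj₁ eq) = along succ0 n , trans eq (h0 n (code<⁻¹ n c<)) , succ0-sound k p (code<⁻¹ n c<)
    E-arc n@(k , p) (c< , inj₂ eq) = along succ1 n , trans eq (h1 n (code<⁻¹ n c<)) , succ1-sound k p (code<⁻¹ n c<)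

    path-code : ∀ {n n'} → Star Arc n n' → code n ⟶* code n'
    path-code ε        = ε
    path-code (a ◅ as) = arc-E a ◅ path-code as

    code-path : ∀ n n' → code n ⟶* code n' → Star Arc n n'
    code-path n n' path = go n path refl
      where
      go : ∀ n {y} → code n ⟶* y → y ≡ code n' → Star Arc n n'
      go n ε eq with code-injective n n' eq
      ... | refl = ε
      go n (e ◅ es) eq with E-arc n e
      -- A loop from a `self` entry is dropped from the path.
      ... | _ , refl , inj₁ refl = go n es eq
      ... | n₁ , refl , inj₂ a   = a ◅ go n₁ es eq

    back-sound : ∀ {f table} → Tabulates f table → Back table → ∀ {x} → x < M → f x ≡ x ⊎ E (f x) x
    back-sound {f} {table} h sound {x} x<M
      rewrite tabulated {f} {table} h x<M
      with sound (proj₁ (decode x)) (proj₂ (decode x)) (decode< x<M)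
    ... | inj₁ eq = inj₁ (trans (cong code eq) (code-decode x))
    ... | inj₂ a  = inj₂ (subst (E (code (along table (decode x)))) (code-decode x) (arc-E a))

    π0-sound : ∀ {x} → x < M → π0 x ≡ x ⊎ E (π0 x) x
    π0-sound = back-sound {π0} {pred0} g0 pred0-sound

    π1-sound : ∀ {x} → x < M → π1 x ≡ x ⊎ E (π1 x) x
    π1-sound = back-sound {π1} {pred1} g1 pred1-sound

    π-complete : ∀ {x y} → E y x → y ≡ x ⊎ (y ≡ π0 x ⊎ y ≡ π1 x)
    π-complete {x} {y} e with E-arc (decode y) (subst (λ z → E z x) (sym (code-decode y)) e)
    ... | n' , refl , inj₁ refl = inj₁ (sym (code-decode y))
    ... | n' , refl , inj₂ a with pred-complete a
    ...   | inj₁ eq = inj₂ (inj₁ (trans (sym (code-decode y)) (trans (cong code eq) (sym (g0 n' (arc-target a))))))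
    ...   | inj₂ eq = inj₂ (inj₂ (trans (sym (code-decode y)) (trans (cong code eq) (sym (g1 n' (arc-target a))))))

    Cyclic : ℕ → Set
    Cyclic p = ∃[ p' ] (Step p p' × Star Step p' p)

    -- The arc `out` always leads from the departure to the arrival, so sharing a component amounts
    -- to a way back, which is the remainder of the closed chain.
    cyclic-~ : ∀ {p} → Cyclic p → code (O , p) ~ code (I , mt p)
    cyclic-~ (p' , (p< , ac≢0 , p'< , v , l) , ss) =
      arc-E (out p< ac≢0) ◅ ε , path-code (enter (mt< p<) p'< v l ◅◅ steps-path ss)

    ~-cyclic : ∀ {p} → p < N → ac p ≢ 0 → code (O , p) ~ code (I , mt p) → Cyclic p
    ~-cyclic {p} p< ac≢0 (_ , path) with path-meaning (code-path (I , mt p) (O , p) path)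
    ... | p' , p'< , l , v , ss = p' , (p< , ac≢0 , p'< , v , l) , ss

-- Tabulating the compact digraph

abstract
  for-rule : ∀ {c s₀} (bound : Exp) (i : Arr) (n : ℕ) (P : S → Set) →
    (∀ s → Frame c s₀ s → ⟦ bound ⟧ᵉ s ≡ n) →
    (∀ s → Frame c s₀ s → P s → s i 0 < n → P (⟦ c ⟧ s) × ⟦ c ⟧ s i 0 ≡ suc (s i 0)) →
    P s₀ → s₀ i 0 ≡ 0 →
    ∃[ k ] ∃[ s ] (k ≤ n × Iterates (bound ⊖ var i) c s₀ k s × Frame c s₀ s × P s × s i 0 ≡ n)
  for-rule {c} {s₀} bound i n P bound≡ step p₀ i₀ =
    let (k , s , k≤ , it , (r , p , sum) , halt , fr) =
          while-rule {bound ⊖ var i} {c} (λ r s → P s × s i 0 + r ≡ n) {n} {s₀} step' (p₀ , cong (_+ n) i₀)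
    in k , s , k≤ , it , fr , p ,
       ≤-antisym (≤-trans (m≤m+n (s i 0) r) (≤-reflexive sum))
                 (m∸n≡0⇒m≤n (trans (cong (_∸ s i 0) (sym (bound≡ s fr))) halt))
    where
    step' : ∀ {r s} → Frame c s₀ s → P s × s i 0 + r ≡ n → ⟦ bound ⟧ᵉ s ∸ s i 0 ≢ 0 →
            ∃[ r' ] (r' < r × P (⟦ c ⟧ s) × ⟦ c ⟧ s i 0 + r' ≡ n)
    step' {zero} {s} fr (p , sum) go = contradiction
      (trans (cong (_∸ s i 0) (trans (bound≡ s fr) (trans (sym sum) (+-identityʳ _)))) (n∸n≡0 (s i 0))) go
    step' {suc r} {s} fr (p , sum) go =
      let (p' , i≡) = step s fr p (≤-trans
            (≤-trans (≤-reflexive (+-comm 1 (s i 0))) (+-monoʳ-≤ (s i 0) (s≤s (z≤n {r})))) (≤-reflexive sum))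
      in r , ≤-refl , p' , trans (cong (_+ r) i≡) (trans (sym (+-suc (s i 0) r)) sum)

Agree : (ℕ → ℕ) → (ℕ → ℕ) → ℕ → Set
Agree f g n = ∀ x → x < n → f x ≡ g x

Agree-write : ∀ f g n → Agree f g n → Agree (f [ n ↦ g n ]) g (suc n)
Agree-write f g n old x x< with n ≟ x
... | yes refl = ↦-same f n
... | no n≢x = trans (↦-other f n≢x) (old x (≤∧≢⇒< (≤-pred x<) (λ x≡n → n≢x (sym x≡n))))

spotE : Place → Exp
spotE here   = var POS
spotE after  = lit 1 ⊕ var POS
spotE before = var POS ⊖ lit 1
spotE mate   = MATE at var POS

valueE : Test → Exp
valueE (active l)  = ACT at spotE l
valueE (linked l)  = LINK at spotE l
valueE (changes l) = LINK at spotE l ⊖ lit 1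

pickE : Pick → Exp
pickE self         = var NODE
pickE (node k l)   = lit (rank k) ⊕ mul6 (spotE l)
pickE (test t e f) = cond (valueE t) (pickE e) (pickE f)

by-kind : (Role → Pick) → Exp
by-kind table =
  -- With truncated subtraction each test means "at most"; the earlier tests have ruled out the
  -- smaller kinds.
  cond (var KIND) (pickE (table O)) (cond (var KIND ⊖ lit 1) (pickE (table I))
    (cond (var KIND ⊖ lit 2) (pickE (table X)) (cond (var KIND ⊖ lit 3) (pickE (table F))
      (cond (var KIND ⊖ lit 4) (pickE (table Y)) (pickE (table B))))))

build-body : Com
build-body =
  SUCC0 ⟪ var NODE ⟫≔ by-kind succ0 ⨾′ SUCC1 ⟪ var NODE ⟫≔ by-kind succ1 ⨾′
  PRED0 ⟪ var NODE ⟫≔ by-kind pred0 ⨾′ PRED1 ⟪ var NODE ⟫≔ by-kind pred1 ⨾′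
  NODE ≔ lit 1 ⊕ var NODE ⨾′
  ifz (lit 5 ⊖ var KIND) (KIND ≔ lit 0 ⨾′ POS ≔ lit 1 ⊕ var POS) (KIND ≔ lit 1 ⊕ var KIND)

module Build (lk mt ac : ℕ → ℕ) where
  open Picks lk mt ac

  record Cursor (s : S) : Set where
    constructor cursor
    field
      lk≡   : s LINK ≡ lk
      mt≡   : s MATE ≡ mt
      ac≡   : s ACT ≡ ac
      kind≡ : s KIND 0 ≡ rank (proj₁ (decode (s NODE 0)))
      pos≡  : s POS 0 ≡ proj₂ (decode (s NODE 0))

  spot-correct : ∀ l {s} → Cursor s → ⟦ spotE l ⟧ᵉ s ≡ spot l (proj₂ (decode (s NODE 0)))
  spot-correct here   (cursor refl refl refl k p) = p
  spot-correct after  (cursor refl refl refl k p) = cong suc p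
  spot-correct before (cursor refl refl refl k p) = cong (_∸ 1) p
  spot-correct mate {s} (cursor refl refl refl k p) = cong (s MATE) p

  value-correct : ∀ t {s} → Cursor s → ⟦ valueE t ⟧ᵉ s ≡ value t (proj₂ (decode (s NODE 0)))
  value-correct (active l)  {s} c = cong₂ (λ f → f) (Cursor.ac≡ c) (spot-correct l c)
  value-correct (linked l)  {s} c = cong₂ (λ f → f) (Cursor.lk≡ c) (spot-correct l c)
  value-correct (changes l) {s} c = cong (_∸ 1) (cong₂ (λ f → f) (Cursor.lk≡ c) (spot-correct l c))

  code-choose : ∀ v n n' → choose v (code n) (code n') ≡ code (choose v n n')
  code-choose zero    n n' = refl
  code-choose (suc _) n n' = refl

  pick-correct : ∀ e {s} → Cursor s → ⟦ pickE e ⟧ᵉ s ≡ code (pick e (decode (s NODE 0)))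
  pick-correct self {s} c = sym (code-decode (s NODE 0))
  pick-correct (node k l) {s} c = cong (λ p → code (k , p)) (spot-correct l c)
  pick-correct (test t e f) {s} c = trans
    (trans (cong₂ (choose _) (pick-correct e c) (pick-correct f c))
           (cong (λ v → choose v (code (pick e (decode (s NODE 0)))) (code (pick f (decode (s NODE 0)))))
                 (value-correct t c)))
    (code-choose (value t (proj₂ (decode (s NODE 0)))) (pick e (decode (s NODE 0))) (pick f (decode (s NODE 0))))

  by-kind-correct : ∀ table {s} → Cursor s → ⟦ by-kind table ⟧ᵉ s ≡ code (along table (decode (s NODE 0)))
  by-kind-correct table {s} c = trans (dispatch (proj₁ (decode (s NODE 0))) (Cursor.kind≡ c))
                                      (pick-correct (table (proj₁ (decode (s NODE 0)))) c)
    where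
    dispatch : ∀ k → s KIND 0 ≡ rank k → ⟦ by-kind table ⟧ᵉ s ≡ ⟦ pickE (table k) ⟧ᵉ s
    dispatch O eq rewrite eq = refl
    dispatch I eq rewrite eq = refl
    dispatch X eq rewrite eq = refl
    dispatch F eq rewrite eq = refl
    dispatch Y eq rewrite eq = refl
    dispatch B eq rewrite eq = refl

  Filled : (ℕ → ℕ) → (Role → Pick) → ℕ → Set
  Filled f table n = Agree f (λ x → code (along table (decode x))) n

  fill : ∀ f table n {v} → Filled f table n → v ≡ code (along table (decode n)) →
         Filled (f [ n ↦ v ]) table (suc n)
  fill f table n old refl = Agree-write f (λ x → code (along table (decode x))) n old

  record Building (s : S) : Set where
    field
      at-node : Cursor s
      filled0 : Filled (s SUCC0) succ0 (s NODE 0)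
      filled1 : Filled (s SUCC1) succ1 (s NODE 0)
      filled2 : Filled (s PRED0) pred0 (s NODE 0)
      filled3 : Filled (s PRED1) pred1 (s NODE 0)

  move : Com
  move = ifz (lit 5 ⊖ var KIND) (KIND ≔ lit 0 ⨾′ POS ≔ lit 1 ⊕ var POS) (KIND ≔ lit 1 ⊕ var KIND)

  move-correct : ∀ s x → s KIND 0 ≡ rank (proj₁ (decode x)) → s POS 0 ≡ proj₂ (decode x) →
    ⟦ move ⟧ s KIND 0 ≡ rank (proj₁ (decode (suc x))) × ⟦ move ⟧ s POS 0 ≡ proj₂ (decode (suc x))
  move-correct s x k p with decode x
  ... | O , q rewrite k = refl , p
  ... | I , q rewrite k = refl , p
  ... | X , q rewrite k = refl , p
  ... | F , q rewrite k = refl , p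
  ... | Y , q rewrite k = refl , p
  ... | B , q rewrite k = refl , cong suc p

  build-step : ∀ s → Building s → Building (⟦ build-body ⟧ s) × ⟦ build-body ⟧ s NODE 0 ≡ suc (s NODE 0)
  -- The conditional in `move` does not reduce, so the fact that `NODE` survives it is proved by
  -- `frame` and passed on as an equation.
  build-step s b = outcome (frame move NODE {s₅} tt)
    where
    open Building b
    x = s NODE 0
    s₁ = ⟦ SUCC0 ⟪ var NODE ⟫≔ by-kind succ0 ⟧ s
    s₂ = ⟦ SUCC1 ⟪ var NODE ⟫≔ by-kind succ1 ⟧ s₁
    s₃ = ⟦ PRED0 ⟪ var NODE ⟫≔ by-kind pred0 ⟧ s₂
    s₄ = ⟦ PRED1 ⟪ var NODE ⟫≔ by-kind pred1 ⟧ s₃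
    s₅ = ⟦ NODE ≔ lit 1 ⊕ var NODE ⟧ s₄
    c : Cursor s
    c = at-node
    c₁ : Cursor s₁
    c₁ = cursor (Cursor.lk≡ c) (Cursor.mt≡ c) (Cursor.ac≡ c) (Cursor.kind≡ c) (Cursor.pos≡ c)
    c₂ : Cursor s₂
    c₂ = cursor (Cursor.lk≡ c) (Cursor.mt≡ c) (Cursor.ac≡ c) (Cursor.kind≡ c) (Cursor.pos≡ c)
    c₃ : Cursor s₃
    c₃ = cursor (Cursor.lk≡ c) (Cursor.mt≡ c) (Cursor.ac≡ c) (Cursor.kind≡ c) (Cursor.pos≡ c)
    moved = move-correct s₅ x (Cursor.kind≡ c) (Cursor.pos≡ c)
    kept : ∀ f table k → Filled f table (suc x) → T (fresh k move) → s₅ k ≡ f → ⟦ move ⟧ s₅ NODE ≡ s₅ NODE →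
           Filled (⟦ move ⟧ s₅ k) table (⟦ move ⟧ s₅ NODE 0)
    kept f table k old fr eq node≡ rewrite node≡ | frame move k {s₅} fr | eq = old
    outcome : ⟦ move ⟧ s₅ NODE ≡ s₅ NODE → Building (⟦ move ⟧ s₅) × ⟦ move ⟧ s₅ NODE 0 ≡ suc x
    outcome node≡ = record
      { at-node = cursor (trans (frame move LINK {s₅} tt) (Cursor.lk≡ c))
          (trans (frame move MATE {s₅} tt) (Cursor.mt≡ c))
          (trans (frame move ACT {s₅} tt) (Cursor.ac≡ c))
          (trans (proj₁ moved) (cong (λ f → rank (proj₁ (decode (f 0)))) (sym node≡)))
          (trans (proj₂ moved) (cong (λ f → proj₂ (decode (f 0))) (sym node≡)))
      ; filled0 = kept (s₅ SUCC0) succ0 SUCC0 (fill (s SUCC0) succ0 x filled0 (by-kind-correct succ0 c)) tt refl node≡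
      ; filled1 = kept (s₅ SUCC1) succ1 SUCC1
          (fill (s SUCC1) succ1 x filled1 (by-kind-correct succ1 c₁)) tt refl node≡
      ; filled2 = kept (s₅ PRED0) pred0 PRED0
          (fill (s PRED0) pred0 x filled2 (by-kind-correct pred0 c₂)) tt refl node≡
      ; filled3 = kept (s₅ PRED1) pred1 PRED1
          (fill (s PRED1) pred1 x filled3 (by-kind-correct pred1 c₃)) tt refl node≡ }
      , cong (λ f → f 0) node≡

  build-run : ∀ s₀ n → 6 * s₀ LEN 0 ≡ n → s₀ LINK ≡ lk → s₀ MATE ≡ mt → s₀ ACT ≡ ac →
    s₀ KIND 0 ≡ 0 → s₀ POS 0 ≡ 0 → s₀ NODE 0 ≡ 0 →
    ∃[ k ] ∃[ s ] (k ≤ n × Iterates (mul6 (var LEN) ⊖ var NODE) build-body s₀ k s × Frame build-body s₀ s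
      × Filled (s SUCC0) succ0 n × Filled (s SUCC1) succ1 n × Filled (s PRED0) pred0 n × Filled (s PRED1) pred1 n)
  build-run s₀ n len l m a kind pos nod =
    let (k , s , k≤ , it , fr , b , end) = for-rule {build-body} {s₀} (mul6 (var LEN)) NODE n Building
          (λ s fr → trans (cong (λ f → 6 * f 0) (fr LEN tt)) len)
          (λ s fr b _ → build-step s b) start nod
        open Building b
    in k , s , k≤ , it , fr , subst (Filled (s SUCC0) succ0) end filled0 , subst (Filled (s SUCC1) succ1) end filled1
       , subst (Filled (s PRED0) pred0) end filled2 , subst (Filled (s PRED1) pred1) end filled3
    where
    none : ∀ f table → Filled f table (s₀ NODE 0)
    none f table x x< = contradiction (<-≤-trans x< (≤-reflexive nod)) n≮0
    start : Building s₀
    start = record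
      { at-node = cursor l m a (trans kind (cong (λ x → rank (proj₁ (decode x))) (sym nod)))
                                (trans pos (cong (λ x → proj₂ (decode x)) (sym nod)))
      ; filled0 = none (s₀ SUCC0) succ0 ; filled1 = none (s₀ SUCC1) succ1
      ; filled2 = none (s₀ PRED0) pred0 ; filled3 = none (s₀ PRED1) pred1 }

-- Positions in the incidence lists

Segment : (ℕ → ℕ) → ℕ → List ℕ → Set
Segment f b []       = ⊤
Segment f b (x ∷ xs) = f b ≡ x × Segment f (suc b) xs

Segment-++ : ∀ {f} b xs {ys} → Segment f b (xs ++ ys) → Segment f b xs × Segment f (b + length xs) ys
Segment-++ {f} b [] {ys} seg = tt , subst (λ c → Segment f c ys) (sym (+-identityʳ b)) seg
Segment-++ {f} b (x ∷ xs) {ys} (eq , seg) with Segment-++ (suc b) xs seg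
... | l , r = (eq , l) , subst (λ c → Segment f c ys) (sym (+-suc b (length xs))) r

Segment-cong : ∀ {f g} b xs → (∀ i → f i ≡ g i) → Segment f b xs → Segment g b xs
Segment-cong b []       eq seg       = tt
Segment-cong b (x ∷ xs) eq (e , seg) = trans (sym (eq b)) e , Segment-cong (suc b) xs eq seg

Segment-snoc : ∀ {f} b xs {x} → Segment f b xs → Segment (f [ b + length xs ↦ x ]) b (xs ∷ʳ x)
Segment-snoc {f} b [] {x} seg = trans (cong (f [ b + 0 ↦ x ]) (sym (+-identityʳ b))) (↦-same f (b + 0)) , tt
Segment-snoc {f} b (y ∷ xs) {x} (eq , seg) =
  trans (↦-other f (λ e → m≢1+m+n b (trans (sym e) (+-suc b (length xs))))) eq
  , subst (λ c → Segment (f [ c ↦ x ]) (suc b) (xs ∷ʳ x)) (sym (+-suc b (length xs))) (Segment-snoc (suc b) xs seg)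

Segment-nth : ∀ {f} b xs i {x} → Segment f b xs → nth xs i ≡ just x → f (b + i) ≡ x
Segment-nth {f} b (y ∷ xs) zero    (eq , seg) refl = trans (cong f (+-identityʳ b)) eq
Segment-nth {f} b (y ∷ xs) (suc i) (eq , seg) n≡   = trans (cong f (+-suc b i)) (Segment-nth (suc b) xs i seg n≡)

Segment-suc : ∀ {f} b xs → Segment (f ∘ suc) b xs → Segment f (suc b) xs
Segment-suc b []       seg       = tt
Segment-suc b (x ∷ xs) (e , seg) = e , Segment-suc (suc b) xs seg

Segment-word : ∀ w → Segment (word w) 0 w
Segment-word []      = tt
Segment-word (x ∷ w) = refl , Segment-suc 0 w (Segment-word w)

module _ {A : Set} where

  nth-< : ∀ (xs : List A) {i x} → nth xs i ≡ just x → i < length xs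
  nth-< (y ∷ xs) {zero}  eq = s≤s z≤n
  nth-< (y ∷ xs) {suc i} eq = s≤s (nth-< xs eq)

  nth-total : ∀ (xs : List A) {i} → i < length xs → ∃[ x ] nth xs i ≡ just x
  nth-total (y ∷ xs) {zero}  _       = y , refl
  nth-total (y ∷ xs) {suc i} (s≤s l) = nth-total xs l

  nth-∈ : ∀ (xs : List A) i {x} → nth xs i ≡ just x → x ∈ xs
  nth-∈ (y ∷ xs) zero    refl = here refl
  nth-∈ (y ∷ xs) (suc i) eq   = there (nth-∈ xs i eq)

  nth-++ : ∀ (xs : List A) {ys} i {x} → nth xs i ≡ just x → nth (xs ++ ys) i ≡ just x
  nth-++ (y ∷ xs) zero    eq = eq
  nth-++ (y ∷ xs) (suc i) eq = nth-++ xs i eq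

  nth-snoc : ∀ (xs : List A) {x} → nth (xs ∷ʳ x) (length xs) ≡ just x
  nth-snoc []       = refl
  nth-snoc (y ∷ xs) = nth-snoc xs

  nth-injective : ∀ {xs : List A} {i j x} → Unique xs → nth xs i ≡ just x → nth xs j ≡ just x → i ≡ j
  nth-injective {y ∷ xs} {zero}  {zero}  u p q = refl
  nth-injective {y ∷ xs} {zero}  {suc j} (fresh ∷ u) refl q = contradiction refl (All.lookup fresh (nth-∈ xs j q))
  nth-injective {y ∷ xs} {suc i} {zero}  (fresh ∷ u) p refl = contradiction refl (All.lookup fresh (nth-∈ xs i p))
  nth-injective {y ∷ xs} {suc i} {suc j} (_ ∷ u) p q = cong suc (nth-injective u p q)

  nth-lookup : ∀ (xs : List A) i {x} → nth xs i ≡ just x → ∃[ f ] (toℕ f ≡ i × lookup xs f ≡ x)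
  nth-lookup (y ∷ xs) zero    refl = Fin.zero , refl , refl
  nth-lookup (y ∷ xs) (suc i) eq with nth-lookup xs i eq
  ... | f , f≡ , x≡ = Fin.suc f , cong suc f≡ , x≡

  lookup-nth : ∀ (xs : List A) (f : Fin (length xs)) → nth xs (toℕ f) ≡ just (lookup xs f)
  lookup-nth (y ∷ xs) Fin.zero    = refl
  lookup-nth (y ∷ xs) (Fin.suc f) = lookup-nth xs f

  nth-split : ∀ (xs : List A) {ys} i {x} → nth (xs ++ ys) i ≡ just x →
              nth xs i ≡ just x ⊎ ∃[ j ] (i ≡ length xs + j × nth ys j ≡ just x)
  nth-split []       i eq = inj₂ (_ , refl , eq)
  nth-split (y ∷ xs) zero    eq = inj₁ eq
  nth-split (y ∷ xs) (suc i) eq with nth-split xs i eq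
  ... | inj₁ eq'           = inj₁ eq'
  ... | inj₂ (j , i≡ , eq') = inj₂ (j , cong suc i≡ , eq')

nth-tabulate : ∀ {A : Set} {n} (f : Fin n → A) i → nth (tabulate f) (toℕ i) ≡ just (f i)
nth-tabulate f Fin.zero    = refl
nth-tabulate f (Fin.suc i) = nth-tabulate (f ∘ Fin.suc) i

nth-map : ∀ {A C : Set} (f : A → C) xs i {x} → nth xs i ≡ just x → nth (map f xs) i ≡ just (f x)
nth-map f (y ∷ xs) zero    refl = refl
nth-map f (y ∷ xs) (suc i) eq   = nth-map f xs i eq

nth-map⁻ : ∀ {A C : Set} (f : A → C) xs i {y} → nth (map f xs) i ≡ just y → ∃[ x ] (nth xs i ≡ just x × y ≡ f x)
nth-map⁻ f (x ∷ xs) zero    refl = x , refl , refl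
nth-map⁻ f (x ∷ xs) (suc i) eq   = nth-map⁻ f xs i eq

shift-3* : ∀ b i → b + 3 * suc i ≡ suc (suc (suc b)) + 3 * i
shift-3* b i = trans (cong (b +_) (*-suc 3 i))
  (trans (+-suc b _) (cong suc (trans (+-suc b _) (cong suc (+-suc b _)))))

triples-nth : ∀ {A : Set} {f} (g h k : A → ℕ) b xs i {x} →
  Segment f b (concatMap (λ e → g e ∷ h e ∷ k e ∷ []) xs) → nth xs i ≡ just x →
  f (b + 3 * i) ≡ g x × f (suc b + 3 * i) ≡ h x × f (suc (suc b) + 3 * i) ≡ k x
triples-nth {f = f} g h k b (y ∷ xs) zero (p , q , r , seg) refl rewrite +-identityʳ b = p , q , r
triples-nth {f = f} g h k b (y ∷ xs) (suc i) (p , q , r , seg) eq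
  rewrite shift-3* b i = triples-nth g h k (suc (suc (suc b))) xs i seg eq

length-triples : ∀ {A : Set} (g h k : A → ℕ) xs → length (concatMap (λ e → g e ∷ h e ∷ k e ∷ []) xs) ≡ 3 * length xs
length-triples g h k []       = refl
length-triples g h k (x ∷ xs) = trans (cong (3 +_) (length-triples g h k xs)) (sym (*-suc 3 (length xs)))

two-sided : ∀ {n m} (g : Fin n → Fin m ⊎ Fin m) → (∀ {i j} → g i ≡ g j → i ≡ j) → n ≤ m + m
two-sided {n} {m} g inj = injective⇒≤ {f = join m m ∘ g} (λ {i} {j} eq →
  inj (trans (sym (splitAt-join m m (g i))) (trans (cong (splitAt m) eq) (splitAt-join m m (g j)))))

module Positions (G : Graph) (I : GroupedIncidence G) where
  open Graph G
  open GroupedIncidence I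

  at-vertex : Vertex → List (Vertex × Edge)
  at-vertex v = map (v ,_) (incident v)

  positions : List (Vertex × Edge)
  positions = concatMap at-vertex (allFin #vertices)

  from-vertices : ∀ vs i {v e} → nth (concatMap at-vertex vs) i ≡ just (v , e) → v ∈ vs
  from-vertices [] zero ()
  from-vertices [] (suc i) ()
  from-vertices (u ∷ vs) i eq with nth-split (at-vertex u) i eq
  ... | inj₂ (j , _ , eq') = there (from-vertices vs j eq')
  ... | inj₁ eq' with nth-map⁻ (u ,_) (incident u) i eq'
  ...   | _ , _ , refl = here refl

  block-nth : ∀ u i {v e} → nth (at-vertex u) i ≡ just (v , e) → v ≡ u × nth (incident u) i ≡ just e
  block-nth u i eq with nth-map⁻ (u ,_) (incident u) i eq
  ... | _ , eq' , refl = refl , eq'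

  position-injective : ∀ vs → Unique vs → ∀ {i j x} → nth (concatMap at-vertex vs) i ≡ just x →
                       nth (concatMap at-vertex vs) j ≡ just x → i ≡ j
  position-injective [] _ {zero} ()
  position-injective [] _ {suc i} ()
  position-injective (u ∷ vs) (fresh ∷ uniq) {i} {j} p q with nth-split (at-vertex u) i p | nth-split (at-vertex u) j q
  ... | inj₁ p' | inj₁ q' =
    nth-injective (unique u) (proj₂ (block-nth u i p')) (proj₂ (block-nth u j q'))
  ... | inj₁ p' | inj₂ (b , _ , q') with block-nth u i p'
  ...   | refl , _ = contradiction refl (All.lookup fresh (from-vertices vs b q'))
  position-injective (u ∷ vs) (fresh ∷ uniq) {i} {j} p q | inj₂ (b , _ , p') | inj₁ q' with block-nth u j q'
  ...   | refl , _ = contradiction refl (All.lookup fresh (from-vertices vs b p'))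
  position-injective (u ∷ vs) (fresh ∷ uniq) {i} {j} p q | inj₂ (a , refl , p') | inj₂ (b , refl , q') =
    cong (length (at-vertex u) +_) (position-injective vs uniq p' q')

  grouped-nth : ∀ v {i j k a b c} → i ≤ j → j ≤ k → nth (incident v) i ≡ just a → nth (incident v) j ≡ just b →
                nth (incident v) k ≡ just c → label a ≡ label c → label b ≡ label a
  grouped-nth v {i} {j} {k} i≤j j≤k p q r eq
    with nth-lookup (incident v) i p | nth-lookup (incident v) j q | nth-lookup (incident v) k r
  ... | f , refl , refl | g , refl , refl | h , refl , refl = grouped v f g h i≤j j≤k eq

  -- Each vertex occurs once in `vs`, so two positions of the same vertex lie in the same incidence
  -- list, and so does everything between them. Within that list the claim about labels is
  -- `grouped`.
  position-block : ∀ vs → Unique vs → ∀ {i j k v v' a b c} → i ≤ j → j ≤ k →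
    nth (concatMap at-vertex vs) i ≡ just (v , a) → nth (concatMap at-vertex vs) j ≡ just (v' , b) →
    nth (concatMap at-vertex vs) k ≡ just (v , c) → v' ≡ v × (label a ≡ label c → label b ≡ label a)
  position-block [] _ {zero} _ _ ()
  position-block [] _ {suc i} _ _ ()
  position-block (u ∷ vs) (fresh ∷ uniq) {i} {j} {k} i≤j j≤k p q r
    with nth-split (at-vertex u) i p | nth-split (at-vertex u) j q | nth-split (at-vertex u) k r
  ... | inj₁ p' | inj₁ q' | inj₁ r' with block-nth u i p' | block-nth u j q' | block-nth u k r'
  ...   | refl , p'' | refl , q'' | refl , r'' = refl , grouped-nth u i≤j j≤k p'' q'' r''
  position-block (u ∷ vs) (fresh ∷ uniq) {i} {j} {k} i≤j j≤k p q r | inj₁ p' | _ | inj₂ (b , _ , r') with block-nth u i p'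
  ... | refl , _ = contradiction refl (All.lookup fresh (from-vertices vs b r'))
  position-block (u ∷ vs) (fresh ∷ uniq) {i} {j} {k} i≤j j≤k p q r | _ | inj₂ (_ , refl , q') | inj₁ r' =
    contradiction (≤-trans (≤-trans (m≤m+n _ _) j≤k) ≤-refl) (<⇒≱ (nth-< (at-vertex u) r'))
  position-block (u ∷ vs) (fresh ∷ uniq) {i} {j} {k} i≤j j≤k p q r | inj₂ (_ , refl , p') | inj₁ q' | _ =
    contradiction (≤-trans (m≤m+n _ _) i≤j) (<⇒≱ (nth-< (at-vertex u) q'))
  position-block (u ∷ vs) (fresh ∷ uniq) {i} {j} {k} i≤j j≤k p q r
    | inj₂ (a , refl , p') | inj₂ (b , refl , q') | inj₂ (c , refl , r') =
    position-block vs uniq (+-cancelˡ-≤ (length (at-vertex u)) _ _ i≤j)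
        (+-cancelˡ-≤ (length (at-vertex u)) _ _ j≤k) p' q' r'

  record At (p : ℕ) (v : Vertex) (e : Edge) : Set where
    constructor at
    field nth≡ : nth positions p ≡ just (v , e)
  open At

  At-injective : ∀ {p q v e} → At p v e → At q v e → p ≡ q
  At-injective (at p) (at q) = position-injective (allFin #vertices) (allFin⁺ #vertices) p q

  At-function : ∀ {p v v' e e'} → At p v e → At p v' e' → v ≡ v' × e ≡ e'
  At-function (at p) (at q) = ,-injective (just-injective (trans (sym p) q))

  At-total : ∀ {p} → p < length positions → ∃[ v ] ∃[ e ] At p v e
  At-total p< with nth-total positions p<
  ... | (v , e) , eq = v , e , at eq

  At-< : ∀ {p v e} → At p v e → p < length positions
  At-< (at p) = nth-< positions p

  ∈-positions : ∀ {v e} → Incident e v → (v , e) ∈ positions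
  ∈-positions {v} {e} inc = ∈-concatMap⁺ at-vertex
    (Any.map (λ { refl → ∈-map⁺ (v ,_) (Equivalence.from (complete v e) inc) }) (∈-allFin v))

  At-incident : ∀ vs p {v e} → nth (concatMap at-vertex vs) p ≡ just (v , e) → Incident e v
  At-incident [] zero ()
  At-incident [] (suc p) ()
  At-incident (u ∷ vs) p eq with nth-split (at-vertex u) p eq
  ... | inj₂ (q , _ , eq') = At-incident vs q eq'
  ... | inj₁ eq' with block-nth u p eq'
  ...   | refl , eq'' = Equivalence.to (complete u _) (nth-∈ (incident u) p eq'')

  -- This injects the incidences into two copies of the edges. A self-loop is listed once and uses
  -- only the first copy.
  side : Vertex × Edge → Edge ⊎ Edge
  side (v , e) with source e Fin.≟ v
  ... | yes _ = inj₁ e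
  ... | no _  = inj₂ e

  side-injective : ∀ {v v' e e'} → Incident e v → Incident e' v' → side (v , e) ≡ side (v' , e') → (v , e) ≡ (v' , e')
  side-injective {v} {v'} {e} {e'} inc inc' eq with source e Fin.≟ v | source e' Fin.≟ v'
  side-injective inc inc' refl | yes refl | yes refl = refl
  side-injective inc inc' ()   | yes _    | no _
  side-injective inc inc' ()   | no _     | yes _
  side-injective (inj₁ s) inc' eq | no s≢ | no s'≢ = contradiction s s≢
  side-injective (inj₂ t) (inj₁ s') eq | no s≢ | no s'≢ = contradiction s' s'≢
  side-injective (inj₂ refl) (inj₂ refl) refl | no s≢ | no s'≢ = refl

  #positions≤ : length positions ≤ #edges + #edges
  #positions≤ = two-sided (side ∘ lookup positions) λ {i} {j} eq →
    toℕ-injective (position-injective (allFin #vertices) (allFin⁺ #vertices) (lookup-nth positions i)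
      (trans (lookup-nth positions j) (cong just (sym (side-injective (inc i) (inc j) eq)))))
    where
    inc : ∀ i → Incident (proj₂ (lookup positions i)) (proj₁ (lookup positions i))
    inc i = At-incident (allFin #vertices) (toℕ i) (lookup-nth positions i)

  -- Each vertex is charged to an end of an edge incident to it. Here the absence of isolated
  -- vertices enters the running time.
  #vertices≤ : #vertices ≤ #edges + #edges
  #vertices≤ = two-sided end λ {u} {v} → end-injective u v
    where
    end : Vertex → Edge ⊎ Edge
    end v with no-isolated v
    ... | e , inj₁ _ = inj₁ e
    ... | e , inj₂ _ = inj₂ e
    end-injective : ∀ u v → end u ≡ end v → u ≡ v
    end-injective u v eq with no-isolated u | no-isolated v
    end-injective u v refl | e , inj₁ p | .e , inj₁ q = trans (sym p) q
    end-injective u v ()   | e , inj₁ p | e' , inj₂ q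
    end-injective u v ()   | e , inj₂ p | e' , inj₁ q
    end-injective u v refl | e , inj₂ p | .e , inj₂ q = trans (sym p) q

  incidence-words : Vertex → List ℕ
  incidence-words v = length (incident v) ∷ map toℕ (incident v)

  length-incidence : ∀ vs → length (concatMap incidence-words vs) ≡ length vs + length (concatMap at-vertex vs)
  length-incidence []       = refl
  length-incidence (v ∷ vs) = cong suc (trans (length-++ (map toℕ (incident v)))
    (trans (cong₂ _+_ (trans (length-map toℕ (incident v)) (sym (length-map (v ,_) (incident v))))
        (length-incidence vs))
    (trans (exchange (length (at-vertex v)) (length vs) _)
           (cong (length vs +_) (sym (length-++ (at-vertex v)))))))
    where
    exchange : ∀ a b c → a + (b + c) ≡ b + (a + c)
    exchange a b c = trans (sym (+-assoc a b c)) (trans (cong (_+ c) (+-comm a b)) (+-assoc b a c))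

  input : List ℕ
  input = encode G I

  edges-segment : Segment (word input) 3
      (concatMap (λ e → toℕ (source e) ∷ toℕ (target e) ∷ label e ∷ []) (allFin #edges))
  edges-segment = proj₁ (Segment-++ 3 (concatMap _ (allFin #edges)) (proj₂ (proj₂ (proj₂ (Segment-word input)))))

  edge-words : ∀ e → word input (3 + 3 * toℕ e) ≡ toℕ (source e) × word input (4 + 3 * toℕ e) ≡ toℕ (target e)
                     × word input (5 + 3 * toℕ e) ≡ label e
  edge-words e = triples-nth (toℕ ∘ source) (toℕ ∘ target) label 3 (allFin #edges) (toℕ e) edges-segment
      (nth-tabulate (λ e → e) e)

  #edge-words : length (concatMap (λ e → toℕ (source e) ∷ toℕ (target e) ∷ label e ∷ []) (allFin #edges)) ≡ 3 * #edges
  #edge-words = trans (length-triples (toℕ ∘ source) (toℕ ∘ target) label (allFin #edges))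
                      (cong (λ n → 3 * n) {length (allFin #edges)} {#edges} (length-tabulate (λ (e : Edge) → e)))

  incidence-segment : Segment (word input) (3 + 3 * #edges) (concatMap incidence-words (allFin #vertices))
  incidence-segment = subst (λ n → Segment (word input) (3 + n) (concatMap incidence-words (allFin #vertices)))
    #edge-words
    (proj₂ (Segment-++ 3 (concatMap _ (allFin #edges)) (proj₂ (proj₂ (proj₂ (Segment-word input))))))

  input-length : length input ≤ 3 + #edges + #edges + #edges + #edges + #edges + #edges + #edges
  input-length = ≤-trans (≤-reflexive (cong (3 +_) (length-++ (concatMap edge-triple (allFin #edges)))))
    (≤-trans (+-monoʳ-≤ 3 (+-mono-≤
      (≤-reflexive #edge-words)
      (≤-trans (≤-reflexive (length-incidence (allFin #vertices)))
        (+-mono-≤ (≤-trans (≤-reflexive (length-tabulate (λ (v : Vertex) → v))) #vertices≤) #positions≤))))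
      (≤-reflexive (sevenfold #edges)))
    where
    edge-triple : Edge → List ℕ
    edge-triple e = toℕ (source e) ∷ toℕ (target e) ∷ label e ∷ []
    sevenfold : ∀ m → 3 + (3 * m + ((m + m) + (m + m))) ≡ 3 + m + m + m + m + m + m + m
    sevenfold = solve 1 (λ m → con 3 :+ (con 3 :* m :+ ((m :+ m) :+ (m :+ m))) :=
      con 3 :+ m :+ m :+ m :+ m :+ m :+ m :+ m) refl

-- Nonrepetitive cycles as closed chains of positions

-- The equality test available to a machine with truncated subtraction, in the form in which `gap`
-- evaluates it; only its being zero matters.
∣_-_∣ₑ : ℕ → ℕ → ℕ
∣ a - b ∣ₑ = (a ∸ b) + (b ∸ a)

apart≡0 : ∀ {a b} → a ≡ b → ∣ a - b ∣ₑ ≡ 0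
apart≡0 {a} refl = cong₂ _+_ (n∸n≡0 a) (n∸n≡0 a)

apart≢0 : ∀ {a b} → a ≢ b → ∣ a - b ∣ₑ ≢ 0
apart≢0 {a} {b} a≢b eq =
  a≢b (≤-antisym (m∸n≡0⇒m≤n (m+n≡0⇒m≡0 (a ∸ b) eq)) (m∸n≡0⇒m≤n (m+n≡0⇒n≡0 (a ∸ b) eq)))

choose-equal : ∀ {A : Set} {a b} {x y : A} → a ≡ b → choose ∣ a - b ∣ₑ x y ≡ x
choose-equal {a = a} {b} a≡b = choose-zero {n = ∣ a - b ∣ₑ} (apart≡0 a≡b)

choose-apart : ∀ {A : Set} {a b} {x y : A} → a ≢ b → choose ∣ a - b ∣ₑ x y ≡ y
choose-apart {a = a} {b} a≢b = choose-nonzero {n = ∣ a - b ∣ₑ} (apart≢0 a≢b)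

-- The facts about the computed arrays from which the combinatorial argument proceeds. They are
-- stated for arbitrary functions, so that no machine state appears in it.
record Tables (G : Graph) (I : GroupedIncidence G) (src mt ac lk : ℕ → ℕ) : Set where
  open Graph G
  open Positions G I
  field
    vt eg tgt lab srcw : ℕ → ℕ
    vt≡    : ∀ {p v e} → At p v e → vt p ≡ suc (toℕ v)
    eg≡    : ∀ {p v e} → At p v e → eg p ≡ toℕ e
    vt-end : vt (length positions) ≡ 0
    src-at : ∀ e → At (src (toℕ e)) (source e) e
    tgt-at : ∀ e → At (tgt (toℕ e)) (target e) e
    lab≡   : ∀ e → lab (toℕ e) ≡ label e
    srcw≡  : ∀ e → srcw (toℕ e) ≡ toℕ (source e)
    mt≡    : ∀ p → p < length positions →
             mt p ≡ choose ∣ vt p - suc (srcw (eg p)) ∣ₑ (tgt (eg p)) (src (eg p))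
    ac≡    : ∀ p → p < length positions →
             ac p ≡ choose ∣ vt p - suc (srcw (eg p)) ∣ₑ 1 (kindFlag kind)
    lk-0   : lk 0 ≡ 0
    lk≡    : ∀ p → p < length positions → lk (suc p) ≡
             choose ∣ vt p - vt (suc p) ∣ₑ (choose ∣ lab (eg p) - lab (eg (suc p)) ∣ₑ 1 2) 0

module Translation (G : Graph) (I : GroupedIncidence G) {src mt ac lk : ℕ → ℕ}
                   (tables : Tables G I src mt ac lk) where
  open Graph G
  open Positions G I
  open Tables tables

  N : ℕ
  N = length positions

  lb : ℕ → ℕ
  lb p = lab (eg p)

  lb≡ : ∀ {p v e} → At p v e → lb p ≡ label e
  lb≡ {e = e} x = trans (cong lab (eg≡ x)) (lab≡ e)

  vt-injective : ∀ {p q v w e f} → At p v e → At q w f → vt p ≡ vt q → v ≡ w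
  vt-injective x y eq = toℕ-injective (suc-injective (trans (sym (vt≡ x)) (trans eq (vt≡ y))))

  at-source : ∀ {p v e} → At p v e → source e ≡ v → mt p ≡ tgt (toℕ e) × ac p ≡ 1
  at-source {p} {v} {e} x s =
    trans (mt≡ p (At-< x)) (trans (choose-equal tested) (cong tgt (eg≡ x)))
    , trans (ac≡ p (At-< x)) (choose-equal tested)
    where
    tested : vt p ≡ suc (srcw (eg p))
    tested = trans (vt≡ x) (cong suc (sym (trans (cong srcw (eg≡ x)) (trans (srcw≡ e) (cong toℕ s)))))

  at-target : ∀ {p v e} → At p v e → source e ≢ v →
              target e ≡ v × mt p ≡ src (toℕ e) × ac p ≡ kindFlag kind
  at-target {p} {v} {e} x@(at eq) s≢ =
    is-target (At-incident (allFin #vertices) p eq)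
    , trans (mt≡ p (At-< x)) (trans (choose-apart tested) (cong src (eg≡ x)))
    , trans (ac≡ p (At-< x)) (choose-apart tested)
    where
    is-target : Incident e v → target e ≡ v
    is-target (inj₁ s) = contradiction s s≢
    is-target (inj₂ t) = t
    tested : vt p ≢ suc (srcw (eg p))
    tested eq' = s≢ (toℕ-injective (sym (suc-injective (trans (sym (vt≡ x))
      (trans eq' (cong suc (trans (cong srcw (eg≡ x)) (srcw≡ e))))))))

  other-end : ∀ {p v e} → At p v e → ∃[ w ] At (mt p) w e
  other-end {p} {v} {e} x with source e Fin.≟ v
  ... | yes s = target e , subst (λ q → At q (target e) e) (sym (proj₁ (at-source x s))) (tgt-at e)
  ... | no s≢ = source e , subst (λ q → At q (source e) e) (sym (proj₁ (proj₂ (at-target x s≢)))) (src-at e)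

  -- A position is determined by its vertex and edge. For a self-loop the positions of source and
  -- target therefore coincide, and the position is its own mate.
  mt-involutive : ∀ {p v e} → At p v e → mt (mt p) ≡ p
  mt-involutive {p} {v} {e} x with source e Fin.≟ v
  mt-involutive {p} {_} {e} x | yes refl with source e Fin.≟ target e
  ... | yes loop = trans (cong mt (proj₁ (at-source x refl)))
          (trans (proj₁ (at-source (tgt-at e) loop))
              (At-injective (subst (λ w → At (tgt (toℕ e)) w e) (sym loop) (tgt-at e)) x))
  ... | no s≢t = trans (cong mt (proj₁ (at-source x refl)))
          (trans (proj₁ (proj₂ (at-target (tgt-at e) s≢t))) (At-injective (src-at e) x))
  mt-involutive {p} {v} {e} x | no s≢ = trans (cong mt (proj₁ (proj₂ (at-target x s≢))))
    (trans (proj₁ (at-source (src-at e) refl))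
      (At-injective (subst (λ w → At (tgt (toℕ e)) w e) (proj₁ (at-target x s≢)) (tgt-at e)) x))

  layout : Layout
  layout = record
    { N = N ; vt = vt ; lb = lb ; lk = lk ; mt = mt ; ac = ac
    ; mt< = λ p< → let (_ , _ , x) = At-total p< in At-< (proj₂ (other-end x))
    ; mt-inv = λ p< → let (_ , _ , x) = At-total p< in mt-involutive x
    ; block = block
    ; lk-first = lk-0
    ; link = link }
    where
    block : ∀ {p q r} → p ≤ q → q ≤ r → r < N → vt p ≡ vt r → vt q ≡ vt p × (lb p ≡ lb r → lb q ≡ lb p)
    block {p} {q} {r} p≤q q≤r r< v≡
      with At-total (≤-<-trans (≤-trans p≤q q≤r) r<) | At-total (≤-<-trans q≤r r<) | At-total r<
    ... | v , a , x | v' , b , y | w , c , z with vt-injective x z v≡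
    ...   | refl with At.nth≡ x | At.nth≡ y | At.nth≡ z
    ...     | x' | y' | z' with position-block (allFin #vertices) (allFin⁺ #vertices) p≤q q≤r x' y' z'
    ...       | refl , labels = trans (vt≡ y) (sym (vt≡ x)) , λ l → trans (lb≡ y)
                  (trans (labels (trans (sym (lb≡ x)) (trans l (lb≡ z)))) (sym (lb≡ x)))
    -- The cell after the last position holds 0, whereas every position holds a vertex plus one.
    inside : ∀ p → p < N → vt p ≡ vt (suc p) → suc p < N
    inside p p< v≡ = ≤∧≢⇒< p< λ end →
      0≢1+n (trans (sym vt-end) (trans (cong vt (sym end)) (trans (sym v≡) (vt≡ (proj₂ (proj₂ (At-total p<)))))))
    link : ∀ p → p < N → Link N vt lb p (lk (suc p))
    link p p< with vt p ≟ vt (suc p)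
    ... | no v≢ = subst (Link N vt lb p) (sym (trans (lk≡ p p<) (choose-apart v≢))) (apart (λ _ → v≢))
    ... | yes v≡ with lb p ≟ lb (suc p)
    ...   | yes l≡ = subst (Link N vt lb p)
        (sym (trans (lk≡ p p<) (trans (choose-equal v≡) (choose-equal l≡)))) (same (inside p p< v≡) v≡ l≡)
    ...   | no l≢ = subst (Link N vt lb p)
        (sym (trans (lk≡ p p<) (trans (choose-equal v≡) (choose-apart l≢)))) (other (inside p p< v≡) v≡ l≢)

  open Gadget layout public using (Step)

  Steps⁺ : ℕ → ℕ → Set
  Steps⁺ p q = ∃[ p' ] (Step p p' × Star Step p' q)

  Differ : Edge → Edge → Set
  Differ a b = label a ≢ label b

  -- A traversal of `e` from `u` to `w`, seen as the active position at its tail, with the mate at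
  -- its head.
  record Dart (e : Edge) (u w : Vertex) : Set where
    field
      pos  : ℕ
      from : At pos u e
      to   : At (mt pos) w e
      live : ac pos ≢ 0
  open Dart

  dart : ∀ {e u w} → Traverses G e u w → Dart e u w
  dart (forward e) = record
    { pos = src (toℕ e) ; from = src-at e
    ; to = subst (λ q → At q (target e) e) (sym (proj₁ (at-source (src-at e) refl))) (tgt-at e)
    ; live = λ eq → 0≢1+n (trans (sym eq) (proj₂ (at-source (src-at e) refl))) }
  dart (backward und e) with source e Fin.≟ target e
  -- The position of a self-loop counts as one at the source, so its activity comes from there and
  -- not from the kind flag.
  ... | yes loop = record
    { pos = tgt (toℕ e) ; from = tgt-at e
    ; to = subst (λ q → At q (source e) e) (sym (proj₁ (at-source (tgt-at e) loop)))
             (subst (λ w → At (tgt (toℕ e)) w e) (sym loop) (tgt-at e))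
    ; live = λ eq → 0≢1+n (trans (sym eq) (proj₂ (at-source (tgt-at e) loop))) }
  ... | no s≢t = record
    { pos = tgt (toℕ e) ; from = tgt-at e
    ; to = subst (λ q → At q (source e) e) (sym (proj₁ (proj₂ (at-target (tgt-at e) s≢t)))) (src-at e)
    ; live = λ eq → 0≢1+n (trans (sym eq) (trans (proj₂ (proj₂ (at-target (tgt-at e) s≢t))) (cong kindFlag und))) }

  -- A position away from the source carries the kind flag as its activity, so being active there
  -- means that the graph is undirected and the edge may be traversed backwards.
  traversal : ∀ {p v e w} → At p v e → At (mt p) w e → ac p ≢ 0 → Traverses G e v w
  traversal {p} {v} {e} {w} x y live with source e Fin.≟ v
  traversal {p} {v} {e} {w} x y live | yes refl
    with At-function y (subst (λ q → At q (target e) e) (sym (proj₁ (at-source x refl))) (tgt-at e))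
  ... | refl , _ = forward e
  traversal {p} {v} {e} {w} x y live | no s≢ with at-target x s≢
  ... | refl , mt≡src , ac≡kind with At-function y (subst (λ q → At q (source e) e) (sym mt≡src) (src-at e))
  ...   | refl , _ = backward (undirected-kind kind refl) e
    where
    undirected-kind : ∀ k → kind ≡ k → kind ≡ undirected
    undirected-kind directed   eq = contradiction (trans ac≡kind (cong kindFlag eq)) live
    undirected-kind undirected eq = eq

  dart-step : ∀ {e f u w x} (d : Dart e u w) (d' : Dart f w x) → Differ e f → Step (pos d) (pos d')
  dart-step d d' e≢f = At-< (from d) , live d , At-< (from d') , trans (vt≡ (to d)) (sym (vt≡ (from d')))
    , λ eq → e≢f (trans (sym (lb≡ (to d))) (trans eq (lb≡ (from d'))))

  -- `d` belongs to the edge just before the walk and `d'` to the one just after it. For a cycle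
  -- both are the first edge, which matches its repetition in `Nonrepetitive`.
  walk-steps : ∀ {e a u x y z es} (d : Dart e u x) → Walk G x y es → (d' : Dart a y z) →
               Linked Differ (e ∷ es ∷ʳ a) → Steps⁺ (pos d) (pos d')
  walk-steps d [] d' (r ∷ _) = pos d' , dart-step d d' r , ε
  walk-steps d (t ∷ w) d' (r ∷ l) with walk-steps (dart t) w d' l
  ... | p , s , ss = pos (dart t) , dart-step d (dart t) r , s ◅ ss

  -- The walk stops before departing along `f`. Leaving the preceding edge `a` arbitrary makes the
  -- label condition composable in the induction, and finally allows `a` to be the first edge of a
  -- cycle.
  step-walk : ∀ {p q v e u f} → Star Step p q → At p v e → At q u f →
    ∃[ es ] (Walk G v u es × (∀ a → Differ a e → Linked Differ (a ∷ es ∷ʳ f)))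
  step-walk ε x y with At-function x y
  ... | refl , refl = [] , [] , λ a r → r ∷ [-]
  step-walk {e = e} ((p< , live , p'< , v≡ , l≢) ◅ ss) x y with At-total p'< | other-end x
  ... | w , e' , z | w' , x' with vt-injective x' z v≡
  ...   | refl with step-walk ss z y
  ...     | es , walk , lnk = e ∷ es , traversal x x' live ∷ walk ,
      λ a r → r ∷ lnk e (λ eq → l≢ (trans (lb≡ x') (trans eq (sym (lb≡ z)))))

  walk-split : ∀ {u w es e} → Walk G u w es → e ∈ es →
    ∃[ es₁ ] ∃[ es₂ ] ∃[ x ] ∃[ y ] (es ≡ es₁ ++ e ∷ es₂ × Walk G u x es₁ × Traverses G e x y × Walk G y w es₂)
  walk-split (t ∷ w) (here refl) = [] , _ , _ , _ , refl , [] , t , w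
  walk-split (t ∷ w) (there e∈) with walk-split w e∈
  ... | es₁ , es₂ , x , y , refl , w₁ , t' , w₂ = _ , es₂ , x , y , refl , t ∷ w₁ , t' , w₂

  linked-split : ∀ xs {e ys} → Linked Differ (xs ++ e ∷ ys) → Linked Differ (xs ∷ʳ e) × Linked Differ (e ∷ ys)
  linked-split []           l       = [-] , l
  linked-split (x ∷ [])     (r ∷ l) = r ∷ [-] , l
  linked-split (x ∷ y ∷ xs) (r ∷ l) with linked-split (y ∷ xs) l
  ... | l₁ , l₂ = r ∷ l₁ , l₂

  Steps⁺-trans : ∀ {p q r} → Steps⁺ p q → Steps⁺ q r → Steps⁺ p r
  Steps⁺-trans (p' , s , ss) (q' , t , ts) = p' , s , ss ◅◅ (t ◅ ts)

  -- Rotation of the cycle: from `e` on to the first edge, then from the first edge back to `e`.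
  -- Both label conditions are pieces of the given one, split at `e`.
  cycle-dart : ∀ {es e} → Cycle G es → Nonrepetitive G es → e ∈ es →
               ∃[ x ] ∃[ y ] Σ (Traverses G e x y) λ t → Steps⁺ (pos (dart t)) (pos (dart t))
  cycle-dart (v , t ∷ w) l (here refl) = _ , _ , t , walk-steps (dart t) w (dart t) l
  cycle-dart (v , _∷_ {e = f} t w) l (there e∈) with walk-split w e∈
  ... | es₁ , es₂ , x , y , refl , w₁ , t' , w₂
    with linked-split (f ∷ es₁) (subst (λ xs → Linked Differ (f ∷ xs)) (++-assoc es₁ _ _) l)
  ...   | l₁ , l₂ = x , y , t' , Steps⁺-trans (walk-steps (dart t') w₂ (dart t) l₂)
      (walk-steps (dart t) w₁ (dart t') l₁)

  live-undirected : kind ≡ undirected → ∀ {p v e} → At p v e → ac p ≢ 0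
  live-undirected und {p} {v} {e} x eq with source e Fin.≟ v
  ... | yes s = 0≢1+n (trans (sym eq) (proj₂ (at-source x s)))
  ... | no s≢ = 0≢1+n (trans (sym eq) (trans (proj₂ (proj₂ (at-target x s≢))) (cong kindFlag und)))

  -- Reversal swaps arrival and departure at the vertex where the step turns, so the two conditions
  -- there are symmetric; in an undirected graph all positions are active.
  step-reverse : kind ≡ undirected → ∀ {p q} → Step p q → Step (mt q) (mt p)
  step-reverse und {p} {q} (p< , _ , q< , v≡ , l≢) with At-total p< | At-total q<
  ... | v , e , x | w , f , y with other-end x | other-end y
  ...   | v' , x' | w' , y' = At-< y' , live-undirected und y' , At-< x'
      , trans (cong vt (mt-involutive y)) (sym v≡)
      , λ eq → l≢ (trans (sym eq) (cong lb (mt-involutive y)))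

  steps-reverse : kind ≡ undirected → ∀ {p q} → Star Step p q → Star Step (mt q) (mt p)
  steps-reverse und ε        = ε
  steps-reverse und (s ◅ ss) = steps-reverse und ss ◅◅ (step-reverse und s ◅ ε)

  Steps⁺-snoc : ∀ {p q r} → Star Step p q → Step q r → Steps⁺ p r
  Steps⁺-snoc ε        t = _ , t , ε
  Steps⁺-snoc (s ◅ ss) t = _ , s , ss ◅◅ (t ◅ ε)

  on-cycle⇒steps : ∀ e → OnNonrepetitiveCycle G e → Steps⁺ (src (toℕ e)) (src (toℕ e))
  on-cycle⇒steps e (es , cyc , nonrep , e∈) with cycle-dart cyc nonrep e∈
  ... | _ , _ , forward _ , st = st
  ... | _ , _ , backward und _ , st = back (source e Fin.≟ target e) (proj₁ (proj₂ tgt-steps))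
      (proj₂ (proj₂ tgt-steps))
    where
    tgt-steps : Steps⁺ (tgt (toℕ e)) (tgt (toℕ e))
    tgt-steps = subst (λ p → Steps⁺ p p) (At-injective (from (dart (backward und e))) (tgt-at e)) st
    back : Dec (source e ≡ target e) → ∀ {p} → Step (tgt (toℕ e)) p → Star Step p (tgt (toℕ e)) → Steps⁺
        (src (toℕ e)) (src (toℕ e))
    back (yes loop) s ss =
      subst (λ p → Steps⁺ p p) (At-injective (subst (λ w → At (tgt (toℕ e)) w e) (sym loop) (tgt-at e))
          (src-at e)) (_ , s , ss)
    back (no s≢t) s ss =
      -- Reversing a closed chain at the target position gives one at its mate, which is the source
      -- position.
      subst (λ p → Steps⁺ p p) (proj₁ (proj₂ (at-target (tgt-at e) s≢t)))
        (Steps⁺-snoc (steps-reverse und ss) (step-reverse und s))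

  steps⇒on-cycle : ∀ e → Steps⁺ (src (toℕ e)) (src (toℕ e)) → OnNonrepetitiveCycle G e
  steps⇒on-cycle e (p' , (p< , live , p'< , v≡ , l≢) , ss) with At-total p'< | other-end (src-at e)
  ... | w , f , z | w' , x' with vt-injective x' z v≡
  ...   | refl with step-walk ss z (src-at e)
  ...     | es , walk , lnk = e ∷ es , (source e , traversal (src-at e) x' live ∷ walk) ,
      lnk e (λ eq → l≢ (trans (lb≡ x') (trans eq (sym (lb≡ z))))) , here refl

-- Reading the incidence lists

mul3 : Exp → Exp
mul3 e = e ⊕ (e ⊕ (e ⊕ lit 0))

gap : Exp → Exp → Exp
gap e f = (e ⊖ f) ⊕ (f ⊖ e)

sourceE targetE labelE : Exp → Exp
sourceE e = INP at (lit 3 ⊕ mul3 e)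
targetE e = INP at (lit 4 ⊕ mul3 e)
labelE  e = INP at (lit 5 ⊕ mul3 e)

parse-cond : Exp
parse-cond = var REM ⊕ (INP at lit 1 ⊖ var VTX)

-- Each iteration consumes one word, so the nested lists are read by a single loop. `VTX` counts the
-- list headers seen so far, which is why vertices are stored plus one.
parse-body : Com
parse-body =
  ifz (var REM)
    (REM ≔ INP at var PTR ⨾′ VTX ≔ lit 1 ⊕ var VTX)
    (EG ⟪ var LEN ⟫≔ INP at var PTR ⨾′
     VT ⟪ var LEN ⟫≔ var VTX ⨾′
     -- The old entry is written back when the current vertex is not the source of the edge.
     SRC ⟪ INP at var PTR ⟫≔ cond (gap (var VTX) (lit 1 ⊕ sourceE (INP at var PTR))) (var LEN)
         (SRC at (INP at var PTR)) ⨾′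
     TGT ⟪ INP at var PTR ⟫≔ cond (gap (var VTX) (lit 1 ⊕ targetE (INP at var PTR))) (var LEN)
         (TGT at (INP at var PTR)) ⨾′
     LEN ≔ lit 1 ⊕ var LEN ⨾′
     REM ≔ var REM ⊖ lit 1) ⨾′
  PTR ≔ lit 1 ⊕ var PTR

start-parse : Com
start-parse = PTR ≔ lit 3 ⊕ mul3 (INP at lit 2)

-- The extra write to INP exempts the input array.
Untouched : Com → S → Set
Untouched c s = ∀ k → T (fresh k (INP ≔ lit 0 ⨾′ c)) → ∀ i → s k i ≡ 0

Untouched-frame : ∀ {c d s s'} → Untouched c s → Frame d s s' → Untouched (c ⨾′ d) s'
Untouched-frame {c} {d} zero₀ fr k new i =
  let (new₁ , new₂) = Equivalence.to T-∧ new
      (new₃ , new₄) = Equivalence.to (T-∧ {fresh k c}) new₂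
  in trans (cong (λ f → f i) (fr k new₄)) (zero₀ k (Equivalence.from T-∧ (new₁ , new₃)) i)

Enumerates : ∀ {n} → ℕ → List (Fin n) → Set
Enumerates {n} k []       = k ≡ n
Enumerates     k (v ∷ vs) = toℕ v ≡ k × Enumerates (suc k) vs

module Parse (G : Graph) (I : GroupedIncidence G) where
  open Graph G
  open GroupedIncidence I
  open Positions G I

  record Input (f : ℕ → ℕ) : Set where
    field
      count   : f 1 ≡ #vertices
      sources : ∀ (e : Edge) → f (3 + 3 * toℕ e) ≡ toℕ (source e)
      targets : ∀ (e : Edge) → f (4 + 3 * toℕ e) ≡ toℕ (target e)

  -- Nothing is required of an edge before its incidence at `end` has been read, so the initial
  -- entries may be arbitrary.
  Recorded : (Edge → Vertex) → List (Vertex × Edge) → (ℕ → ℕ) → Set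
  Recorded end done f = ∀ {v e} → (v , e) ∈ done → end e ≡ v → nth done (f (toℕ e)) ≡ just (v , e)

  -- `fuel` is the number of unread words. `done` lists the positions already stored, `cur` the rest
  -- of the current incidence list, and `rest` the vertices whose headers are still ahead.
  record Parsing (fuel : ℕ) (inp : ℕ → ℕ) (rem vtx ptr len : ℕ) (vt eg src tgt : ℕ → ℕ) : Set where
    field
      done cur : List (Vertex × Edge)
      rest     : List Vertex
      split    : positions ≡ done ++ cur ++ concatMap at-vertex rest
      current  : All (λ x → suc (toℕ (proj₁ x)) ≡ vtx) cur
      rem≡     : rem ≡ length cur
      later    : Enumerates vtx rest
      words    : Segment inp ptr (map (toℕ ∘ proj₂) cur ++ concatMap incidence-words rest)
      len≡     : len ≡ length done
      vertices : Segment vt 0 (map (suc ∘ toℕ ∘ proj₁) done)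
      edges    : Segment eg 0 (map (toℕ ∘ proj₂) done)
      blank    : ∀ i → len ≤ i → vt i ≡ 0
      sourced  : Recorded source done src
      targeted : Recorded target done tgt
      fuel≡    : fuel ≡ length cur + length (concatMap incidence-words rest)

  next-vertex : ∀ {fuel inp rem vtx ptr len vt eg src tgt} → rem ≡ 0 → inp 1 ≡ #vertices →
    rem + (inp 1 ∸ vtx) ≢ 0 → Parsing fuel inp rem vtx ptr len vt eg src tgt →
    ∃[ fuel' ] (fuel' < fuel × Parsing fuel' inp (inp ptr) (suc vtx) (suc ptr) len vt eg src tgt)
  next-vertex refl cnt go record { cur = _ ∷ _ ; rem≡ = () }
  -- With no vertex left, `later` says that `vtx` equals the number of vertices, so the loop guard
  -- would be 0.
  next-vertex {vtx = vtx} refl cnt go record { cur = [] ; rest = [] ; later = refl } =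
    contradiction (trans (cong (_∸ vtx) cnt) (n∸n≡0 vtx)) go
  next-vertex {vtx = vtx} refl cnt go
    record { done = done ; cur = [] ; rest = v ∷ rest ; split = split ; later = refl , later ; words = w≡ , words
           ; len≡ = len≡ ; vertices = vertices ; edges = edges ; blank = blank
           ; sourced = sourced ; targeted = targeted ; fuel≡ = refl } =
    _ , ≤-refl , record
      { done = done ; cur = at-vertex v ; rest = rest ; split = split
      ; current = same-vertex (incident v)
      ; rem≡ = trans w≡ (sym (length-map (v ,_) (incident v)))
      ; later = later
      ; words = subst (λ xs → Segment _ _ (xs ++ concatMap incidence-words rest)) (map-∘ (incident v)) words
      ; len≡ = len≡ ; vertices = vertices ; edges = edges ; blank = blank
      ; sourced = sourced ; targeted = targeted
      ; fuel≡ = trans (length-++ (map toℕ (incident v)))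
          (cong (_+ length (concatMap incidence-words rest))
            (trans (length-map toℕ (incident v)) (sym (length-map (v ,_) (incident v))))) }
    where
    same-vertex : ∀ es → All (λ x → suc (toℕ (proj₁ x)) ≡ suc (toℕ v)) (map (v ,_) es)
    same-vertex []       = []
    same-vertex (e ∷ es) = refl ∷ same-vertex es

  record-snoc : ∀ end {done : List (Vertex × Edge)} {f : ℕ → ℕ} v e {vtx w} → suc (toℕ v) ≡ vtx → w ≡ toℕ (end e) →
    Recorded end done f →
    Recorded end (done ∷ʳ (v , e)) (f [ toℕ e ↦ choose ∣ vtx - suc w ∣ₑ (length done) (f (toℕ e)) ])
  record-snoc end {done} {f} v e {vtx} {w} refl refl old {v'} {e'} x∈ end≡ with toℕ e ≟ toℕ e' | end e Fin.≟ v
  ... | yes same-edge | yes refl with toℕ-injective same-edge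
  ...   | refl rewrite sym end≡ = trans (cong (nth (done ∷ʳ (end e , e)))
            (trans (↦-same f (toℕ e)) (choose-equal {a = suc (toℕ (end e))} {suc (toℕ (end e))} refl)))
                (nth-snoc done)
  record-snoc end {done} {f} v e refl refl old {v'} {e'} x∈ end≡ | yes same-edge | no end≢ with toℕ-injective same-edge
  ... | refl = trans (cong (nth (done ∷ʳ (v , e)))
      (trans (↦-same f (toℕ e)) (choose-apart {a = suc (toℕ v)} {suc (toℕ (end e))}
          (λ eq → end≢ (sym (toℕ-injective (suc-injective eq)))))))
    (nth-++ done (f (toℕ e)) (old (earlier (∈-++⁻ done x∈)) end≡))
    where
    earlier : (v' , e) ∈ done ⊎ (v' , e) ∈ (v , e) ∷ [] → (v' , e) ∈ done
    earlier (inj₁ y∈) = y∈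
    earlier (inj₂ (here refl)) = contradiction end≡ end≢
  record-snoc end {done} {f} v e refl refl old {v'} {e'} x∈ end≡ | no other≢ | _ =
    trans (cong (nth (done ∷ʳ (v , e))) (↦-other f other≢))
        (nth-++ done (f (toℕ e')) (old (earlier (∈-++⁻ done x∈)) end≡))
    where
    earlier : (v' , e') ∈ done ⊎ (v' , e') ∈ (v , e) ∷ [] → (v' , e') ∈ done
    earlier (inj₁ y∈) = y∈
    earlier (inj₂ (here refl)) = contradiction refl other≢

  next-edge : ∀ {fuel inp rem vtx ptr len vt eg src tgt} → Input inp → rem ≢ 0 →
    Parsing fuel inp rem vtx ptr len vt eg src tgt → let e = inp ptr in
    ∃[ fuel' ] (fuel' < fuel × Parsing fuel' inp (rem ∸ 1) vtx (suc ptr) (suc len) (vt [ len ↦ vtx ]) (eg [ len ↦ e ])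
      (src [ e ↦ choose ∣ vtx - suc (inp (3 + 3 * e)) ∣ₑ len (src e) ])
      (tgt [ e ↦ choose ∣ vtx - suc (inp (4 + 3 * e)) ∣ₑ len (tgt e) ]))
  next-edge input rem≢0 record { cur = [] ; rem≡ = refl } = contradiction refl rem≢0
  next-edge {inp = inp} {vtx = vtx} {vt = vt} {eg} {src} {tgt} input rem≢0
    record { done = done ; cur = (v , e) ∷ cur ; rest = rest ; split = split ; current = here-v ∷ current
        ; rem≡ = refl
           ; later = later ; words = w≡ , words ; len≡ = refl ; vertices = vertices ; edges = edges ; blank = blank
           ; sourced = sourced ; targeted = targeted ; fuel≡ = refl }
    rewrite w≡ =
    _ , ≤-refl , record
      { done = done ∷ʳ (v , e) ; cur = cur ; rest = rest
      ; split = trans split (sym (++-assoc done ((v , e) ∷ []) _))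
      ; current = current ; rem≡ = refl ; later = later ; words = words
      ; len≡ = trans (+-comm 1 (length done)) (sym (length-++ done))
      ; vertices = subst₂ (λ n xs → Segment (vt [ n ↦ vtx ]) 0 xs) (length-map _ done)
          (trans (cong (map (suc ∘ toℕ ∘ proj₁) done ∷ʳ_) (sym here-v))
              (sym (map-++ (suc ∘ toℕ ∘ proj₁) done ((v , e) ∷ []))))
          (Segment-snoc 0 (map (suc ∘ toℕ ∘ proj₁) done) vertices)
      ; edges = subst₂ (λ n xs → Segment (eg [ n ↦ toℕ e ]) 0 xs) (length-map _ done)
          (sym (map-++ (toℕ ∘ proj₂) done ((v , e) ∷ [])))
          (Segment-snoc 0 (map (toℕ ∘ proj₂) done) edges)
      ; blank = λ i len< → trans (↦-other vt (<⇒≢ len<)) (blank i (<⇒≤ len<))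
      ; sourced = record-snoc source {done} {src} v e here-v (Input.sources input e) sourced
      ; targeted = record-snoc target {done} {tgt} v e here-v (Input.targets input e) targeted
      ; fuel≡ = refl }

  ParseState : ℕ → S → Set
  ParseState n s = Parsing n (s INP) (s REM 0) (s VTX 0) (s PTR 0) (s LEN 0) (s VT) (s EG) (s SRC) (s TGT)

  parse-step : ∀ n s → Input (s INP) → ParseState n s → ⟦ parse-cond ⟧ᵉ s ≢ 0 → ∃[ n' ]
      (n' < n × ParseState n' (⟦ parse-body ⟧ s))
  parse-step n s input st go =
    choose-elim (λ s' → ∃[ n' ] (n' < n × ParseState n' (⟦ PTR ≔ lit 1 ⊕ var PTR ⟧ s'))) (s REM 0)
      (λ rem≡0 → next-vertex rem≡0 (Input.count input) go st)
      (λ rem≢0 → next-edge input rem≢0 st)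

  record Parsed (s : S) : Set where
    field
      len≡   : s LEN 0 ≡ length positions
      vt≡    : ∀ {p v e} → At p v e → s VT p ≡ suc (toℕ v)
      eg≡    : ∀ {p v e} → At p v e → s EG p ≡ toℕ e
      vt-end : s VT (length positions) ≡ 0
      src-at : ∀ e → At (s SRC (toℕ e)) (source e) e
      tgt-at : ∀ e → At (s TGT (toℕ e)) (target e) e

  parsed : ∀ n s → Input (s INP) → ParseState n s → ⟦ parse-cond ⟧ᵉ s ≡ 0 → Parsed s
  parsed n s input record { cur = _ ∷ _ ; rem≡ = rem≡ } halt =
    contradiction (trans (sym (m+n≡0⇒m≡0 (s REM 0) halt)) rem≡) λ ()
  parsed n s input record { cur = [] ; rest = v ∷ rest ; later = v≡ , later } halt =
    contradiction (m∸n≡0⇒m≤n (m+n≡0⇒n≡0 (s REM 0) halt))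
      (<⇒≱ (subst₂ _<_ v≡ (sym (Input.count input)) (toℕ<n v)))
  parsed n s input record { done = done ; cur = [] ; rest = [] ; split = split ; len≡ = len≡ ; vertices = vertices
                          ; edges = edges ; blank = blank ; sourced = sourced ; targeted = targeted } halt = record
    { len≡ = trans len≡ (cong length all)
    ; vt≡ = λ { {p} (at eq) → Segment-nth 0 _ p vertices (nth-map _ done p (trans (cong (λ xs → nth xs p) all) eq)) }
    ; eg≡ = λ { {p} (at eq) → Segment-nth 0 _ p edges (nth-map _ done p (trans (cong (λ xs → nth xs p) all) eq)) }
    ; vt-end = blank _ (≤-reflexive (trans len≡ (cong length all)))
    ; src-at = λ e → at (trans (cong (λ xs → nth xs (s SRC (toℕ e))) (sym all))
                          (sourced (subst (_ ∈_) (sym all) (∈-positions (inj₁ refl))) refl))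
    ; tgt-at = λ e → at (trans (cong (λ xs → nth xs (s TGT (toℕ e))) (sym all))
                          (targeted (subst (_ ∈_) (sym all) (∈-positions (inj₂ refl))) refl)) }
    where
    all : done ≡ positions
    all = sym (trans split (++-identityʳ done))

  enumerates-all : Enumerates 0 (allFin #vertices)
  enumerates-all = go 0 #vertices (λ v → v) (λ v → refl) refl
    where
    go : ∀ k m (f : Fin m → Vertex) → (∀ i → toℕ (f i) ≡ k + toℕ i) → k + m ≡ #vertices → Enumerates k (tabulate f)
    go k zero    f f≡ sum = trans (sym (+-identityʳ k)) sum
    go k (suc m) f f≡ sum = trans (f≡ Fin.zero) (+-identityʳ k)
      , go (suc k) m (f ∘ Fin.suc) (λ i → trans (f≡ (Fin.suc i)) (+-suc k (toℕ i))) (trans (sym (+-suc k m)) sum)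

  parse-run : ∀ s₀ → (∀ i → s₀ INP i ≡ word input i) → s₀ PTR 0 ≡ 3 + 3 * #edges →
    Untouched start-parse s₀ →
    ∃[ k ] ∃[ s ] (k ≤ 4 * #edges × Iterates parse-cond parse-body s₀ k s × Frame parse-body s₀ s × Parsed s)
  parse-run s₀ inp ptr zeros =
    let (k , s , k≤ , it , (n , st) , halt , fr) =
          while-rule {parse-cond} {parse-body} ParseState {s₀ = s₀}
            (λ {n} {s} fr st go → parse-step n s (subst Input (sym (fr INP tt)) input₀) st go) start
    in k , s , ≤-trans k≤ bounded , it , fr , parsed n s (subst Input (sym (fr INP tt)) input₀) st halt
    where
    input₀ : Input (s₀ INP)
    input₀ = record
      { count = inp 1
      ; sources = λ e → trans (inp _) (proj₁ (edge-words e))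
      ; targets = λ e → trans (inp _) (proj₁ (proj₂ (edge-words e))) }
    start : ParseState (length (concatMap incidence-words (allFin #vertices))) s₀
    start = record
      { done = [] ; cur = [] ; rest = allFin #vertices ; split = refl ; current = []
      ; rem≡ = zeros REM tt 0
      ; later = subst (λ k → Enumerates k (allFin #vertices)) (sym (zeros VTX tt 0)) enumerates-all
      ; words = subst (λ b → Segment (s₀ INP) b (concatMap incidence-words (allFin #vertices))) (sym ptr)
          (Segment-cong _ _ (λ i → sym (inp i)) incidence-segment)
      ; len≡ = zeros LEN tt 0 ; vertices = tt ; edges = tt
      ; blank = λ i _ → zeros VT tt i
      ; sourced = λ () ; targeted = λ () ; fuel≡ = refl }
    bounded : length (concatMap incidence-words (allFin #vertices)) ≤ 4 * #edges
    bounded = ≤-trans (≤-reflexive (length-incidence (allFin #vertices)))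
      (≤-trans (+-mono-≤ (≤-trans (≤-reflexive (length-tabulate (λ (v : Vertex) → v))) #vertices≤) #positions≤)
        (≤-reflexive (fourfold #edges)))
      where
      fourfold : ∀ m → (m + m) + (m + m) ≡ 4 * m
      fourfold m = trans (+-assoc m m (m + m)) (cong (λ k → m + (m + (m + k))) (sym (+-identityʳ m)))

-- The algorithm

mate-body : Com
mate-body =
  MATE ⟪ var IDX ⟫≔ cond at-target? (TGT at (EG at var IDX)) (SRC at (EG at var IDX)) ⨾′
  ACT ⟪ var IDX ⟫≔ cond at-target? (lit 1) (INP at lit 0) ⨾′
  -- For the last position this reads the cell just behind `VT`, whose 0 matches no vertex, so the
  -- entry becomes 0. Writing at the next index leaves `LINK` at 0 blank, as the layout requires.
  LINK ⟪ lit 1 ⊕ var IDX ⟫≔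
    cond (gap (VT at var IDX) (VT at (lit 1 ⊕ var IDX)))
      (cond (gap (labelE (EG at var IDX)) (labelE (EG at (lit 1 ⊕ var IDX)))) (lit 1) (lit 2))
      (lit 0) ⨾′
  IDX ≔ lit 1 ⊕ var IDX
  where
  at-target? : Exp
  at-target? = gap (VT at var IDX) (lit 1 ⊕ sourceE (EG at var IDX))

module Mates (inp vt eg src tgt : ℕ → ℕ) where

  mate-at act-at link-after : ℕ → ℕ
  mate-at p = choose ∣ vt p - suc (inp (3 + 3 * eg p)) ∣ₑ (tgt (eg p)) (src (eg p))
  act-at p = choose ∣ vt p - suc (inp (3 + 3 * eg p)) ∣ₑ 1 (inp 0)
  link-after p = choose ∣ vt p - vt (suc p) ∣ₑ
    (choose ∣ inp (5 + 3 * eg p) - inp (5 + 3 * eg (suc p)) ∣ₑ 1 2) 0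

  Matching : S → Set
  Matching s = Agree (s MATE) mate-at (s IDX 0) × Agree (s ACT) act-at (s IDX 0)
             × Agree (s LINK ∘ suc) link-after (s IDX 0) × s LINK 0 ≡ 0

  mate-step : ∀ s → s INP ≡ inp → s VT ≡ vt → s EG ≡ eg → s SRC ≡ src → s TGT ≡ tgt →
    Matching s → Matching (⟦ mate-body ⟧ s)
  mate-step s refl refl refl refl refl (m , a , l , l0) =
    Agree-write (s MATE) mate-at (s IDX 0) m , Agree-write (s ACT) act-at (s IDX 0) a
    -- A write at `suc i`, viewed through `suc`, is definitionally a write at `i`.
    , Agree-write (s LINK ∘ suc) link-after (s IDX 0) l , l0

  mate-run : ∀ s₀ n → s₀ INP ≡ inp → s₀ VT ≡ vt → s₀ EG ≡ eg → s₀ SRC ≡ src → s₀ TGT ≡ tgt →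
    s₀ LEN 0 ≡ n → s₀ IDX 0 ≡ 0 → s₀ LINK 0 ≡ 0 →
    ∃[ k ] ∃[ s ] (k ≤ n × Iterates (var LEN ⊖ var IDX) mate-body s₀ k s × Frame mate-body s₀ s
      × Agree (s MATE) mate-at n × Agree (s ACT) act-at n × Agree (s LINK ∘ suc) link-after n × s LINK 0 ≡ 0)
  mate-run s₀ n e₁ e₂ e₃ e₄ e₅ len idx l0 =
    let (k , s , k≤ , it , fr , (m , a , l , l0') , end) =
          for-rule {mate-body} {s₀} (var LEN) IDX n Matching
            (λ s fr → trans (cong (λ f → f 0) (fr LEN tt)) len)
            (λ s fr inv _ → mate-step s (trans (fr INP tt) e₁) (trans (fr VT tt) e₂) (trans (fr EG tt) e₃)
                              (trans (fr SRC tt) e₄) (trans (fr TGT tt) e₅) inv , refl)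
            (none , none , none , l0) idx
    in k , s , k≤ , it , fr , subst (Agree (s MATE) mate-at) end m , subst (Agree (s ACT) act-at) end a
       , subst (Agree (s LINK ∘ suc) link-after) end l , l0'
    where
    none : ∀ {f g} → Agree f g (s₀ IDX 0)
    none x x< = contradiction (<-≤-trans x< (≤-reflexive idx)) n≮0

-- `6 * p` is the code of `(O, p)`. The position at the source of an edge is always active, so its
-- `SUCC0` is the arrival at the mate, and the test compares the components of the two ends of the
-- arc `out`.
answer-body : Com
answer-body =
  OUT ⟪ var IDX ⟫≔ cond (gap (COMP at departure) (COMP at (SUCC0 at departure))) (lit 1) (lit 0) ⨾′
  IDX ≔ lit 1 ⊕ var IDX
  where
  departure : Exp
  departure = mul6 (SRC at var IDX)

answer-at : (src succ comp : ℕ → ℕ) → ℕ → ℕ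
answer-at src succ comp e = choose ∣ comp (6 * src e) - comp (succ (6 * src e)) ∣ₑ 1 0

answer-run : ∀ s₀ n → s₀ INP 2 ≡ n → s₀ IDX 0 ≡ 0 →
  ∃[ k ] ∃[ s ] (k ≤ n × Iterates (INP at lit 2 ⊖ var IDX) answer-body s₀ k s × Frame answer-body s₀ s
    × Agree (s OUT) (answer-at (s₀ SRC) (s₀ SUCC0) (s₀ COMP)) n)
answer-run s₀ n cnt idx =
  let (k , s , k≤ , it , fr , inv , end) =
        for-rule {answer-body} {s₀} (INP at lit 2) IDX n (λ s → Agree (s OUT) expected (s IDX 0))
          (λ s fr → trans (cong (λ f → f 2) (fr INP tt)) cnt)
          (λ s fr inv _ → extend s (fr SRC tt) (fr SUCC0 tt) (fr COMP tt) inv , refl)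
          (λ x x< → contradiction (<-≤-trans x< (≤-reflexive idx)) n≮0) idx
  in k , s , k≤ , it , fr , subst (Agree (s OUT) expected) end inv
  where
  expected : ℕ → ℕ
  expected = answer-at (s₀ SRC) (s₀ SUCC0) (s₀ COMP)
  extend : ∀ s → s SRC ≡ s₀ SRC → s SUCC0 ≡ s₀ SUCC0 → s COMP ≡ s₀ COMP → Agree (s OUT) expected (s IDX 0) →
         Agree (⟦ answer-body ⟧ s OUT) expected (suc (s IDX 0))
  extend s e₁ e₂ e₃ old rewrite sym e₁ | sym e₂ | sym e₃ =
    Agree-write (s OUT) (answer-at (s SRC) (s SUCC0) (s COMP)) (s IDX 0) old

restart : Com
restart = IDX ≔ lit 0

answer-algo sweep-algo dfs-algo build-algo mate-algo algorithm : Algo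
answer-algo = once restart ⨟ while (INP at lit 2 ⊖ var IDX) answer-body
sweep-algo  = while sweep-cond sweep-body ⨟ answer-algo
dfs-algo    = while dfs-cond dfs-body ⨟ sweep-algo
build-algo  = while (mul6 (var LEN) ⊖ var NODE) build-body ⨟ dfs-algo
mate-algo   = while (var LEN ⊖ var IDX) mate-body ⨟ build-algo
algorithm   = once start-parse ⨟ while parse-cond parse-body ⨟ mate-algo

-- With N positions, N ≤ 2 m, the digraph has 6 N nodes. Its search takes 6 N + 3 · 6 N = 24 N
-- rounds and the sweep 24 N + 2 · 6 N = 36 N; building takes 6 N and matching N. Doubling gives 48,
-- 72, 12 and 2. Parsing reads at most 2 m headers and 2 m incidences.
answer-cost sweep-cost dfs-cost build-cost mate-cost constant : ℕ
answer-cost = size (tr restart) + while-cost (INP at lit 2 ⊖ var IDX) answer-body 1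
sweep-cost  = while-cost sweep-cond sweep-body 72 + answer-cost
dfs-cost    = while-cost dfs-cond dfs-body 48 + sweep-cost
build-cost  = while-cost (mul6 (var LEN) ⊖ var NODE) build-body 12 + dfs-cost
mate-cost   = while-cost (var LEN ⊖ var IDX) mate-body 2 + build-cost
constant    = size (tr start-parse) + (while-cost parse-cond parse-body 4 + mate-cost)

-- Not executed as such: they collect the assignments of the stages so far, so that `Untouched` can
-- state which arrays are still blank.
parsing mating building : Com
parsing  = start-parse ⨾′ parse-body
mating   = parsing ⨾′ mate-body
building = mating ⨾′ build-body

Answers : (G : Graph) → (ℕ → ℕ) → Set
Answers G f = ∀ (e : Graph.Edge G) →
  (OnNonrepetitiveCycle G e × f (toℕ e) ≡ 1) ⊎ (¬ OnNonrepetitiveCycle G e × f (toℕ e) ≡ 0)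

24-fold : ∀ n → 6 * n + 6 * n * 3 ≡ 24 * n
24-fold = solve 1 (λ n → con 6 :* n :+ con 6 :* n :* con 3 := con 24 :* n) refl

36-fold : ∀ n → (6 * n + 6 * n * 3) + 6 * n * 2 ≡ 36 * n
36-fold = solve 1 (λ n → (con 6 :* n :+ con 6 :* n :* con 3) :+ con 6 :* n :* con 2 := con 36 :* n) refl

-- Correctness and running time of the stages

module Correctness (G : Graph) (J : GroupedIncidence G) where
  open Graph G
  open Positions G J
  open Parse G J

  N : ℕ
  N = length positions

  N-linear : ∀ {k} c → k ≤ c * N → Linear (c * 2) #edges k
  N-linear {k} c k≤ = linear (≤-trans k≤ (≤-trans (*-monoʳ-≤ c #positions≤)
    (≤-trans (≤-reflexive (twice c #edges)) (*-monoʳ-≤ (c * 2) (n≤1+n #edges)))))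
    where
    twice : ∀ c m → c * (m + m) ≡ c * 2 * m
    twice = solve 2 (λ c m → c :* (m :+ m) := c :* con 2 :* m) refl

  m-linear : ∀ {k} c → k ≤ c * #edges → Linear c #edges k
  m-linear c k≤ = linear (≤-trans k≤ (*-monoʳ-≤ c (n≤1+n #edges)))

  Result : Algo → ℕ → S → Set
  Result q d s = ∃[ s' ] (LinearRun q d #edges s s' × s' INP 2 ≡ #edges × Answers G (s' OUT))

  combine : ∀ {p q c d s s'} → LinearRun p c #edges s s' → Result q d s' → Result (p ⨟ q) (c + d) s
  combine run (s'' , run' , rest) = s'' , (run then run') , rest

  answer-stage : ∀ s → s INP 2 ≡ #edges →
    (∀ f → Agree f (answer-at (s SRC) (s SUCC0) (s COMP)) #edges → Answers G f) →
    Result answer-algo answer-cost s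
  answer-stage s cnt correct =
    let (_ , s' , k≤ , it , fr , out) = answer-run (⟦ restart ⟧ s) #edges cnt refl
    in combine (once-linear restart s #edges)
         (s' , while-linear (m-linear 1 (≤-trans k≤ (≤-reflexive (sym (*-identityˡ #edges))))) it
         , trans (cong (λ f → f 2) (fr INP tt)) cnt , correct (s' OUT) out)

  module AfterMates (s₃ : S) (src : ℕ → ℕ) (tables : Tables G J src (s₃ MATE) (s₃ ACT) (s₃ LINK)) where

    open Translation G J tables using (layout; at-source; on-cycle⇒steps; steps⇒on-cycle)
    open Build (s₃ LINK) (s₃ MATE) (s₃ ACT) using (Filled; build-run)
    open Picks (s₃ LINK) (s₃ MATE) (s₃ ACT) using (along)

    module AfterBuild (s₄ : S)
      (f0 : Filled (s₄ SUCC0) succ0 (6 * N)) (f1 : Filled (s₄ SUCC1) succ1 (6 * N))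
      (f2 : Filled (s₄ PRED0) pred0 (6 * N)) (f3 : Filled (s₄ PRED1) pred1 (6 * N)) where

      open Coded layout (s₄ SUCC0) (s₄ SUCC1) (s₄ PRED0) (s₄ PRED1)
        using (Tabulates; σ0<; σ1<; π0-sound; π1-sound; π-complete; cyclic-~; ~-cyclic)
      open Digraph (6 * N) (s₄ SUCC0) (s₄ SUCC1) using (_~_; Good)

      tabulates : ∀ f table → Filled f table (6 * N) → Tabulates f table
      tabulates f table filled n p< =
        trans (filled (code n) (code< (proj₁ n) p<)) (cong (λ n → code (along table n)) (decode-code n))

      h0 = tabulates (s₄ SUCC0) succ0 f0
      h1 = tabulates (s₄ SUCC1) succ1 f1
      g0 = tabulates (s₄ PRED0) pred0 f2
      g1 = tabulates (s₄ PRED1) pred1 f3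

      open DfsPass (6 * N) (s₄ SUCC0) (s₄ SUCC1) (σ0< h0 h1 g0 g1) (σ1< h0 h1 g0 g1) using (dfs-run; Finished; module Finished)
      open SweepPass (6 * N) (s₄ SUCC0) (s₄ SUCC1) (s₄ PRED0) (s₄ PRED1) using (sweep-run)

      answers : (comp : ℕ → ℕ) →
        (∀ {x y} → x < 6 * N → (comp x ≡ comp y → x ~ y) × (x ~ y → comp x ≡ comp y)) →
        ∀ f → Agree f (answer-at src (s₄ SUCC0) comp) #edges → Answers G f
      answers comp classes f agree e = decide (comp departure ≟ comp arrival)
        where
        p = src (toℕ e)
        departure = code (O , p)
        arrival = code (I , s₃ MATE p)
        p< : p < N
        p< = At-< (Tables.src-at tables e)
        live : s₃ ACT p ≢ 0
        live eq = 0≢1+n (trans (sym eq) (proj₂ (at-source (Tables.src-at tables e) refl)))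
        succ≡ : s₄ SUCC0 departure ≡ arrival
        succ≡ = trans (h0 (O , p) p<) (cong code (choose-nonzero live))
        value≡ : f (toℕ e) ≡ choose ∣ comp departure - comp arrival ∣ₑ 1 0
        value≡ = trans (agree (toℕ e) (toℕ<n e))
          (cong (λ x → choose ∣ comp departure - comp x ∣ₑ 1 0) succ≡)
        decide : Dec (comp departure ≡ comp arrival) →
          (OnNonrepetitiveCycle G e × f (toℕ e) ≡ 1) ⊎ (¬ OnNonrepetitiveCycle G e × f (toℕ e) ≡ 0)
        decide (yes eq) = inj₁
          ( steps⇒on-cycle e (~-cyclic h0 h1 g0 g1 p< live (proj₁ (classes (code< O p<)) eq))
          , trans value≡ (choose-equal eq))
        decide (no neq) = inj₂
          ( (λ on → neq (proj₂ (classes (code< O p<)) (cyclic-~ h0 h1 g0 g1 (on-cycle⇒steps e on))))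
          , trans value≡ (choose-apart neq))

      sweep-stage : ∀ s → s INP 2 ≡ #edges → s SRC ≡ src → s SUCC0 ≡ s₄ SUCC0 →
        s PRED0 ≡ s₄ PRED0 → s PRED1 ≡ s₄ PRED1 → (∀ x → s COMP x ≡ 0) → s TOP 0 ≡ 0 →
        s FIN 0 ≤ 6 * N + 6 * N * 3 → Finished s → Result sweep-algo sweep-cost s
      sweep-stage s cnt src≡ succ≡ pred0≡ pred1≡ blank top≡0 fin≤ done =
        let (_ , s' , k≤ , it , fr , classes) =
              sweep-run (π0-sound h0 h1 g0 g1) (π1-sound h0 h1 g0 g1) (π-complete h0 h1 g0 g1) s
                pred0≡ pred1≡ blank top≡0 fin≤ (Finished.good done) (Finished.order done) (Finished.all done)
                    (Finished.only done)
        in combine (while-linear (N-linear 36 (≤-trans k≤ (≤-reflexive (36-fold N)))) it)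
             (answer-stage s' (trans (cong (λ f → f 2) (fr INP tt)) cnt) λ f agree →
               answers (s' COMP) classes f
                 (subst₂ (λ src succ → Agree f (answer-at src succ (s' COMP)) #edges)
                   (trans (fr SRC tt) src≡) (trans (fr SUCC0 tt) succ≡) agree))

      dfs-stage : s₄ INP 2 ≡ #edges → s₄ SRC ≡ src → s₄ LEN 0 ≡ N → Untouched building s₄ →
        Result dfs-algo dfs-cost s₄
      dfs-stage cnt src≡ len zeros =
        let (_ , s' , k≤ , it , fr , fin≤ , top≡0 , done) = dfs-run s₄ (cong (6 *_) len) refl refl
              (zeros COL tt) (zeros TOP tt 0) (zeros FIN tt 0) (zeros ROOT tt 0)
        in combine (while-linear (N-linear 24 (≤-trans k≤ (≤-reflexive (24-fold N)))) it)
             (sweep-stage s' (trans (cong (λ f → f 2) (fr INP tt)) cnt) (trans (fr SRC tt) src≡)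
               (fr SUCC0 tt) (fr PRED0 tt) (fr PRED1 tt)
               (λ x → trans (cong (λ f → f x) (fr COMP tt)) (zeros COMP tt x)) top≡0 fin≤ done)

    build-stage : s₃ INP 2 ≡ #edges → s₃ SRC ≡ src → s₃ LEN 0 ≡ N → Untouched mating s₃ →
      Result build-algo build-cost s₃
    build-stage cnt src≡ len zeros =
      let (_ , s' , k≤ , it , fr , f0 , f1 , f2 , f3) = build-run s₃ (6 * N) (cong (6 *_) len) refl refl refl
            (zeros KIND tt 0) (zeros POS tt 0) (zeros NODE tt 0)
      in combine (while-linear (N-linear 6 k≤) it)
           (AfterBuild.dfs-stage s' f0 f1 f2 f3 (trans (cong (λ f → f 2) (fr INP tt)) cnt) (trans (fr SRC tt) src≡)
             (trans (cong (λ f → f 0) (fr LEN tt)) len) (Untouched-frame {mating} {build-body} zeros fr))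

  mate-stage : ∀ s → (∀ j → s INP j ≡ word input j) → Parsed s → Untouched parsing s →
    Result mate-algo mate-cost s
  mate-stage s inp P zeros =
    let (_ , s' , k≤ , it , fr , m , a , l , l0) =
          Mates.mate-run (s INP) (s VT) (s EG) (s SRC) (s TGT) s N refl refl refl refl refl
            (Parsed.len≡ P) (zeros IDX tt 0) (zeros LINK tt 0)
    in combine (while-linear (N-linear 1 (≤-trans k≤ (≤-reflexive (sym (*-identityˡ N))))) it)
         (AfterMates.build-stage s' (s SRC) (tables s' m a l l0)
           (trans (cong (λ f → f 2) (fr INP tt)) (inp 2)) (fr SRC tt)
           (trans (cong (λ f → f 0) (fr LEN tt)) (Parsed.len≡ P)) (Untouched-frame {parsing} {mate-body} zeros fr))
    where
    open Mates (s INP) (s VT) (s EG) (s SRC) (s TGT)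
    open Parsed P
    tables : ∀ s' → Agree (s' MATE) mate-at N → Agree (s' ACT) act-at N → Agree (s' LINK ∘ suc) link-after N →
             s' LINK 0 ≡ 0 → Tables G J (s SRC) (s' MATE) (s' ACT) (s' LINK)
    tables s' m a l l0 = record
      { vt = s VT ; eg = s EG ; tgt = s TGT
      ; lab = λ i → s INP (5 + 3 * i) ; srcw = λ i → s INP (3 + 3 * i)
      ; vt≡ = vt≡ ; eg≡ = eg≡ ; vt-end = vt-end ; src-at = src-at ; tgt-at = tgt-at
      ; lab≡ = λ e → trans (inp _) (proj₂ (proj₂ (edge-words e)))
      ; srcw≡ = λ e → trans (inp _) (proj₁ (edge-words e))
      ; mt≡ = m
      ; ac≡ = λ p p< → trans (a p p<) (cong (choose ∣ s VT p - suc (s INP (3 + 3 * s EG p)) ∣ₑ 1) (inp 0))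
      ; lk-0 = l0 ; lk≡ = l }

  solved : ∀ s → (∀ j → s INP j ≡ word input j) → (∀ k → k ≢ INP → ∀ j → s k j ≡ 0) →
    Result algorithm constant s
  solved s inp zeros =
    let (_ , s' , k≤ , it , fr , P) = parse-run (⟦ start-parse ⟧ s) inp (cong (λ m → 3 + 3 * m) (inp 2)) untouched
    in combine (once-linear start-parse s #edges) (combine (while-linear (m-linear 4 k≤) it)
         (mate-stage s' (λ j → trans (cong (λ f → f j) (fr INP tt)) (inp j)) P
             (Untouched-frame {start-parse} {parse-body} untouched fr)))
    where
    untouched : Untouched start-parse (⟦ start-parse ⟧ s)
    untouched k new i =
      let (new₁ , new₂) = Equivalence.to T-∧ new
      in trans (cong (λ f → f i) (frame start-parse k {s} new₂)) (zeros k (λ { refl → new₁ }) i)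

-- Stated for arbitrary programs, so that the compiled code is never normalised.
conclude : ∀ P k (G : Graph) s₀ →
  ∃[ n ] (n ≤ k * suc (Graph.#edges G) × Halted P (run P n s₀)
    × ∃[ f ] (Answers G f × ∀ j → j < Graph.#edges G → memory (run P n s₀) j ≡ f j)) →
  ∃[ t ] (t ≤ k * suc (Graph.#edges G) × Halted P (run P t s₀)
    × Identifies G (OnNonrepetitiveCycle G) (run P t s₀))
conclude P k G s₀ (n , n≤ , halted , f , answers , memory≡) =
  n , n≤ , halted , λ e → transfer (memory≡ (toℕ e) (toℕ<n e)) (answers e)
  where
  transfer : ∀ {Q : Set} {x y} → y ≡ x → (Q × x ≡ 1) ⊎ (¬ Q × x ≡ 0) → (Q × y ≡ 1) ⊎ (¬ Q × y ≡ 0)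
  transfer refl answer = answer

identifies : ∀ A c →
  (∀ (G : Graph) (J : GroupedIncidence G) s → (∀ j → s INP j ≡ word (encode G J) j) →
    (∀ k → k ≢ INP → ∀ j → s k j ≡ 0) → Correctness.Result G J A c s) →
  IdentifiesInLinearTime (pflat (whole A) 0) OnNonrepetitiveCycle
identifies A c correct = overhead + c , λ G J →
  conclude (pflat (whole A) 0) (overhead + c) G (initial (encode G J))
    -- The omitted argument is the base address, which the second `refl` fixes as the bound of
    -- `input-length`.
    (run-algo (encode G J) (Graph.#edges G) _ refl refl (Positions.input-length G J) A c (Answers G) (correct G J))

theorem1 : ∃[ P ] IdentifiesInLinearTime P OnNonrepetitiveCycle
theorem1 = pflat (whole algorithm) 0 , identifies algorithm constant Correctness.solved
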